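{- Let $n\ge1$, let $\lambda$ be a partition with at most $n$ nonzero parts, let $T\in\mathrm{GT}(\lambda)$ and let $\mathrm{rsort}^{ -1}(T)=\{F\in\mathrm{CSF}(\lambda):\mathrm{rsort}(F)=T\}$. Then (1) $\displaystyle\sum_{F\in\mathrm{rsort}^{ -1}(T)}q^{\mathrm{inv}(F)}=\sum_{F\in\mathrm{rsort}^{ -1}(T)}q^{\mathrm{quinv}(F)}=\mathrm{wt}_q(T)$; (2) $\mathrm{inv}(F)+\mathrm{quinv}(F)=\mathrm{area}(T)$ for all $F\in\mathrm{rsort}^{ -1}(T)$; in particular the sum is constant on $\mathrm{rsort}^{ -1}(T)$.
   Context: The Young diagram of $\lambda$ is $\mathrm{dg}(\lambda)=\{(r,c):1\le c\le\lambda_r\}$, with $r$ the row index from the top and $c$ the column index from the left. $\mathrm{CSF}(\lambda)$ is the set of column strict fillings: maps $F:\mathrm{dg}(\lambda)\to[n]=\{1,\dots,n\}$ strictly increasing down each column. For a cell $u=(i,j)$ with $i>1$ let $u^\uparrow=(i-1,j)$; $\mathrm{Des}(F)$ is the set of cells $u$ not in the first row with $F(u)>F(u^\uparrow)$; $\mathrm{arm}(u)$ is the number of cells of $\mathrm{dg}(\lambda)$ strictly to the right of $u$ in its row. A cell $u$ Inv-attacks $v$ if they are in the same row with $u$ strictly left of $v$, or $u$ is in the row immediately below that of $v$, in a column strictly to the right of that of $v$. A cell $u$ Quinv-attacks $v$ if they are in the same row with $u$ strictly right of $v$, or $u$ is in the row immediately below that of $v$, in a column strictly to the left of that of $v$.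 $\mathrm{Inv}(F)$ (resp. $\mathrm{Quinv}(F)$) is the set of pairs $(u,v)$ such that $u$ Inv-attacks (resp. Quinv-attacks) $v$ and $F(u)>F(v)$. Then $\mathrm{inv}(F)=|\mathrm{Inv}(F)|-\sum_{u\in\mathrm{Des}(F)}\mathrm{arm}(u)$ and $\mathrm{quinv}(F)=|\mathrm{Quinv}(F)|-\sum_{u\in\mathrm{Des}(F)}\mathrm{arm}(u^\uparrow)$. $\mathrm{GT}(\lambda)$ is the set of Gelfand-Tsetlin patterns: integer arrays $T=(T^j_i:1\le i\le j\le n)$ with $T^n_i=\lambda_i$ and, for $1\le i\le j<n$, $\mathrm{NE}_{ij}(T):=T^{j+1}_i-T^j_i\ge0$ and $\mathrm{SE}_{ij}(T):=T^j_i-T^{j+1}_{i+1}\ge0$. It is identified with the set of semistandard Young tableaux of shape $\lambda$ with entries in $[n]$ by letting $T^j_i$ be the number of cells of the $i$th row containing entries $\le j$. $\mathrm{rsort}(F)$ is obtained from $F$ by sorting the entries of each row in ascending order from left to right; it is a semistandard tableau, regarded as an element of $\mathrm{GT}(\lambda)$. With ${a\brack b}_q$ the $q$-binomial coefficient, $\mathrm{wt}_q(T)=\prod_{1\le i\le j<n}{\mathrm{NE}_{ij}(T)+\mathrm{SE}_{ij}(T)\brack\mathrm{NE}_{ij}(T)}_q$. Also $\mathrm{area}(T)=\sum_{1\le i\le j<n}\mathrm{NE}_{ij}(T)\,\mathrm{SE}_{ij}(T)$. -}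

module Defs where

open import Data.Fin as Fin using (Fin; toℕ)
open import Data.Fin.Properties as Fin using (all?; ≤-decTotalOrder)
open import Data.Integer as ℤ using (ℤ; +_; 0ℤ; ∣_∣)
import Data.Integer.Properties as ℤ
open import Data.List using (List; []; _∷_; [_]; _++_; map; foldr; length; filter;
  concatMap; upTo; allFin; cartesianProduct; cartesianProductWith)
open import Data.List.Properties using (map-id; map-cong; map-∘; map-++; ++-identityʳ;
  cartesianProductWith-zeroʳ; cartesianProductWith-distribʳ-++)
open import Data.List.Relation.Binary.Permutation.Propositional
  using (_↭_; ↭-refl; ↭-sym; ↭-trans; ↭-reflexive; prep; module PermutationReasoning)
open import Data.List.Relation.Binary.Permutation.Propositional.Properties
  using (↭-length; filter-↭; map⁺; ++⁺; ++⁺ˡ; ++⁺ʳ; ++-assoc; shifts)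
open import Data.List.Sort using (sort; sort-↭)
open import Data.Nat.ListAction using (sum)
open import Data.Nat as ℕ using (ℕ; zero; suc; _∸_; _≤_; _<_)
import Data.Nat.Properties as ℕ
open import Data.Product using (_×_; _,_)
open import Data.Sum using (_⊎_)
open import Data.Vec as Vec using (Vec; []; _∷_; lookup; toList; fromList)
open import Data.Vec.Properties using (length-toList)
open import Data.Vec.Relation.Unary.All as All using (All; []; _∷_)
open import Data.Vec.Relation.Unary.All.Properties using (lookup⁺)
open import Relation.Binary.PropositionalEquality
  using (_≡_; refl; sym; trans; cong; cong₂; module ≡-Reasoning)
open import Relation.Nullary using (Dec)
open import Relation.Nullary.Decidable using (_×-dec_; _⊎-dec_; _→-dec_)
open import Relation.Unary using (Decidable)

-- A polynomial is given by the exponents of its monomials, each exponent being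
-- repeated as often as its coefficient says; the order is irrelevant for _≈_.
Laurent : Set
Laurent = List ℤ

coeff : Laurent → ℤ → ℕ
coeff f k = length (filter (k ℤ.≟_) f)

infix 4 _≈_
_≈_ : Laurent → Laurent → Set
f ≈ g = ∀ k → coeff f k ≡ coeff g k

q^_ : ℤ → Laurent
q^ k = [ k ]

infixl 6 _⊕_
_⊕_ : Laurent → Laurent → Laurent
_⊕_ = _++_

infixl 7 _⊗_
_⊗_ : Laurent → Laurent → Laurent
_⊗_ = cartesianProductWith ℤ._+_

𝟘 𝟙 : Laurent
𝟘 = []
𝟙 = q^ 0ℤ

∑-syntax : {A : Set} → List A → (A → Laurent) → Laurent
∑-syntax xs f = foldr _⊕_ 𝟘 (map f xs)

infix 5 ∑-syntax
syntax ∑-syntax xs (λ x → e) = ∑[ x ∈ xs ] e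

∏-syntax : {A : Set} → List A → (A → Laurent) → Laurent
∏-syntax xs f = foldr _⊗_ 𝟙 (map f xs)

infix 5 ∏-syntax
syntax ∏-syntax xs (λ x → e) = ∏[ x ∈ xs ] e

-- The q-Pascal recursion; qBinomial-factorial below shows that this is the usual
-- quotient of q-factorials.
qBinomial : ℕ → ℕ → Laurent
qBinomial _       zero    = 𝟙
qBinomial zero    (suc _) = 𝟘
qBinomial (suc a) (suc b) = qBinomial a b ⊕ q^ (+ suc b) ⊗ qBinomial a (suc b)

qInt : ℕ → Laurent
qInt zero    = 𝟘
qInt (suc m) = qInt m ⊕ q^ (+ m)

qFactorial : ℕ → Laurent
qFactorial zero    = 𝟙
qFactorial (suc m) = qInt (suc m) ⊗ qFactorial m

-- λ₁ ≥ … ≥ λₙ ≥ 0 as a vector of length n, that is, a partition with at most n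
-- nonzero parts padded by zeros.
IsPartition : ∀ {n} → Vec ℕ n → Set
IsPartition lam = ∀ i j → i Fin.≤ j → lookup lam j ≤ lookup lam i

-- Rows, columns and entries are counted from 0 here: row i, column c, entry e
-- stand for i+1, c+1, e+1.
record Cell {m} (lam : Vec ℕ m) : Set where
  constructor cell
  field
    r : Fin m
    c : Fin (lookup lam r)

  row col : ℕ
  row = toℕ r
  col = toℕ c

open Cell public using (row; col)

dg : ∀ {m} (lam : Vec ℕ m) → List (Cell lam)
dg {m} lam = concatMap (λ r → map (cell r) (allFin (lookup lam r))) (allFin m)

-- A map dg(λ) → Fin n, stored row by row.
Filling : ℕ → ∀ {m} → Vec ℕ m → Set
Filling n lam = All (Vec (Fin n)) lam

infix 9 _⟨_⟩
_⟨_⟩ : ∀ {n m} {lam : Vec ℕ m} → Filling n lam → Cell lam → Fin n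
F ⟨ cell r c ⟩ = lookup (lookup⁺ F r) c

allRows : ∀ n k → List (Vec (Fin n) k)
allRows n zero    = [ [] ]
allRows n (suc k) = cartesianProductWith _∷_ (allFin n) (allRows n k)

allFillings : ∀ n {m} (lam : Vec ℕ m) → List (Filling n lam)
allFillings n []        = [ [] ]
allFillings n (l ∷ lam) = cartesianProductWith _∷_ (allRows n l) (allFillings n lam)

ColumnStrict : ∀ {n m} {lam : Vec ℕ m} → Filling n lam → Set
ColumnStrict {lam = lam} F =
  ∀ r c r′ c′ → toℕ c ≡ toℕ c′ → r Fin.< r′ → F ⟨ cell r c ⟩ Fin.< F ⟨ cell r′ c′ ⟩

columnStrict? : ∀ {n m} {lam : Vec ℕ m} → Decidable (ColumnStrict {n} {lam = lam})
columnStrict? F = all? λ r → all? λ c → all? λ r′ → all? λ c′ →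
  (toℕ c ℕ.≟ toℕ c′) →-dec ((r Fin.<? r′) →-dec (F ⟨ cell r c ⟩ Fin.<? F ⟨ cell r′ c′ ⟩))

arm : ∀ {m} {lam : Vec ℕ m} → Cell lam → ℕ
arm {lam = lam} u =
  length (filter (λ v → (row v ℕ.≟ row u) ×-dec (col u ℕ.<? col v)) (dg lam))

_isAbove_ : ∀ {m} {lam : Vec ℕ m} → Cell lam → Cell lam → Set
v isAbove u = row u ≡ suc (row v) × col u ≡ col v

InvAttacks QuinvAttacks : ∀ {m} {lam : Vec ℕ m} → Cell lam → Cell lam → Set
InvAttacks   u v = (row u ≡ row v × col u < col v) ⊎ (row u ≡ suc (row v) × col v < col u)
QuinvAttacks u v = (row u ≡ row v × col v < col u) ⊎ (row u ≡ suc (row v) × col u < col v)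

isAbove? : ∀ {m} {lam : Vec ℕ m} (v u : Cell lam) → Dec (v isAbove u)
isAbove? v u = (row u ℕ.≟ suc (row v)) ×-dec (col u ℕ.≟ col v)

invAttacks? : ∀ {m} {lam : Vec ℕ m} (u v : Cell lam) → Dec (InvAttacks u v)
invAttacks? u v = ((row u ℕ.≟ row v) ×-dec (col u ℕ.<? col v))
  ⊎-dec ((row u ℕ.≟ suc (row v)) ×-dec (col v ℕ.<? col u))

quinvAttacks? : ∀ {m} {lam : Vec ℕ m} (u v : Cell lam) → Dec (QuinvAttacks u v)
quinvAttacks? u v = ((row u ℕ.≟ row v) ×-dec (col v ℕ.<? col u))
  ⊎-dec ((row u ℕ.≟ suc (row v)) ×-dec (col u ℕ.<? col v))

module _ {n m} {lam : Vec ℕ m} (F : Filling n lam) where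

  -- Each descent u is listed together with u↑, as the pair (u , u↑).
  Des : List (Cell lam × Cell lam)
  Des = filter (λ (u , v) → isAbove? v u ×-dec (F ⟨ v ⟩ Fin.<? F ⟨ u ⟩))
    (cartesianProduct (dg lam) (dg lam))

  Inv : List (Cell lam × Cell lam)
  Inv = filter (λ (u , v) → invAttacks? u v ×-dec (F ⟨ v ⟩ Fin.<? F ⟨ u ⟩))
    (cartesianProduct (dg lam) (dg lam))

  Quinv : List (Cell lam × Cell lam)
  Quinv = filter (λ (u , v) → quinvAttacks? u v ×-dec (F ⟨ v ⟩ Fin.<? F ⟨ u ⟩))
    (cartesianProduct (dg lam) (dg lam))

  inv : ℤ
  inv = + length Inv ℤ.- + sum (map (λ (u , u↑) → arm u) Des)

  quinv : ℤ
  quinv = + length Quinv ℤ.- + sum (map (λ (u , u↑) → arm u↑) Des)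

-- T j i is T^j_i with the usual indices 1 ≤ i ≤ j ≤ n; the values of T outside
-- this range are never used.
Array : Set
Array = ℕ → ℕ → ℤ

NE SE : Array → ℕ → ℕ → ℤ
NE T i j = T (suc j) i ℤ.- T j i
SE T i j = T j i ℤ.- T (suc j) (suc i)

record GT {n} (lam : Vec ℕ n) : Set where
  field
    entry  : Array
    top    : ∀ (i : Fin n) → entry n (suc (toℕ i)) ≡ + lookup lam i
    NE-≥0  : ∀ i j → 1 ≤ i → i ≤ j → j < n → NE entry i j ℤ.≥ 0ℤ
    SE-≥0  : ∀ i j → 1 ≤ i → i ≤ j → j < n → SE entry i j ℤ.≥ 0ℤ

open GT public using (entry)

1…_ : ℕ → List ℕ
1… m = map suc (upTo m)

-- The pairs (i , j) with 1 ≤ i ≤ j < n.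
triangle : ℕ → List (ℕ × ℕ)
triangle n = concatMap (λ j → map (_, j) (1… j)) (1… (n ∸ 1))

wtFactor : Array → ℕ × ℕ → Laurent
wtFactor T (i , j) = qBinomial ∣ NE T i j ℤ.+ SE T i j ∣ ∣ NE T i j ∣

wt-q : ∀ {n} {lam : Vec ℕ n} → GT lam → Laurent
wt-q {n} T = ∏[ ij ∈ triangle n ] wtFactor (entry T) ij

area : ∀ {n} {lam : Vec ℕ n} → GT lam → ℤ
area {n} T = foldr ℤ._+_ 0ℤ
  (map (λ (i , j) → NE (entry T) i j ℤ.* SE (entry T) i j) (triangle n))

sortRow : ∀ {n k} → Vec (Fin n) k → Vec (Fin n) k
sortRow {n} xs = Vec.cast
  (trans (↭-length (sort-↭ (≤-decTotalOrder n) (toList xs))) (length-toList xs))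
  (fromList (sort (≤-decTotalOrder n) (toList xs)))

rsort : ∀ {n m} {lam : Vec ℕ m} → Filling n lam → Filling n lam
rsort = All.map sortRow

-- The number of cells in row i of F whose entry is at most j (as usual, for
-- j : Fin n read as j+1).
entries≤ : ∀ {n m} {lam : Vec ℕ m} → Filling n lam → Fin n → Fin m → ℕ
entries≤ {lam = lam} F j i =
  length (filter (λ c → F ⟨ cell i c ⟩ Fin.≤? j) (allFin (lookup lam i)))

-- The semistandard tableau S is the Gelfand–Tsetlin pattern T.
Represents : ∀ {n} {lam : Vec ℕ n} → Filling n lam → GT lam → Set
Represents S T = ∀ i j → i Fin.≤ j →
  entry T (suc (toℕ j)) (suc (toℕ i)) ≡ + entries≤ S j i

represents? : ∀ {n} {lam : Vec ℕ n} (S : Filling n lam) (T : GT lam) → Dec (Represents S T)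
represents? S T = all? λ i → all? λ j → (i Fin.≤? j) →-dec
  (entry T (suc (toℕ j)) (suc (toℕ i)) ℤ.≟ + entries≤ S j i)

InFibre : ∀ {n} {lam : Vec ℕ n} → GT lam → Filling n lam → Set
InFibre T F = ColumnStrict F × Represents (rsort F) T

rsort⁻¹ : ∀ {n} {lam : Vec ℕ n} → GT lam → List (Filling n lam)
rsort⁻¹ {n} {lam} T =
  filter (λ F → columnStrict? F ×-dec represents? (rsort F) T) (allFillings n lam)

↭⇒≈ : ∀ {f g} → f ↭ g → f ≈ g
↭⇒≈ p k = ↭-length (filter-↭ (k ℤ.≟_) p)

shift-⊗ : ∀ x g h → map (ℤ._+_ x) g ⊗ h ≡ map (ℤ._+_ x) (g ⊗ h)
shift-⊗ x []      h = refl
shift-⊗ x (y ∷ g) h = begin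
  map (ℤ._+_ (x ℤ.+ y)) h ++ map (ℤ._+_ x) g ⊗ h
    ≡⟨ cong₂ _++_ (trans (map-cong (ℤ.+-assoc x y) h) (map-∘ h)) (shift-⊗ x g h) ⟩
  map (ℤ._+_ x) (map (ℤ._+_ y) h) ++ map (ℤ._+_ x) (g ⊗ h)
    ≡⟨ map-++ (ℤ._+_ x) (map (ℤ._+_ y) h) (g ⊗ h) ⟨
  map (ℤ._+_ x) (map (ℤ._+_ y) h ++ g ⊗ h) ∎
  where open ≡-Reasoning

⊗-distribʳ : ∀ f g h → (f ⊕ g) ⊗ h ≡ f ⊗ h ⊕ g ⊗ h
⊗-distribʳ = cartesianProductWith-distribʳ-++ ℤ._+_

⊗-assoc : ∀ f g h → (f ⊗ g) ⊗ h ≡ f ⊗ (g ⊗ h)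
⊗-assoc []      g h = refl
⊗-assoc (x ∷ f) g h = trans (⊗-distribʳ (map (ℤ._+_ x) g) (f ⊗ g) h)
  (cong₂ _++_ (shift-⊗ x g h) (⊗-assoc f g h))

⊗-identityˡ : ∀ f → 𝟙 ⊗ f ≡ f
⊗-identityˡ f = trans (++-identityʳ _) (trans (map-cong ℤ.+-identityˡ f) (map-id f))

⊗-∷ʳ : ∀ f y g → f ⊗ (y ∷ g) ↭ map (ℤ._+_ y) f ++ f ⊗ g
⊗-∷ʳ []      y g = ↭-refl
⊗-∷ʳ (x ∷ f) y g = ↭-trans
  (↭-reflexive (cong (_∷ (map (ℤ._+_ x) g ++ f ⊗ (y ∷ g))) (ℤ.+-comm x y)))
  (prep (y ℤ.+ x) (↭-trans (++⁺ˡ (map (ℤ._+_ x) g) (⊗-∷ʳ f y g))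
    (shifts (map (ℤ._+_ x) g) (map (ℤ._+_ y) f))))

⊗-comm : ∀ f g → f ⊗ g ↭ g ⊗ f
⊗-comm f []      = ↭-reflexive (cartesianProductWith-zeroʳ ℤ._+_ f)
⊗-comm f (y ∷ g) = ↭-trans (⊗-∷ʳ f y g) (++⁺ˡ (map (ℤ._+_ y) f) (⊗-comm f g))

⊗-congˡ : ∀ f {g h} → g ↭ h → f ⊗ g ↭ f ⊗ h
⊗-congˡ []      p = ↭-refl
⊗-congˡ (x ∷ f) p = ++⁺ (map⁺ (ℤ._+_ x) p) (⊗-congˡ f p)

⊗-congʳ : ∀ {f g} h → f ↭ g → f ⊗ h ↭ g ⊗ h
⊗-congʳ {f} {g} h p = ↭-trans (⊗-comm f h) (↭-trans (⊗-congˡ h p) (⊗-comm h g))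

⊗-distribˡ : ∀ f g h → f ⊗ (g ⊕ h) ↭ f ⊗ g ⊕ f ⊗ h
⊗-distribˡ f g h = ↭-trans (⊗-comm f (g ⊕ h))
  (↭-trans (↭-reflexive (⊗-distribʳ g h f)) (++⁺ (⊗-comm g f) (⊗-comm h f)))

⊗-swapˡ : ∀ f g h → f ⊗ (g ⊗ h) ↭ g ⊗ (f ⊗ h)
⊗-swapˡ f g h = ↭-trans (↭-reflexive (sym (⊗-assoc f g h)))
  (↭-trans (⊗-congʳ h (⊗-comm f g)) (↭-reflexive (⊗-assoc g f h)))

qInt-+ : ∀ a b → qInt b ⊕ q^ (+ b) ⊗ qInt a ↭ qInt (b ℕ.+ a)
qInt-+ zero    b rewrite ℕ.+-identityʳ b = ↭-reflexive (++-identityʳ _)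
qInt-+ (suc a) b rewrite ℕ.+-suc b a = ↭-trans
  (++⁺ˡ (qInt b) (⊗-distribˡ (q^ (+ b)) (qInt a) (q^ (+ a))))
  (↭-trans (↭-sym (++-assoc (qInt b) _ _)) (++⁺ʳ _ (qInt-+ a b)))

qBinomial-> : ∀ {a b} → a < b → qBinomial a b ≡ 𝟘
qBinomial-> {zero}  {suc b} _         = refl
qBinomial-> {suc a} {suc b} (ℕ.s≤s p)
  rewrite qBinomial-> p | qBinomial-> (ℕ.m<n⇒m<1+n p) = refl

qBinomial-diag : ∀ a → qBinomial a a ↭ 𝟙
qBinomial-diag zero    = ↭-refl
qBinomial-diag (suc a) rewrite qBinomial-> (ℕ.n<1+n a) =
  ↭-trans (↭-reflexive (++-identityʳ _)) (qBinomial-diag a)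

qBinomial-factorial-↭ : ∀ b a → qFactorial b ⊗ (qFactorial a ⊗ qBinomial (b ℕ.+ a) b)
  ↭ qFactorial (b ℕ.+ a)
qBinomial-factorial-↭ zero a = ↭-trans (↭-reflexive (⊗-identityˡ _))
  (↭-trans (⊗-comm (qFactorial a) 𝟙) (↭-reflexive (⊗-identityˡ _)))
qBinomial-factorial-↭ (suc b) zero rewrite ℕ.+-identityʳ b = ↭-trans
  (⊗-congˡ (qFactorial (suc b))
    (↭-trans (↭-reflexive (⊗-identityˡ _)) (qBinomial-diag (suc b))))
  (↭-trans (⊗-comm (qFactorial (suc b)) 𝟙) (↭-reflexive (⊗-identityˡ _)))
qBinomial-factorial-↭ (suc b) (suc a) = begin
  B! ⊗ (A! ⊗ (P ⊕ Q ⊗ R))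
    ↭⟨ ⊗-congˡ B! (⊗-distribˡ A! P (Q ⊗ R)) ⟩
  B! ⊗ (A! ⊗ P ⊕ A! ⊗ (Q ⊗ R))
    ↭⟨ ⊗-distribˡ B! (A! ⊗ P) (A! ⊗ (Q ⊗ R)) ⟩
  B! ⊗ (A! ⊗ P) ⊕ B! ⊗ (A! ⊗ (Q ⊗ R))
    ↭⟨ ++⁺ left right ⟩
  qInt (suc b) ⊗ N! ⊕ (Q ⊗ qInt (suc a)) ⊗ N!
    ≡⟨ ⊗-distribʳ (qInt (suc b)) (Q ⊗ qInt (suc a)) N! ⟨
  (qInt (suc b) ⊕ Q ⊗ qInt (suc a)) ⊗ N!
    ↭⟨ ⊗-congʳ N! (qInt-+ (suc a) (suc b)) ⟩
  qInt (suc b ℕ.+ suc a) ⊗ N! ∎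
  where
  open PermutationReasoning
  A! = qFactorial (suc a)
  B! = qFactorial (suc b)
  N! = qFactorial (b ℕ.+ suc a)
  P  = qBinomial (b ℕ.+ suc a) b
  Q  = q^ (+ suc b)
  R  = qBinomial (b ℕ.+ suc a) (suc b)

  left : B! ⊗ (A! ⊗ P) ↭ qInt (suc b) ⊗ N!
  left = ↭-trans (↭-reflexive (⊗-assoc (qInt (suc b)) (qFactorial b) (A! ⊗ P)))
    (⊗-congˡ (qInt (suc b)) (qBinomial-factorial-↭ b (suc a)))

  ih : B! ⊗ (qFactorial a ⊗ R) ↭ N!
  ih rewrite ℕ.+-suc b a = qBinomial-factorial-↭ (suc b) a

  right : B! ⊗ (A! ⊗ (Q ⊗ R)) ↭ (Q ⊗ qInt (suc a)) ⊗ N!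
  right = begin
    B! ⊗ (A! ⊗ (Q ⊗ R))
      ↭⟨ ⊗-congˡ B! (⊗-swapˡ A! Q R) ⟩
    B! ⊗ (Q ⊗ (A! ⊗ R))
      ↭⟨ ⊗-swapˡ B! Q (A! ⊗ R) ⟩
    Q ⊗ (B! ⊗ (A! ⊗ R))
      ≡⟨ cong (λ e → Q ⊗ (B! ⊗ e)) (⊗-assoc (qInt (suc a)) (qFactorial a) R) ⟩
    Q ⊗ (B! ⊗ (qInt (suc a) ⊗ (qFactorial a ⊗ R)))
      ↭⟨ ⊗-congˡ Q (⊗-swapˡ B! (qInt (suc a)) (qFactorial a ⊗ R)) ⟩
    Q ⊗ (qInt (suc a) ⊗ (B! ⊗ (qFactorial a ⊗ R)))
      ↭⟨ ⊗-congˡ Q (⊗-congˡ (qInt (suc a)) ih) ⟩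
    Q ⊗ (qInt (suc a) ⊗ N!)
      ≡⟨ ⊗-assoc Q (qInt (suc a)) N! ⟨
    (Q ⊗ qInt (suc a)) ⊗ N! ∎

qBinomial-factorial : ∀ b a →
  qFactorial b ⊗ (qFactorial a ⊗ qBinomial (b ℕ.+ a) b) ≈ qFactorial (b ℕ.+ a)
qBinomial-factorial b a = ↭⇒≈ (qBinomial-factorial-↭ b a)

module Submission where

-- Let h_c(v) be the number of entries of column c that are at most v.  Counting attacks
-- pair by pair of columns and sorting them by value shows that inv F is the number of
-- triples (v, c < d) with h_c(v) = h_d(v) such that v lies in column c but not in
-- column d, and quinv F the same with c and d exchanged: the arms count all attacking
-- pairs in consecutive rows, so what remains of the inversions there is minus the number
-- of non-inversions.  The Gelfand–Tsetlin pattern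
-- T of F records how often each height occurs on each level v, so going from level
-- v = j + 1 to level j one chooses, independently for every i, which NE_ij of the
-- NE_ij + SE_ij columns of height i contain v.  Each choice is a binary word with its
-- inversions (or coinversions) as weight, which gives the q-binomial coefficients, and the
-- pairs counted by inv or by quinv are NE_ij SE_ij in number, which gives the area.

open import Defs
open import Data.Bool as Bool using (Bool; true; false; _∧_; _∨_)
open import Data.Bool.Properties using (T-∧)
open import Data.Empty using (⊥-elim)
open import Data.Fin as Fin using (Fin; toℕ; fromℕ<)
import Data.Fin.Properties as Fin
open import Data.Integer as ℤ using (ℤ; 0ℤ; ∣_∣)
import Data.Integer.Properties as ℤ
open import Data.List using (List; []; _∷_; _++_; map; foldr; length; filter; concatMap;
  tabulate; allFin; cartesianProduct; applyUpTo; upTo)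
open import Data.List.Membership.Propositional using (_∈_; find; lose)
open import Data.List.Membership.Propositional.Properties using (∈-map⁺; ∈-map⁻; ∈-++⁺ˡ;
  ∈-++⁺ʳ; ∈-++⁻; ∈-concatMap⁺; ∈-concatMap⁻; ∈-filter⁺; ∈-filter⁻; ∈-allFin;
  ∈-cartesianProductWith⁺)
open import Data.List.Membership.Propositional.Properties.WithK using (unique∧set⇒bag)
open import Data.List.Properties using (map-++; map-tabulate; map-∘; map-cong; map-cong-local;
  map-applyUpTo; ++-identityʳ; concatMap-++; upTo-∷ʳ; ∷-injectiveˡ; ∷-injectiveʳ)
open import Data.List.Relation.Binary.BagAndSetEquality using (∼bag⇒↭)
open import Data.List.Relation.Binary.Permutation.Propositional
  using (_↭_; ↭-refl; ↭-sym; ↭-trans; ↭-reflexive; module PermutationReasoning)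
open import Data.List.Relation.Binary.Permutation.Propositional.Properties
  using (++⁺; ++⁺ˡ; map⁺; ++-assoc; shifts; ↭-length; filter-↭)
open import Data.List.Relation.Binary.Pointwise using (Pointwise; []; _∷_)
open import Data.List.Relation.Unary.All as All using (All; []; _∷_)
open import Data.List.Relation.Unary.All.Properties using (applyUpTo⁻)
open import Data.List.Relation.Unary.Any using (here; there)
open import Data.List.Relation.Unary.Unique.Propositional using (Unique; []; _∷_)
import Data.List.Relation.Unary.Unique.Propositional.Properties as Unique
open import Data.List.Sort using (sort-↭)
open import Data.Nat as ℕ
  using (ℕ; zero; suc; pred; _+_; _*_; _∸_; _≤_; _<_; _≥_; z≤n; s≤s; _<ᵇ_; _≡ᵇ_)
open import Data.Nat.ListAction using (sum)
open import Data.Nat.ListAction.Properties using (sum-++)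
import Data.Nat.Properties as ℕ
open import Data.Nat.Tactic.RingSolver using (solve-∀)
open import Data.Product using (_×_; _,_; ∃; proj₁; proj₂)
open import Data.Sum using (_⊎_; inj₁; inj₂)
open import Data.Vec as Vec using (Vec; []; _∷_; lookup; toList)
import Data.Vec.Properties as Vec
open import Data.Vec.Relation.Unary.All using ([]; _∷_)
open import Data.Vec.Relation.Unary.All.Properties using (lookup⁺; lookup⁻)
open import Function using (_∘_; id; mk⇔; Equivalence)
open import Level using (0ℓ)
open import Relation.Binary.PropositionalEquality
open import Relation.Nullary using (Dec; yes; no; ¬_; does)
open import Relation.Nullary.Decidable using (does-⇔; dec-true; dec-false; _×-dec_)
open import Relation.Unary using (Pred; Decidable)

-- Finite sums of indicators

-- Everything is expressed through heights `η c v` for levels `0 ≤ v ≤ n`. Giving missing cells the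
-- entry `n` makes "the entry in row `r` is below `v`" equivalent to `r < η c v` for all rows and
-- all `v ≤ n`, including level `n`, where the heights are the column lengths. Sums over cells
-- become sums over a rectangle weighted by an indicator, and inv and quinv differ only in the order
-- imposed on the two columns. A row of the pattern gives the numbers of columns of height at least
-- `i`. Adding the index `i = 0`, where this number is constant, makes the columns of height 0 one
-- more class. Each level then has two boundary classes outside the triangle, both with q-binomial
-- factor 1 and area 0. The sum over all continuations below a level depends only on the pattern and
-- not on the heights already chosen, so the sum over chains factors level by level.

⟦_⟧ : Bool → ℕ
⟦ true ⟧  = 1
⟦ false ⟧ = 0

⟦∧⟧ : ∀ a b → ⟦ a ∧ b ⟧ ≡ ⟦ a ⟧ * ⟦ b ⟧
⟦∧⟧ true  b = sym (ℕ.*-identityˡ _)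
⟦∧⟧ false b = refl

<ᵇ-cong : ∀ {a b c d} → (a < b → c < d) → (c < d → a < b) → (a <ᵇ b) ≡ (c <ᵇ d)
<ᵇ-cong {a} {b} {c} {d} f g = does-⇔ (mk⇔ f g) (a ℕ.<? b) (c ℕ.<? d)

<ᵇ-true : ∀ {a b} → a < b → (a <ᵇ b) ≡ true
<ᵇ-true {a} {b} = dec-true (a ℕ.<? b)

<ᵇ-false : ∀ {a b} → b ≤ a → (a <ᵇ b) ≡ false
<ᵇ-false {a} {b} p = dec-false (a ℕ.<? b) (ℕ.≤⇒≯ p)

<ᵇ-transport : ∀ {a b c d} → (a <ᵇ b) ≡ (c <ᵇ d) → a < b → c < d
<ᵇ-transport {a} {b} {c} {d} eq p = ℕ.<ᵇ⇒< c d (subst Bool.T eq (ℕ.<⇒<ᵇ p))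

≡ᵇ-refl : ∀ a → (a ≡ᵇ a) ≡ true
≡ᵇ-refl a = dec-true (a ℕ.≟ a) refl

≡ᵇ-false : ∀ {a b} → a ≢ b → (a ≡ᵇ b) ≡ false
≡ᵇ-false {a} {b} = dec-false (a ℕ.≟ b)

≡ᵇ-sym : ∀ a b → (a ≡ᵇ b) ≡ (b ≡ᵇ a)
≡ᵇ-sym a b = does-⇔ (mk⇔ sym sym) (a ℕ.≟ b) (b ℕ.≟ a)

<ᵇ-suc : ∀ x v → ⟦ x <ᵇ suc v ⟧ ≡ ⟦ v ≡ᵇ x ⟧ + ⟦ x <ᵇ v ⟧
<ᵇ-suc zero    zero    = refl
<ᵇ-suc zero    (suc v) = refl
<ᵇ-suc (suc x) zero    = refl
<ᵇ-suc (suc x) (suc v) = <ᵇ-suc x v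

<ᵇ-dichotomy : ∀ x y → ⟦ x <ᵇ y ⟧ + ⟦ y <ᵇ suc x ⟧ ≡ 1
<ᵇ-dichotomy zero    zero    = refl
<ᵇ-dichotomy zero    (suc y) = refl
<ᵇ-dichotomy (suc x) zero    = refl
<ᵇ-dichotomy (suc x) (suc y) = <ᵇ-dichotomy x y

Σ< : ℕ → (ℕ → ℕ) → ℕ
Σ< zero    f = 0
Σ< (suc n) f = f 0 + Σ< n (f ∘ suc)

Σ-cong : ∀ n {f g} → (∀ i → i < n → f i ≡ g i) → Σ< n f ≡ Σ< n g
Σ-cong zero    eq = refl
Σ-cong (suc n) eq = cong₂ _+_ (eq 0 (s≤s z≤n)) (Σ-cong n (λ i p → eq (suc i) (s≤s p)))

Σ-cong′ : ∀ n {f g} → (∀ i → f i ≡ g i) → Σ< n f ≡ Σ< n g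
Σ-cong′ n eq = Σ-cong n (λ i _ → eq i)

Σ-zero : ∀ n {f} → (∀ i → f i ≡ 0) → Σ< n f ≡ 0
Σ-zero zero    eq = refl
Σ-zero (suc n) eq = cong₂ _+_ (eq 0) (Σ-zero n (eq ∘ suc))

Σ-+ : ∀ n f g → Σ< n (λ i → f i + g i) ≡ Σ< n f + Σ< n g
Σ-+ zero    f g = refl
Σ-+ (suc n) f g rewrite Σ-+ n (f ∘ suc) (g ∘ suc) =
  lemma (f 0) (g 0) (Σ< n (f ∘ suc)) (Σ< n (g ∘ suc))
  where
  lemma : ∀ a b c d → (a + b) + (c + d) ≡ (a + c) + (b + d)
  lemma = solve-∀

Σ-* : ∀ n a f → a * Σ< n f ≡ Σ< n (λ i → a * f i)
Σ-* zero    a f = ℕ.*-zeroʳ a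
Σ-* (suc n) a f =
  trans (ℕ.*-distribˡ-+ a (f 0) _) (cong (a * f 0 +_) (Σ-* n a (f ∘ suc)))

Σ-swap : ∀ m n (f : ℕ → ℕ → ℕ) →
  Σ< m (λ i → Σ< n (f i)) ≡ Σ< n (λ j → Σ< m (λ i → f i j))
Σ-swap zero    n f = sym (Σ-zero n (λ _ → refl))
Σ-swap (suc m) n f = trans (cong (Σ< n (f 0) +_) (Σ-swap m n (f ∘ suc)))
  (sym (Σ-+ n (f 0) (λ j → Σ< m (λ i → f (suc i) j))))

Σ-δ : ∀ n a (f : ℕ → ℕ) → (n ≤ a → f a ≡ 0) → Σ< n (λ i → ⟦ i ≡ᵇ a ⟧ * f i) ≡ f a
Σ-δ zero    a       f out = sym (out z≤n)
Σ-δ (suc n) zero    f out = trans (cong (f 0 + 0 +_) (Σ-zero n (λ _ → refl)))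
  (trans (ℕ.+-identityʳ _) (ℕ.+-identityʳ _))
Σ-δ (suc n) (suc a) f out = Σ-δ n a (f ∘ suc) (out ∘ s≤s)

Σ-δ′ : ∀ n a (f : ℕ → ℕ) → (n ≤ a → f a ≡ 0) → Σ< n (λ i → ⟦ a ≡ᵇ i ⟧ * f i) ≡ f a
Σ-δ′ n a f out =
  trans (Σ-cong′ n (λ i → cong (λ b → ⟦ b ⟧ * f i) (≡ᵇ-sym a i))) (Σ-δ n a f out)

-- If `P 0` fails, nothing holds and the count is 0; otherwise both sides lose the index 0. This
-- turns a count into a threshold for heights, for column lengths and for the entries rebuilt from
-- heights.
initialSegment : ∀ N (P : ℕ → Bool) → (∀ i → Bool.T (P (suc i)) → Bool.T (P i)) →
  (∀ i → N ≤ i → P i ≡ false) → ∀ i → P i ≡ (i <ᵇ Σ< N (λ j → ⟦ P j ⟧))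
initialSegment zero    P down out i = out i z≤n
initialSegment (suc N) P down out i with P 0 in P0
... | false = subst (λ s → P i ≡ (i <ᵇ s)) (sym (Σ-zero N (λ j → cong ⟦_⟧ (none (suc j))))) (none i)
  where
  none : ∀ j → P j ≡ false
  none zero = P0
  none (suc j) with P (suc j) in Pj
  ... | false = refl
  ... | true  = ⊥-elim (subst Bool.T (none j) (down j (subst Bool.T (sym Pj) _)))
... | true with i
...   | zero   = P0
...   | suc i′ = initialSegment N (P ∘ suc) (down ∘ suc) (λ j p → out (suc j) (s≤s p)) i′

Σ-last : ∀ n f → Σ< (suc n) f ≡ f n + Σ< n f
Σ-last zero    f = refl
Σ-last (suc n) f = trans (cong (f 0 +_) (Σ-last n (f ∘ suc)))
  (lemma (f 0) (f (suc n)) (Σ< n (f ∘ suc)))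
  where
  lemma : ∀ a b c → a + (b + c) ≡ b + (a + c)
  lemma = solve-∀

-- Inversions between two columns

-- A strict column contains each value at most once, so its height changes by at most one between
-- levels. The upper level is the first argument.
Step : ℕ → ℕ → Set
Step a b = a ≡ b ⊎ a ≡ suc b

-- X i is the entry of row i of a column of length at most m with entries below n;
-- missing cells have an entry that is at least n. η v counts the entries below v,
-- so that X and η determine each other.
record Column (n m : ℕ) (X η : ℕ → ℕ) : Set where
  field
    galois : ∀ i v → v ≤ n → (X i <ᵇ v) ≡ (i <ᵇ η v)
    step   : ∀ v → v < n → Step (η (suc v)) (η v)
    bound  : ∀ v → v ≤ n → η v ≤ m

≡ᵇ-<ᵇ-disjoint : ∀ a b → ⟦ a ≡ᵇ b ⟧ * ⟦ a <ᵇ b ⟧ ≡ 0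
≡ᵇ-<ᵇ-disjoint zero    zero    = refl
≡ᵇ-<ᵇ-disjoint zero    (suc b) = refl
≡ᵇ-<ᵇ-disjoint (suc a) zero    = refl
≡ᵇ-<ᵇ-disjoint (suc a) (suc b) = ≡ᵇ-<ᵇ-disjoint a b

<ᵇ-split : ∀ a b → ⟦ a <ᵇ b ⟧ ≡ ⟦ suc a <ᵇ b ⟧ + ⟦ suc a ≡ᵇ b ⟧ * ⟦ a <ᵇ b ⟧
<ᵇ-split zero    zero          = refl
<ᵇ-split zero    (suc zero)    = refl
<ᵇ-split zero    (suc (suc b)) = refl
<ᵇ-split (suc a) zero          = refl
<ᵇ-split (suc a) (suc b)       = <ᵇ-split a b

-- If `b′ = suc b`, both comparisons agree and the correction asks for `a = b` and `a < b`. If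
-- `b′ = b`, the comparisons differ only at `b = suc a`, which is what the correction detects.
raised : ∀ a {b′ b} → Step b′ b →
  ⟦ a <ᵇ b ⟧ ≡ ⟦ suc a <ᵇ b′ ⟧ + ⟦ suc a ≡ᵇ b′ ⟧ * ⟦ a <ᵇ b ⟧
raised a {b′} (inj₁ refl) = <ᵇ-split a b′
raised a {b = b} (inj₂ refl) rewrite ≡ᵇ-<ᵇ-disjoint a b = sym (ℕ.+-identityʳ _)

unraised : ∀ a {b′ b} → Step b′ b → ⟦ a ≡ᵇ b′ ⟧ * ⟦ a <ᵇ b ⟧ ≡ 0
unraised a {b′} (inj₁ refl) = ≡ᵇ-<ᵇ-disjoint a b′
unraised a {b = b} (inj₂ refl) = suc-disjoint a b
  where
  suc-disjoint : ∀ a b → ⟦ a ≡ᵇ suc b ⟧ * ⟦ a <ᵇ b ⟧ ≡ 0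
  suc-disjoint zero          b       = refl
  suc-disjoint (suc a) zero          = ℕ.*-zeroʳ ⟦ a ≡ᵇ 0 ⟧
  suc-disjoint (suc a) (suc b)       = suc-disjoint a b

-- A missing cell has no value `v` below `n`; the factor `⟦ X i <ᵇ n ⟧` accounts for this.
byValue : ∀ n m (X : ℕ → ℕ) (f : ℕ → ℕ → ℕ) →
  Σ< m (λ i → ⟦ X i <ᵇ n ⟧ * f i (X i)) ≡ Σ< n (λ v → Σ< m (λ i → ⟦ v ≡ᵇ X i ⟧ * f i v))
byValue n m X f = trans (Σ-cong′ m (sym ∘ perRow)) (Σ-swap m n _)
  where
  perRow : ∀ i → Σ< n (λ v → ⟦ v ≡ᵇ X i ⟧ * f i v) ≡ ⟦ X i <ᵇ n ⟧ * f i (X i)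
  perRow i = trans
    (Σ-cong n (λ v v<n → cong (⟦ v ≡ᵇ X i ⟧ *_)
      (sym (trans (cong (λ b → ⟦ b ⟧ * f i v) (<ᵇ-true v<n)) (ℕ.*-identityˡ _)))))
    (Σ-δ n (X i) (λ v → ⟦ v <ᵇ n ⟧ * f i v)
      (λ n≤X → cong (λ b → ⟦ b ⟧ * f i (X i)) (<ᵇ-false n≤X)))

module _ {n m X η} (col : Column n m X η) {v} (v<n : v < n) where

  hasValue : ∀ i → ⟦ i <ᵇ η (suc v) ⟧ ≡ ⟦ v ≡ᵇ X i ⟧ + ⟦ i <ᵇ η v ⟧
  hasValue i = subst₂ (λ b c → ⟦ b ⟧ ≡ ⟦ v ≡ᵇ X i ⟧ + ⟦ c ⟧)
    (Column.galois col i (suc v) v<n) (Column.galois col i v (ℕ.<⇒≤ v<n)) (<ᵇ-suc (X i) v)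

  missingValue : η (suc v) ≡ η v → ∀ (g : ℕ → ℕ) → Σ< m (λ i → ⟦ v ≡ᵇ X i ⟧ * g i) ≡ 0
  missingValue eq g = Σ-zero m λ i → cong (_* g i) (ℕ.+-cancelʳ-≡ ⟦ i <ᵇ η v ⟧ _ 0
    (trans (sym (hasValue i)) (cong (λ h → ⟦ i <ᵇ h ⟧) eq)))

  -- The value `v` sits in row `η v`, directly under the `η v` smaller entries, and this row exists
  -- because `η (suc v)` is at most `m`.
  presentValue : η (suc v) ≡ suc (η v) → ∀ g → Σ< m (λ i → ⟦ v ≡ᵇ X i ⟧ * g i) ≡ g (η v)
  presentValue eq g = trans (Σ-cong′ m λ i → cong (_* g i) (at i))
    (Σ-δ′ m (η v) g (λ m≤η → ⊥-elim (ℕ.<⇒≱ (subst (_≤ m) eq (Column.bound col (suc v) v<n)) m≤η)))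
    where
    at : ∀ i → ⟦ v ≡ᵇ X i ⟧ ≡ ⟦ η v ≡ᵇ i ⟧
    at i = ℕ.+-cancelʳ-≡ ⟦ i <ᵇ η v ⟧ _ _ (trans (sym (hasValue i))
      (trans (cong (λ h → ⟦ i <ᵇ h ⟧) eq) (<ᵇ-suc i (η v))))

-- Under `Step` the two factors force `η` to rise at `v` and `θ` to stay: `v` belongs to the first
-- column only.
crossings : ℕ → (ℕ → ℕ) → (ℕ → ℕ) → ℕ
crossings n η θ = Σ< n (λ v → ⟦ η (suc v) ≡ᵇ θ (suc v) ⟧ * ⟦ η v <ᵇ θ v ⟧)

-- A value `v` of `X` lies in row `η v`, so the comparison within the row reads `η v < θ v` and the
-- weak one with the next row reads `suc (η v) < θ (suc v)`; `raised` gives their difference. For a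
-- value that `X` lacks, both sums are empty and `unraised` excludes a crossing.
columnPair : ∀ {n m X η Y θ} → Column n m X η → Column n m Y θ →
  Σ< m (λ i → ⟦ X i <ᵇ n ⟧ * ⟦ Y i <ᵇ X i ⟧)
    ≡ Σ< m (λ i → ⟦ X i <ᵇ n ⟧ * ⟦ Y (suc i) <ᵇ suc (X i) ⟧) + crossings n η θ
columnPair {n} {m} {X} {η} {Y} {θ} cX cY = begin
  Σ< m (λ i → ⟦ X i <ᵇ n ⟧ * ⟦ Y i <ᵇ X i ⟧)
    ≡⟨ byValue n m X (λ i v → ⟦ Y i <ᵇ v ⟧) ⟩
  Σ< n (λ v → Σ< m (λ i → ⟦ v ≡ᵇ X i ⟧ * ⟦ Y i <ᵇ v ⟧))
    ≡⟨ Σ-cong n (λ v p → level v p (Column.step cX v p)) ⟩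
  Σ< n (λ v → Σ< m (λ i → ⟦ v ≡ᵇ X i ⟧ * ⟦ Y (suc i) <ᵇ suc v ⟧) + c v)
    ≡⟨ Σ-+ n _ _ ⟩
  Σ< n (λ v → Σ< m (λ i → ⟦ v ≡ᵇ X i ⟧ * ⟦ Y (suc i) <ᵇ suc v ⟧)) + Σ< n c
    ≡⟨ cong (_+ Σ< n c) (byValue n m X (λ i v → ⟦ Y (suc i) <ᵇ suc v ⟧)) ⟨
  Σ< m (λ i → ⟦ X i <ᵇ n ⟧ * ⟦ Y (suc i) <ᵇ suc (X i) ⟧) + Σ< n c ∎
  where
  open ≡-Reasoning
  c : ℕ → ℕ
  c v = ⟦ η (suc v) ≡ᵇ θ (suc v) ⟧ * ⟦ η v <ᵇ θ v ⟧

  level : ∀ v → v < n → Step (η (suc v)) (η v) →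
    Σ< m (λ i → ⟦ v ≡ᵇ X i ⟧ * ⟦ Y i <ᵇ v ⟧)
      ≡ Σ< m (λ i → ⟦ v ≡ᵇ X i ⟧ * ⟦ Y (suc i) <ᵇ suc v ⟧) + c v
  level v v<n (inj₁ eq) = trans (missingValue cX v<n eq _)
    (sym (cong₂ _+_ (missingValue cX v<n eq _)
      (trans (cong (λ h → ⟦ h ≡ᵇ θ (suc v) ⟧ * ⟦ η v <ᵇ θ v ⟧) eq)
        (unraised (η v) (Column.step cY v v<n)))))
  level v v<n (inj₂ eq) = begin
    Σ< m (λ i → ⟦ v ≡ᵇ X i ⟧ * ⟦ Y i <ᵇ v ⟧)
      ≡⟨ presentValue cX v<n eq (λ i → ⟦ Y i <ᵇ v ⟧) ⟩
    ⟦ Y (η v) <ᵇ v ⟧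
      ≡⟨ cong ⟦_⟧ (Column.galois cY (η v) v (ℕ.<⇒≤ v<n)) ⟩
    ⟦ η v <ᵇ θ v ⟧
      ≡⟨ raised (η v) (Column.step cY v v<n) ⟩
    ⟦ suc (η v) <ᵇ θ (suc v) ⟧ + ⟦ suc (η v) ≡ᵇ θ (suc v) ⟧ * ⟦ η v <ᵇ θ v ⟧
      ≡⟨ cong₂ _+_ (trans (cong ⟦_⟧ (sym (Column.galois cY (suc (η v)) (suc v) v<n)))
           (sym (presentValue cX v<n eq (λ i → ⟦ Y (suc i) <ᵇ suc v ⟧))))
           (cong (λ h → ⟦ h ≡ᵇ θ (suc v) ⟧ * ⟦ η v <ᵇ θ v ⟧) (sym eq)) ⟩
    Σ< m (λ i → ⟦ v ≡ᵇ X i ⟧ * ⟦ Y (suc i) <ᵇ suc v ⟧) + c v ∎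

-- The relation `p` is the order of the columns, `_<ᵇ_` for inv and its reverse for quinv, so one
-- computation serves both.
pairs : ℕ → (ℕ → ℕ → Bool) → (ℕ → ℕ → ℕ) → ℕ
pairs L p f = Σ< L (λ c → Σ< L (λ d → ⟦ p c d ⟧ * f c d))

pairs-cong : ∀ L p {f g} → (∀ c d → f c d ≡ g c d) → pairs L p f ≡ pairs L p g
pairs-cong L p eq = Σ-cong′ L λ c → Σ-cong′ L λ d → cong (⟦ p c d ⟧ *_) (eq c d)

pairs-+ : ∀ L p f g → pairs L p (λ c d → f c d + g c d) ≡ pairs L p f + pairs L p g
pairs-+ L p f g = trans
  (Σ-cong′ L λ c → trans
    (Σ-cong′ L λ d → ℕ.*-distribˡ-+ ⟦ p c d ⟧ (f c d) (g c d)) (Σ-+ L _ _))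
  (Σ-+ L _ _)

pairs-flip : ∀ L p f → pairs L (λ c d → p d c) f ≡ pairs L p (λ c d → f d c)
pairs-flip L p f = Σ-swap L L _

Σ-pairs : ∀ m L p (f : ℕ → ℕ → ℕ → ℕ) →
  Σ< m (λ i → pairs L p (f i)) ≡ pairs L p (λ c d → Σ< m (λ i → f i c d))
Σ-pairs m L p f = trans (Σ-swap m L _) (Σ-cong′ L λ c → trans (Σ-swap m L _)
  (Σ-cong′ L λ d → sym (Σ-* m ⟦ p c d ⟧ (λ i → f i c d))))

-- Attacks, descents and arms in a rectangular array

module Entries {n m L : ℕ} (e : ℕ → ℕ → ℕ)
  (missing : ∀ r c → m ≤ r → e r c ≡ n)
  (strict  : ∀ r c → e (suc r) c < n → e r c < e (suc r) c)
  (rows    : ∀ r c d → c < d → e r d < n → e r c < n) where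

  κ : ℕ → ℕ → ℕ
  κ r c = ⟦ e r c <ᵇ n ⟧

  η : ℕ → ℕ → ℕ
  η c v = Σ< m (λ r → ⟦ e r c <ᵇ v ⟧)

  galois : ∀ c r v → v ≤ n → (e r c <ᵇ v) ≡ (r <ᵇ η c v)
  galois c r v v≤n = initialSegment m (λ r → e r c <ᵇ v)
    (λ i t → let p = ℕ.<ᵇ⇒< (e (suc i) c) v t in
      ℕ.<⇒<ᵇ (ℕ.<-trans (strict i c (ℕ.<-≤-trans p v≤n)) p))
    (λ i m≤i → <ᵇ-false (subst (v ≤_) (sym (missing i c m≤i)) v≤n)) r

  below⇒counted : ∀ {c r v} → v ≤ n → e r c < v → r < η c v
  below⇒counted {c} {r} {v} v≤n = <ᵇ-transport (galois c r v v≤n)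

  counted⇒below : ∀ {c r v} → v ≤ n → r < η c v → e r c < v
  counted⇒below {c} {r} {v} v≤n = <ᵇ-transport (sym (galois c r v v≤n))

  η-mono : ∀ c {v w} → v ≤ w → w ≤ n → η c v ≤ η c w
  η-mono c {v} {w} v≤w w≤n = ℕ.≮⇒≥ λ lt → ℕ.<-irrefl refl
    (below⇒counted w≤n (ℕ.<-≤-trans (counted⇒below (ℕ.≤-trans v≤w w≤n) lt) v≤w))

  -- If the height rose by two, row `suc (η c v)` would have an entry at most `v`. By strictness row
  -- `η c v` would then have an entry below `v` and already be counted in `η c v`.
  η-suc : ∀ c {v} → v < n → η c (suc v) ≤ suc (η c v)
  η-suc c {v} v<n = ℕ.≮⇒≥ λ lt →
    let p = counted⇒below {c} v<n lt
        q = strict (η c v) c (ℕ.<-≤-trans p v<n)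
    in ℕ.<-irrefl refl (below⇒counted (ℕ.<⇒≤ v<n) (ℕ.<-≤-trans q (ℕ.≤-pred p)))

  column : ∀ c → Column n m (λ r → e r c) (η c)
  column c = record
    { galois = galois c
    ; step   = λ v v<n → between (η-mono c (ℕ.n≤1+n v) v<n) (η-suc c v<n)
    ; bound  = λ v v≤n → ℕ.≮⇒≥ λ lt → ℕ.<⇒≱ (counted⇒below {c} v≤n lt)
        (subst (v ≤_) (sym (missing m c ℕ.≤-refl)) v≤n)
    }
    where
    between : ∀ {a b} → b ≤ a → a ≤ suc b → Step a b
    between {a} {b} b≤a a≤1+b with ℕ.m≤n⇒m<n∨m≡n b≤a
    ... | inj₁ b<a = inj₂ (ℕ.≤-antisym a≤1+b b<a)
    ... | inj₂ b≡a = inj₁ (sym b≡a)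

  -- `columnPair` trades the inversions within a row for non-inversions between consecutive rows
  -- plus crossings. Together with the inversions between consecutive rows these non-inversions
  -- exhaust all pairs of present cells there (`comparable`).
  attacks≡arms+crossings : ∀ p →
    Σ< m (λ i → pairs L p (λ c d → κ i c * (κ i d * ⟦ e i d <ᵇ e i c ⟧)))
      + Σ< m (λ i → pairs L p (λ c d → κ i c * (κ (suc i) d * ⟦ e i c <ᵇ e (suc i) d ⟧)))
      ≡ Σ< m (λ i → pairs L p (λ c d → κ i c * κ (suc i) d))
      + pairs L p (λ c d → crossings n (η c) (η d))
  attacks≡arms+crossings p = begin
    Σ< m (λ i → pairs L p (a i)) + Σ< m (λ i → pairs L p (b i))
      ≡⟨ cong₂ _+_ (Σ-pairs m L p a) (Σ-pairs m L p b) ⟩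
    pairs L p (λ c d → Σ< m (λ i → a i c d)) + pairs L p (λ c d → Σ< m (λ i → b i c d))
      ≡⟨ pairs-+ L p _ _ ⟨
    pairs L p (λ c d → Σ< m (λ i → a i c d) + Σ< m (λ i → b i c d))
      ≡⟨ pairs-cong L p columns ⟩
    pairs L p (λ c d → Σ< m (λ i → κ i c * κ (suc i) d) + crossings n (η c) (η d))
      ≡⟨ pairs-+ L p _ _ ⟩
    pairs L p (λ c d → Σ< m (λ i → κ i c * κ (suc i) d))
      + pairs L p (λ c d → crossings n (η c) (η d))
      ≡⟨ cong (_+ pairs L p (λ c d → crossings n (η c) (η d))) (Σ-pairs m L p _) ⟨
    Σ< m (λ i → pairs L p (λ c d → κ i c * κ (suc i) d))
      + pairs L p (λ c d → crossings n (η c) (η d)) ∎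
    where
    open ≡-Reasoning
    a b b′ : ℕ → ℕ → ℕ → ℕ
    a  i c d = κ i c * (κ i d * ⟦ e i d <ᵇ e i c ⟧)
    b  i c d = κ i c * (κ (suc i) d * ⟦ e i c <ᵇ e (suc i) d ⟧)
    -- The comparison implies that the lower cell is present, since the entry `n` is never at most a
    -- present entry.
    b′ i c d = κ i c * ⟦ e (suc i) d <ᵇ suc (e i c) ⟧

    present : ∀ i c d → a i c d ≡ κ i c * ⟦ e i d <ᵇ e i c ⟧
    present i c d with e i c ℕ.<? n
    ... | no ≮n rewrite <ᵇ-false (ℕ.≮⇒≥ ≮n) = refl
    ... | yes <n with e i d ℕ.<? e i c
    ...   | no ≮e rewrite <ᵇ-false (ℕ.≮⇒≥ ≮e) | ℕ.*-zeroʳ (κ i d) = refl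
    ...   | yes <e rewrite <ᵇ-true (ℕ.<-trans <e <n) = cong (κ i c *_) (ℕ.*-identityˡ _)

    comparable : ∀ i c d → b′ i c d + b i c d ≡ κ i c * κ (suc i) d
    comparable i c d with e i c ℕ.<? n
    ... | no ≮n rewrite <ᵇ-false (ℕ.≮⇒≥ ≮n) = refl
    ... | yes <n with e (suc i) d ℕ.<? n
    ...   | no ≮n rewrite <ᵇ-true <n | <ᵇ-false (ℕ.≮⇒≥ ≮n)
                        | <ᵇ-false (ℕ.≤-trans <n (ℕ.≮⇒≥ ≮n)) = refl
    ...   | yes <n′ rewrite <ᵇ-true <n | <ᵇ-true <n′ =
      trans (lemma ⟦ e (suc i) d <ᵇ suc (e i c) ⟧ ⟦ e i c <ᵇ e (suc i) d ⟧)
        (<ᵇ-dichotomy (e i c) (e (suc i) d))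
      where
      lemma : ∀ x y → x + 0 + (y + 0 + 0) ≡ y + x
      lemma = solve-∀

    columns : ∀ c d → Σ< m (λ i → a i c d) + Σ< m (λ i → b i c d)
      ≡ Σ< m (λ i → κ i c * κ (suc i) d) + crossings n (η c) (η d)
    columns c d = begin
      Σ< m (λ i → a i c d) + Σ< m (λ i → b i c d)
        ≡⟨ cong (_+ Σ< m (λ i → b i c d)) (trans (Σ-cong′ m λ i → present i c d)
             (columnPair (column c) (column d))) ⟩
      (Σ< m (λ i → b′ i c d) + x) + Σ< m (λ i → b i c d)
        ≡⟨ lemma (Σ< m (λ i → b′ i c d)) x (Σ< m (λ i → b i c d)) ⟩
      (Σ< m (λ i → b′ i c d) + Σ< m (λ i → b i c d)) + x
        ≡⟨ cong (_+ x) (trans (sym (Σ-+ m _ _)) (Σ-cong′ m λ i → comparable i c d)) ⟩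
      Σ< m (λ i → κ i c * κ (suc i) d) + x ∎
      where
      x = crossings n (η c) (η d)
      lemma : ∀ x y z → (x + y) + z ≡ (x + z) + y
      lemma = solve-∀

  -- The weights `x` and `y` belong to pairs in the same row and to pairs with the first cell one
  -- row lower. Each row condition removes one row index, and the surviving index of the second sum
  -- is the upper row.
  attackSum : ∀ (x y : ℕ → ℕ → ℕ → ℕ → ℕ) →
    Σ< m (λ r → Σ< L (λ c → κ r c * Σ< m (λ s → Σ< L (λ d →
      κ s d * (⟦ r ≡ᵇ s ⟧ * x r c s d + ⟦ r ≡ᵇ suc s ⟧ * y r c s d)))))
    ≡ Σ< m (λ r → Σ< L (λ c → Σ< L (λ d → κ r c * (κ r d * x r c r d))))
      + Σ< m (λ s → Σ< L (λ c → Σ< L (λ d → κ (suc s) c * (κ s d * y (suc s) c s d))))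
  attackSum x y = begin
    Σ< m (λ r → Σ< L (λ c → κ r c * Σ< m (λ s → Σ< L (λ d →
      κ s d * (⟦ r ≡ᵇ s ⟧ * x r c s d + ⟦ r ≡ᵇ suc s ⟧ * y r c s d)))))
      ≡⟨ Σ-cong m (λ r r<m → trans (Σ-cong′ L (λ c → inner r r<m c)) (Σ-+ L _ _)) ⟩
    Σ< m (λ r → Σ< L (λ c → Σ< L (λ d → κ r c * (κ r d * x r c r d)))
              + Σ< L (λ c → Σ< m (λ s → ⟦ r ≡ᵇ suc s ⟧ * Y r c s)))
      ≡⟨ Σ-+ m _ _ ⟩
    Σ< m (λ r → Σ< L (λ c → Σ< L (λ d → κ r c * (κ r d * x r c r d))))
      + Σ< m (λ r → Σ< L (λ c → Σ< m (λ s → ⟦ r ≡ᵇ suc s ⟧ * Y r c s)))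
      ≡⟨ cong (Σ< m (λ r → Σ< L (λ c → Σ< L (λ d → κ r c * (κ r d * x r c r d)))) +_) below ⟩
    Σ< m (λ r → Σ< L (λ c → Σ< L (λ d → κ r c * (κ r d * x r c r d))))
      + Σ< m (λ s → Σ< L (λ c → Y (suc s) c s)) ∎
    where
    open ≡-Reasoning
    Y : ℕ → ℕ → ℕ → ℕ
    Y r c s = Σ< L (λ d → κ r c * (κ s d * y r c s d))

    inner : ∀ r → r < m → ∀ c → κ r c * Σ< m (λ s → Σ< L (λ d →
      κ s d * (⟦ r ≡ᵇ s ⟧ * x r c s d + ⟦ r ≡ᵇ suc s ⟧ * y r c s d)))
      ≡ Σ< L (λ d → κ r c * (κ r d * x r c r d)) + Σ< m (λ s → ⟦ r ≡ᵇ suc s ⟧ * Y r c s)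
    inner r r<m c = begin
      κ r c * Σ< m (λ s → Σ< L (λ d →
        κ s d * (⟦ r ≡ᵇ s ⟧ * x r c s d + ⟦ r ≡ᵇ suc s ⟧ * y r c s d)))
        ≡⟨ Σ-* m (κ r c) _ ⟩
      Σ< m (λ s → κ r c * Σ< L (λ d →
        κ s d * (⟦ r ≡ᵇ s ⟧ * x r c s d + ⟦ r ≡ᵇ suc s ⟧ * y r c s d)))
        ≡⟨ Σ-cong′ m (λ s → split s) ⟩
      Σ< m (λ s → ⟦ r ≡ᵇ s ⟧ * Σ< L (λ d → κ r c * (κ s d * x r c s d))
        + ⟦ r ≡ᵇ suc s ⟧ * Y r c s)
        ≡⟨ Σ-+ m _ _ ⟩
      Σ< m (λ s → ⟦ r ≡ᵇ s ⟧ * Σ< L (λ d → κ r c * (κ s d * x r c s d)))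
        + Σ< m (λ s → ⟦ r ≡ᵇ suc s ⟧ * Y r c s)
        ≡⟨ cong (_+ Σ< m (λ s → ⟦ r ≡ᵇ suc s ⟧ * Y r c s))
             (Σ-δ′ m r (λ s → Σ< L (λ d → κ r c * (κ s d * x r c s d)))
               (λ m≤r → ⊥-elim (ℕ.<⇒≱ r<m m≤r))) ⟩
      Σ< L (λ d → κ r c * (κ r d * x r c r d)) + Σ< m (λ s → ⟦ r ≡ᵇ suc s ⟧ * Y r c s) ∎
      where
      split : ∀ s → κ r c * Σ< L (λ d →
        κ s d * (⟦ r ≡ᵇ s ⟧ * x r c s d + ⟦ r ≡ᵇ suc s ⟧ * y r c s d))
        ≡ ⟦ r ≡ᵇ s ⟧ * Σ< L (λ d → κ r c * (κ s d * x r c s d)) + ⟦ r ≡ᵇ suc s ⟧ * Y r c s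
      split s = trans (Σ-* L (κ r c) _) (trans
        (Σ-cong′ L (λ d →
          lemma (κ r c) (κ s d) ⟦ r ≡ᵇ s ⟧ (x r c s d) ⟦ r ≡ᵇ suc s ⟧ (y r c s d)))
        (trans (Σ-+ L _ _) (cong₂ _+_ (sym (Σ-* L ⟦ r ≡ᵇ s ⟧ _))
          (sym (Σ-* L ⟦ r ≡ᵇ suc s ⟧ _)))))
        where
        lemma : ∀ k l a x b y → k * (l * (a * x + b * y)) ≡ a * (k * (l * x)) + b * (k * (l * y))
        lemma = solve-∀

    below : Σ< m (λ r → Σ< L (λ c → Σ< m (λ s → ⟦ r ≡ᵇ suc s ⟧ * Y r c s)))
      ≡ Σ< m (λ s → Σ< L (λ c → Y (suc s) c s))
    below = trans
      (Σ-cong′ m (λ r → trans (Σ-swap L m _)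
        (Σ-cong′ m (λ s → sym (Σ-* L ⟦ r ≡ᵇ suc s ⟧ (λ c → Y r c s))))))
      (trans (Σ-swap m m _)
        (Σ-cong′ m (λ s → Σ-δ m (suc s) (λ r → Σ< L (λ c → Y r c s))
          -- When `suc s` leaves the range of rows, row `suc s` is empty and `κ` annihilates the
          -- term.
          (λ m≤s → Σ-zero L (λ c → Σ-zero L (λ d → cong (_* (κ s d * y (suc s) c s d))
            (cong ⟦_⟧ (<ᵇ-false (ℕ.≤-reflexive (sym (missing (suc s) c m≤s)))))))))))

  attackSum-pairs : ∀ p →
    Σ< m (λ r → Σ< L (λ c → κ r c * Σ< m (λ s → Σ< L (λ d → κ s d *
      (⟦ r ≡ᵇ s ⟧ * (⟦ p c d ⟧ * ⟦ e s d <ᵇ e r c ⟧)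
        + ⟦ r ≡ᵇ suc s ⟧ * (⟦ p d c ⟧ * ⟦ e s d <ᵇ e r c ⟧))))))
    ≡ Σ< m (λ i → pairs L p (λ c d → κ i c * (κ i d * ⟦ e i d <ᵇ e i c ⟧)))
      + Σ< m (λ i → pairs L p (λ c d → κ i c * (κ (suc i) d * ⟦ e i c <ᵇ e (suc i) d ⟧)))
  attackSum-pairs p = trans (attackSum (λ r c s d → ⟦ p c d ⟧ * ⟦ e s d <ᵇ e r c ⟧)
      (λ r c s d → ⟦ p d c ⟧ * ⟦ e s d <ᵇ e r c ⟧))
    (cong₂ _+_
      (Σ-cong′ m λ i → Σ-cong′ L λ c → Σ-cong′ L λ d →
        same (κ i c) (κ i d) ⟦ p c d ⟧ ⟦ e i d <ᵇ e i c ⟧)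
      (Σ-cong′ m λ i → trans (Σ-swap L L _) (Σ-cong′ L λ c → Σ-cong′ L λ d →
        next (κ (suc i) d) (κ i c) ⟦ p c d ⟧ ⟦ e i c <ᵇ e (suc i) d ⟧)))
    where
    same : ∀ k l a x → k * (l * (a * x)) ≡ a * (k * (l * x))
    same = solve-∀
    next : ∀ k l a x → k * (l * (a * x)) ≡ a * (l * (k * x))
    next = solve-∀

  -- Strictness makes every present cell outside the first row a descent, so the comparison and the
  -- presence of the cell above drop out. Here `α` is the arm of either cell.
  descentSum : ∀ (α : ℕ → ℕ → ℕ → ℕ → ℕ) →
    Σ< m (λ r → Σ< L (λ c → κ r c * Σ< m (λ s → Σ< L (λ d → κ s d *
      (⟦ r ≡ᵇ suc s ⟧ * (⟦ c ≡ᵇ d ⟧ * (⟦ e s d <ᵇ e r c ⟧ * α r c s d)))))))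
    ≡ Σ< m (λ s → Σ< L (λ c → κ (suc s) c * α (suc s) c s c))
  descentSum α = begin
    Σ< m (λ r → Σ< L (λ c → κ r c * Σ< m (λ s → Σ< L (λ d → κ s d * (⟦ r ≡ᵇ suc s ⟧ * y r c s d)))))
      -- A zero weight for pairs in the same row is inserted to match `attackSum`.
      ≡⟨ Σ-cong′ m (λ r → Σ-cong′ L λ c → cong (κ r c *_) (Σ-cong′ m λ s → Σ-cong′ L λ d →
           cong (λ z → κ s d * (z + ⟦ r ≡ᵇ suc s ⟧ * y r c s d)) (ℕ.*-zeroʳ ⟦ r ≡ᵇ s ⟧))) ⟨
    Σ< m (λ r → Σ< L (λ c → κ r c * Σ< m (λ s → Σ< L (λ d →
      κ s d * (⟦ r ≡ᵇ s ⟧ * 0 + ⟦ r ≡ᵇ suc s ⟧ * y r c s d)))))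
      ≡⟨ attackSum (λ _ _ _ _ → 0) y ⟩
    Σ< m (λ r → Σ< L (λ c → Σ< L (λ d → κ r c * (κ r d * 0))))
      + Σ< m (λ s → Σ< L (λ c → Σ< L (λ d → κ (suc s) c * (κ s d * y (suc s) c s d))))
      ≡⟨ cong₂ _+_ (Σ-zero m λ r → Σ-zero L λ c → Σ-zero L λ d → zeros (κ r c) (κ r d))
           (Σ-cong′ m λ s → Σ-cong L λ c c<L → diagonal s c c<L) ⟩
    Σ< m (λ s → Σ< L (λ c → κ (suc s) c * α (suc s) c s c)) ∎
    where
    open ≡-Reasoning
    y : ℕ → ℕ → ℕ → ℕ → ℕ
    y r c s d = ⟦ c ≡ᵇ d ⟧ * (⟦ e s d <ᵇ e r c ⟧ * α r c s d)

    zeros : ∀ k l → k * (l * 0) ≡ 0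
    zeros = solve-∀

    lemma : ∀ k l a x y → k * (l * (a * (x * y))) ≡ a * (k * (l * (x * y)))
    lemma = solve-∀

    descent : ∀ s c → κ (suc s) c * (κ s c * (⟦ e s c <ᵇ e (suc s) c ⟧ * α (suc s) c s c))
      ≡ κ (suc s) c * α (suc s) c s c
    descent s c with e (suc s) c ℕ.<? n
    ... | no ≮n rewrite <ᵇ-false (ℕ.≮⇒≥ ≮n) = refl
    ... | yes <n rewrite <ᵇ-true (ℕ.<-trans (strict s c <n) <n) | <ᵇ-true (strict s c <n) =
      cong (κ (suc s) c *_) (trans (ℕ.*-identityˡ _) (ℕ.*-identityˡ _))

    diagonal : ∀ s c → c < L → Σ< L (λ d → κ (suc s) c * (κ s d * y (suc s) c s d))
      ≡ κ (suc s) c * α (suc s) c s c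
    diagonal s c c<L = trans
      (Σ-cong′ L λ d → lemma (κ (suc s) c) (κ s d) ⟦ c ≡ᵇ d ⟧ ⟦ e s d <ᵇ e (suc s) c ⟧ _)
      (trans (Σ-δ′ L c
        (λ d → κ (suc s) c * (κ s d * (⟦ e s d <ᵇ e (suc s) c ⟧ * α (suc s) c s d)))
        (λ L≤c → ⊥-elim (ℕ.<⇒≱ c<L L≤c))) (descent s c))

  -- For `c < d` a present cell in row `suc i` and column `d` forces the one in column `c` of that
  -- row, and then the one above it. The presence of the descent can therefore be exchanged for that
  -- of the cell attacked from column `d`.
  armSum : ∀ i → Σ< L (λ c → κ (suc i) c * Σ< L (λ d → κ (suc i) d * ⟦ c <ᵇ d ⟧))
    ≡ pairs L _<ᵇ_ (λ c d → κ i c * κ (suc i) d)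
  armSum i = Σ-cong′ L λ c → trans (Σ-* L (κ (suc i) c) _) (Σ-cong′ L λ d → term c d)
    where
    term : ∀ c d → κ (suc i) c * (κ (suc i) d * ⟦ c <ᵇ d ⟧)
      ≡ ⟦ c <ᵇ d ⟧ * (κ i c * κ (suc i) d)
    term c d with c ℕ.<? d
    ... | no ≮d rewrite <ᵇ-false (ℕ.≮⇒≥ ≮d) | ℕ.*-zeroʳ (κ (suc i) d) = ℕ.*-zeroʳ (κ (suc i) c)
    ... | yes <d with e (suc i) d ℕ.<? n
    ...   | no ≮n rewrite <ᵇ-false (ℕ.≮⇒≥ ≮n) | ℕ.*-zeroʳ (κ (suc i) c) | ℕ.*-zeroʳ (κ i c) =
      sym (ℕ.*-zeroʳ ⟦ c <ᵇ d ⟧)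
    ...   | yes <n rewrite <ᵇ-true <d | <ᵇ-true <n | <ᵇ-true (rows (suc i) c d <d <n)
                         | <ᵇ-true (ℕ.<-trans (strict i c (rows (suc i) c d <d <n))
                                     (rows (suc i) c d <d <n)) = refl

  -- The arm is now counted in the upper row, so its cells and the descent are already the pairs
  -- attacking for quinv; only the names of the columns are exchanged.
  armSum↑ : ∀ i → Σ< L (λ c → κ (suc i) c * Σ< L (λ d → κ i d * ⟦ c <ᵇ d ⟧))
    ≡ pairs L (λ c d → d <ᵇ c) (λ c d → κ i c * κ (suc i) d)
  armSum↑ i = trans (Σ-cong′ L λ c → trans (Σ-* L (κ (suc i) c) _) (Σ-cong′ L λ d →
    lemma (κ (suc i) c) (κ i d) ⟦ c <ᵇ d ⟧)) (Σ-swap L L _)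
    where
    lemma : ∀ k l a → k * (l * a) ≡ a * (l * k)
    lemma = solve-∀

-- inv and quinv of a filling

rowVal : ∀ {n k} → Vec (Fin n) k → ℕ → ℕ
rowVal {n} []       c       = n
rowVal     (x ∷ xs) zero    = toℕ x
rowVal     (x ∷ xs) (suc c) = rowVal xs c

-- The entry of a filling at any position, positions outside the diagram having entry n.
val : ∀ {n m} {lam : Vec ℕ m} → Filling n lam → ℕ → ℕ → ℕ
val {n} []       r       c = n
val     (xs ∷ F) zero    c = rowVal xs c
val     (xs ∷ F) (suc r) c = val F r c

rowVal-lookup : ∀ {n k} (xs : Vec (Fin n) k) c → rowVal xs (toℕ c) ≡ toℕ (lookup xs c)
rowVal-lookup (x ∷ xs) Fin.zero    = refl
rowVal-lookup (x ∷ xs) (Fin.suc c) = rowVal-lookup xs c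

val-cell : ∀ {n m} {lam : Vec ℕ m} (F : Filling n lam) r c →
  val F (toℕ r) (toℕ c) ≡ toℕ (F ⟨ cell r c ⟩)
val-cell (xs ∷ F) Fin.zero    c = rowVal-lookup xs c
val-cell (xs ∷ F) (Fin.suc r) c = val-cell F r c

rowVal-right : ∀ {n k} (xs : Vec (Fin n) k) c → k ≤ c → rowVal xs c ≡ n
rowVal-right []       c       _         = refl
rowVal-right (x ∷ xs) (suc c) (s≤s k≤c) = rowVal-right xs c k≤c

val-right : ∀ {n m} {lam : Vec ℕ m} (F : Filling n lam) r c →
  lookup lam r ≤ c → val F (toℕ r) c ≡ n
val-right (xs ∷ F) Fin.zero    c p = rowVal-right xs c p
val-right (xs ∷ F) (Fin.suc r) c p = val-right F r c p

val-below : ∀ {n m} {lam : Vec ℕ m} (F : Filling n lam) r c → m ≤ r → val F r c ≡ n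
val-below []       r       c _         = refl
val-below (xs ∷ F) (suc r) c (s≤s m≤r) = val-below F r c m≤r

sum-tabulate : ∀ {k} L (f : Fin k → ℕ) (h : ℕ → ℕ) → k ≤ L → (∀ i → f i ≡ h (toℕ i)) →
  (∀ i → k ≤ i → h i ≡ 0) → sum (tabulate f) ≡ Σ< L h
sum-tabulate {zero}  L       f h k≤L       eq out = sym (Σ-zero L (λ i → out i z≤n))
sum-tabulate {suc k} (suc L) f h (s≤s k≤L) eq out = cong₂ _+_ (eq Fin.zero)
  (sum-tabulate L (f ∘ Fin.suc) (h ∘ suc) k≤L (eq ∘ Fin.suc) (λ i → out (suc i) ∘ s≤s))

sum-allFin : ∀ {k} L (f : Fin k → ℕ) (h : ℕ → ℕ) → k ≤ L → (∀ i → f i ≡ h (toℕ i)) →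
  (∀ i → k ≤ i → h i ≡ 0) → sum (map f (allFin k)) ≡ Σ< L h
sum-allFin L f h k≤L eq out =
  trans (cong sum (map-tabulate id f)) (sum-tabulate L f h k≤L eq out)

sum-concatMap : ∀ {A B : Set} (g : B → ℕ) (f : A → List B) xs →
  sum (map g (concatMap f xs)) ≡ sum (map (λ x → sum (map g (f x))) xs)
sum-concatMap g f []       = refl
sum-concatMap g f (x ∷ xs) = trans (cong sum (map-++ g (f x) _))
  (trans (sum-++ (map g (f x)) _) (cong (sum (map g (f x)) +_) (sum-concatMap g f xs)))

sum-filter : ∀ {A : Set} {P : Pred A 0ℓ} (P? : Decidable P) (f : A → ℕ) xs →
  sum (map f (filter P? xs)) ≡ sum (map (λ x → ⟦ does (P? x) ⟧ * f x) xs)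
sum-filter P? f []       = refl
sum-filter P? f (x ∷ xs) with does (P? x)
... | true  = cong₂ _+_ (sym (ℕ.*-identityˡ _)) (sum-filter P? f xs)
... | false = sum-filter P? f xs

length-filter : ∀ {A : Set} {P : Pred A 0ℓ} (P? : Decidable P) xs →
  length (filter P? xs) ≡ sum (map (λ x → ⟦ does (P? x) ⟧) xs)
length-filter P? []       = refl
length-filter P? (x ∷ xs) with does (P? x)
... | true  = cong suc (length-filter P? xs)
... | false = length-filter P? xs

sum-cartesianProduct : ∀ {A B : Set} (g : A × B → ℕ) xs ys →
  sum (map g (cartesianProduct xs ys)) ≡ sum (map (λ x → sum (map (λ y → g (x , y)) ys)) xs)
sum-cartesianProduct g []       ys = refl
sum-cartesianProduct g (x ∷ xs) ys =
  trans (cong sum (map-++ g (map (x ,_) ys) _))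
    (trans (sum-++ (map g (map (x ,_) ys)) _)
      (cong₂ _+_ (cong sum (sym (map-∘ ys))) (sum-cartesianProduct g xs ys)))

module _ {n m} {lam : Vec ℕ m} (F : Filling n lam) {L} (bounded : ∀ r → lookup lam r ≤ L) where

  private
    κ : ℕ → ℕ → ℕ
    κ r c = ⟦ val F r c <ᵇ n ⟧

  κ-cell : ∀ r c → κ (toℕ r) (toℕ c) ≡ 1
  κ-cell r c rewrite val-cell F r c = cong ⟦_⟧ (<ᵇ-true (Fin.toℕ<n (F ⟨ cell r c ⟩)))

  κ-outside : ∀ {r c} → val F r c ≡ n → κ r c ≡ 0
  κ-outside {r} {c} eq = cong ⟦_⟧ (<ᵇ-false {val F r c} (ℕ.≤-reflexive (sym eq)))

  sum-dg : ∀ (g : Cell lam → ℕ) (h : ℕ → ℕ → ℕ → ℕ) →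
    (∀ u → g u ≡ h (row u) (col u) (toℕ (F ⟨ u ⟩))) →
    sum (map g (dg lam)) ≡ Σ< m (λ r → Σ< L (λ c → κ r c * h r c (val F r c)))
  sum-dg g h eq = trans (sum-concatMap g (λ r → map (cell r) (allFin (lookup lam r))) (allFin m))
    (sum-allFin m _ _ ℕ.≤-refl
      (λ r → trans (cong sum (sym (map-∘ (allFin (lookup lam r)))))
        (sum-allFin L _ _ (bounded r)
          (λ c → trans (eq (cell r c)) (trans (cong (h (toℕ r) (toℕ c)) (sym (val-cell F r c)))
            (sym (trans (cong (_* h (toℕ r) (toℕ c) (val F (toℕ r) (toℕ c))) (κ-cell r c))
              (ℕ.*-identityˡ _)))))
          (λ c λ≤c → cong (_* h (toℕ r) c (val F (toℕ r) c)) (κ-outside (val-right F r c λ≤c)))))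
      (λ r m≤r → Σ-zero L (λ c → cong (_* h r c (val F r c))
        (κ-outside {r} (val-below F r c m≤r)))))

  sum-pairs : ∀ (g : Cell lam × Cell lam → ℕ) (h : ℕ → ℕ → ℕ → ℕ → ℕ → ℕ → ℕ) →
    (∀ u v → g (u , v) ≡ h (row u) (col u) (toℕ (F ⟨ u ⟩)) (row v) (col v) (toℕ (F ⟨ v ⟩))) →
    sum (map g (cartesianProduct (dg lam) (dg lam)))
      ≡ Σ< m (λ r → Σ< L (λ c → κ r c * Σ< m (λ s → Σ< L (λ d →
          κ s d * h r c (val F r c) s d (val F s d)))))
  sum-pairs g h eq = trans (sum-cartesianProduct g (dg lam) (dg lam))
    (sum-dg _ (λ r c a → Σ< m (λ s → Σ< L (λ d → κ s d * h r c a s d (val F s d))))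
      (λ u → sum-dg _ (h (row u) (col u) (toℕ (F ⟨ u ⟩))) (eq u)))

  arm-sum : ∀ u → arm u ≡ Σ< L (λ d → κ (row u) d * ⟦ col u <ᵇ d ⟧)
  arm-sum u = trans (length-filter _ (dg lam)) (trans
    (sum-dg _ (λ s d _ → ⟦ s ≡ᵇ row u ⟧ * ⟦ col u <ᵇ d ⟧)
      (λ v → ⟦∧⟧ (row v ≡ᵇ row u) (col u <ᵇ col v)))
    (trans (Σ-cong′ m (λ s → trans
        (Σ-cong′ L λ d → lemma (κ s d) ⟦ s ≡ᵇ row u ⟧ ⟦ col u <ᵇ d ⟧)
        (sym (Σ-* L ⟦ s ≡ᵇ row u ⟧ (λ d → κ s d * ⟦ col u <ᵇ d ⟧)))))
      (Σ-δ m (row u) (λ s → Σ< L (λ d → κ s d * ⟦ col u <ᵇ d ⟧))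
        (λ m≤r → ⊥-elim (ℕ.<⇒≱ (Fin.toℕ<n (Cell.r u)) m≤r)))))
    where
    lemma : ∀ k a b → k * (a * b) ≡ a * (k * b)
    lemma = solve-∀

-- No row is its own successor, so the two kinds of attack are exclusive and the disjunction becomes
-- a sum.
⟦attack⟧ : ∀ r s (p q t : Bool) → ⟦ ((r ≡ᵇ s) ∧ p ∨ (r ≡ᵇ suc s) ∧ q) ∧ t ⟧
  ≡ ⟦ r ≡ᵇ s ⟧ * (⟦ p ⟧ * ⟦ t ⟧) + ⟦ r ≡ᵇ suc s ⟧ * (⟦ q ⟧ * ⟦ t ⟧)
⟦attack⟧ r s p q t with r ℕ.≟ s
... | yes refl rewrite ≡ᵇ-refl r | ≡ᵇ-false (ℕ.1+n≢n {r} ∘ sym) = lemma p t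
  where
  lemma : ∀ p t → ⟦ (p ∨ false) ∧ t ⟧ ≡ ⟦ p ⟧ * ⟦ t ⟧ + 0 + 0
  lemma true  t = sym (trans (ℕ.+-identityʳ _) (trans (ℕ.+-identityʳ _) (ℕ.+-identityʳ _)))
  lemma false t = refl
... | no r≢s rewrite ≡ᵇ-false r≢s with r ≡ᵇ suc s
...   | true  = trans (⟦∧⟧ q t) (sym (ℕ.+-identityʳ _))
...   | false = refl

val-present : ∀ {n m} {lam : Vec ℕ m} (F : Filling n lam) {r c} → val F r c < n →
  ∃ λ r′ → ∃ λ (c′ : Fin (lookup lam r′)) → toℕ r′ ≡ r × toℕ c′ ≡ c
val-present {lam = lam} F {r} {c} p = r′ , fromℕ< c<λ , toℕ-r′ , Fin.toℕ-fromℕ< c<λ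
  where
  r<m = ℕ.≰⇒> λ m≤r → ℕ.<-irrefl (val-below F r c m≤r) p
  r′  = fromℕ< r<m
  toℕ-r′ = Fin.toℕ-fromℕ< r<m
  c<λ = ℕ.≰⇒> λ λ≤c → ℕ.<-irrefl
    (subst (λ k → val F k c ≡ _) toℕ-r′ (val-right F r′ c λ≤c)) p

val-at : ∀ {n m} {lam : Vec ℕ m} (F : Filling n lam) {r c} (p : r < m)
  (q : c < lookup lam (fromℕ< p)) → val F r c ≡ toℕ (F ⟨ cell (fromℕ< p) (fromℕ< q) ⟩)
val-at F p q = trans
  (cong₂ (val F) (sym (Fin.toℕ-fromℕ< p)) (sym (Fin.toℕ-fromℕ< q))) (val-cell F _ _)

-- The partition condition supplies the cell above: row `r` is at least as long as row `suc r`.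
val-strict : ∀ {n m} {lam : Vec ℕ m} → IsPartition lam → (F : Filling n lam) → ColumnStrict F →
  ∀ r c → val F (suc r) c < n → val F r c < val F (suc r) c
val-strict part F cs r c p with val-present F p
... | r′ , c′ , eq , refl = subst₂ _<_ (sym (val-at F r<m c<λ))
        (trans (sym (val-cell F r′ c′)) (cong (λ k → val F k (toℕ c′)) eq))
        (cs (fromℕ< r<m) (fromℕ< c<λ) r′ c′ (Fin.toℕ-fromℕ< c<λ) lt)
  where
  r<m = ℕ.<-trans (ℕ.≤-reflexive (sym eq)) (Fin.toℕ<n r′)
  lt  = subst₂ _<_ (sym (Fin.toℕ-fromℕ< r<m)) (sym eq) (ℕ.n<1+n r)
  c<λ = ℕ.<-≤-trans (Fin.toℕ<n c′) (part (fromℕ< r<m) r′ (ℕ.<⇒≤ lt))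

val-rows : ∀ {n m} {lam : Vec ℕ m} (F : Filling n lam) →
  ∀ r c d → c < d → val F r d < n → val F r c < n
val-rows F r c d c<d p with val-present F p
... | r′ , d′ , refl , refl = subst (_< _)
        (trans (sym (val-cell F r′ (fromℕ< c<λ))) (cong (val F (toℕ r′)) (Fin.toℕ-fromℕ< c<λ)))
        (Fin.toℕ<n (F ⟨ cell r′ (fromℕ< c<λ) ⟩))
  where c<λ = ℕ.<-trans c<d (Fin.toℕ<n d′)

height : ∀ {n m} {lam : Vec ℕ m} → Filling n lam → ℕ → ℕ → ℕ
height {m = m} F c v = Σ< m (λ r → ⟦ val F r c <ᵇ v ⟧)

module _ {n m L} {lam : Vec ℕ m} (part : IsPartition lam) (bounded : ∀ r → lookup lam r ≤ L)
         (F : Filling n lam) (cs : ColumnStrict F) where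

  open Entries {n} {m} {L} (val F) (val-below F) (val-strict part F cs) (val-rows F)

  private
    difference : ∀ {a d s} → a ≡ d + s → ℤ.+ a ℤ.- ℤ.+ d ≡ ℤ.+ s
    difference {d = d} {s} refl = trans (ℤ.m-n≡m⊖n (d + s) d)
      (trans (ℤ.⊖-≥ (ℕ.m≤m+n d s)) (cong ℤ.+_ (ℕ.m+n∸m≡n d s)))

    Des-sum : ∀ (g : Cell lam × Cell lam → ℕ) (α : ℕ → ℕ → ℕ → ℕ → ℕ) →
      (∀ u v → g (u , v) ≡ α (row u) (col u) (row v) (col v)) →
      sum (map g (Des F)) ≡ Σ< m (λ s → Σ< L (λ c → κ (suc s) c * α (suc s) c s c))
    Des-sum g α eq = trans (sum-filter _ g (cartesianProduct (dg lam) (dg lam)))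
      (trans (sum-pairs F bounded _
        (λ r c a s d b → ⟦ r ≡ᵇ suc s ⟧ * (⟦ c ≡ᵇ d ⟧ * (⟦ b <ᵇ a ⟧ * α r c s d)))
        (λ u v → trans (cong₂ _*_ (trans
            (⟦∧⟧ ((row u ≡ᵇ suc (row v)) ∧ (col u ≡ᵇ col v)) _)
            (cong (_* ⟦ toℕ (F ⟨ v ⟩) <ᵇ toℕ (F ⟨ u ⟩) ⟧)
              (⟦∧⟧ (row u ≡ᵇ suc (row v)) (col u ≡ᵇ col v)))) (eq u v))
          (lemma ⟦ row u ≡ᵇ suc (row v) ⟧ ⟦ col u ≡ᵇ col v ⟧
            ⟦ toℕ (F ⟨ v ⟩) <ᵇ toℕ (F ⟨ u ⟩) ⟧ _)))
        (descentSum α))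
      where
      lemma : ∀ a b c d → a * b * c * d ≡ a * (b * (c * d))
      lemma = solve-∀

    attacks : ∀ (p : ℕ → ℕ → Bool) {P : Pred (Cell lam × Cell lam) 0ℓ} (P? : Decidable P) →
      (∀ u v → does (P? (u , v)) ≡
        ((row u ≡ᵇ row v) ∧ p (col u) (col v) ∨ (row u ≡ᵇ suc (row v)) ∧ p (col v) (col u))
          ∧ (toℕ (F ⟨ v ⟩) <ᵇ toℕ (F ⟨ u ⟩))) →
      length (filter P? (cartesianProduct (dg lam) (dg lam)))
        ≡ Σ< m (λ i → pairs L p (λ c d → κ i c * κ (suc i) d))
          + pairs L p (λ c d → crossings n (η c) (η d))
    attacks p P? eq = trans (length-filter P? (cartesianProduct (dg lam) (dg lam)))
      (trans (sum-pairs F bounded _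
        (λ r c a s d b → ⟦ r ≡ᵇ s ⟧ * (⟦ p c d ⟧ * ⟦ b <ᵇ a ⟧)
          + ⟦ r ≡ᵇ suc s ⟧ * (⟦ p d c ⟧ * ⟦ b <ᵇ a ⟧))
        (λ u v → trans (cong ⟦_⟧ (eq u v))
          (⟦attack⟧ (row u) (row v) (p (col u) (col v)) (p (col v) (col u)) _)))
        (trans (attackSum-pairs p) (attacks≡arms+crossings p)))

  inv-crossings : inv F ≡ ℤ.+ pairs L _<ᵇ_ (λ c d → crossings n (height F c) (height F d))
  inv-crossings = difference (trans (attacks _<ᵇ_ _ (λ u v → refl))
    (cong (_+ pairs L _<ᵇ_ (λ c d → crossings n (η c) (η d)))
      (sym (trans (Des-sum _ (λ r c s d → Σ< L (λ w → κ r w * ⟦ c <ᵇ w ⟧))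
        (λ u v → arm-sum F bounded u)) (Σ-cong′ m armSum)))))

  -- Renaming the columns restores the order `c < d` and thereby exchanges the two heights.
  quinv-crossings : quinv F ≡ ℤ.+ pairs L _<ᵇ_ (λ c d → crossings n (height F d) (height F c))
  quinv-crossings = trans (difference (trans (attacks (λ c d → d <ᵇ c) _ (λ u v → refl))
    (cong (_+ pairs L (λ c d → d <ᵇ c) (λ c d → crossings n (η c) (η d)))
      (sym (trans (Des-sum _ (λ r c s d → Σ< L (λ w → κ s w * ⟦ d <ᵇ w ⟧))
        (λ u v → arm-sum F bounded v)) (Σ-cong′ m armSum↑))))))
    (cong ℤ.+_ (pairs-flip L _<ᵇ_ (λ c d → crossings n (η c) (η d))))

-- The two q-Pascal recursions

shift : ℕ → Laurent → Laurent
shift a = map (ℤ._+_ (ℤ.+ a))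

shift-0 : ∀ f → shift 0 f ≡ f
shift-0 []      = refl
shift-0 (x ∷ f) = cong₂ _∷_ (ℤ.+-identityˡ x) (shift-0 f)

shift-shift : ∀ a b f → shift a (shift b f) ≡ shift (a + b) f
shift-shift a b f = trans (sym (map-∘ f)) (map-cong (λ x → trans
  (sym (ℤ.+-assoc (ℤ.+ a) (ℤ.+ b) x)) (cong (ℤ._+ x) (sym (ℤ.pos-+ a b)))) f)

++-interchange : ∀ {A : Set} (a b c d : List A) → (a ++ b) ++ (c ++ d) ↭ (a ++ c) ++ (b ++ d)
++-interchange a b c d = ↭-trans (++-assoc a b (c ++ d))
  (↭-trans (++⁺ˡ a (shifts b c)) (↭-sym (++-assoc a c (b ++ d))))

-- The arguments are the numbers of the two letters, later the lowered and the kept columns of a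
-- class, that is NE and SE.
P : ℕ → ℕ → Laurent
P k z = qBinomial (k + z) k

P-k-0 : ∀ k → P k 0 ↭ 𝟙
P-k-0 k rewrite ℕ.+-identityʳ k = qBinomial-diag k

pascal₁ : ∀ k z → P (suc k) (suc z) ≡ P k (suc z) ⊕ shift (suc k) (P (suc k) z)
pascal₁ k z rewrite ℕ.+-suc k z =
  cong (qBinomial (suc (k + z)) k ++_) (++-identityʳ _)

-- before k z and after k z are P (k − 1) (z + 1) and P (k + 1) (z − 1), read as 𝟘
-- where the subtraction is impossible.
before : ℕ → ℕ → Laurent
before zero    z = 𝟘
before (suc k) z = P k (suc z)

after : ℕ → ℕ → Laurent
after k zero    = 𝟘
after k (suc z) = P (suc k) z

before-pascal₁ : ∀ k z → P k (suc z) ≡ before k z ⊕ shift k (P k z)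
before-pascal₁ zero    z = refl
before-pascal₁ (suc k) z = pascal₁ k z

after-pascal₁ : ∀ k z → P (suc k) z ↭ P k z ⊕ shift (suc k) (after k z)
after-pascal₁ k zero    = ↭-trans (P-k-0 (suc k)) (↭-trans (↭-sym (P-k-0 k))
  (↭-reflexive (sym (++-identityʳ _))))
after-pascal₁ k (suc z) = ↭-reflexive (pascal₁ k z)

-- Expanding by `pascal₁` and then by induction gives four terms. As q^(k+1) q^z = q^(z+1) q^k, they
-- regroup into two expansions by `pascal₁`, read backwards.
pascal₂ : ∀ k z → P (suc k) (suc z) ↭ shift (suc z) (P k (suc z)) ⊕ P (suc k) z
before-pascal₂ : ∀ k z → P k (suc z) ↭ shift (suc z) (before k z) ⊕ P k z
after-pascal₂ : ∀ k z → P (suc k) z ↭ shift z (P k z) ⊕ after k z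

before-pascal₂ zero    z = ↭-refl
before-pascal₂ (suc k) z = pascal₂ k z

after-pascal₂ k zero    = ↭-trans (P-k-0 (suc k)) (↭-trans (↭-sym (P-k-0 k))
  (↭-reflexive (sym (trans (++-identityʳ _) (shift-0 _)))))
after-pascal₂ k (suc z) = pascal₂ k z

pascal₂ k z = begin
  P (suc k) (suc z)
    ≡⟨ pascal₁ k z ⟩
  P k (suc z) ++ shift (suc k) (P (suc k) z)
    ↭⟨ ++⁺ (before-pascal₂ k z) (map⁺ _ (after-pascal₂ k z)) ⟩
  (shift (suc z) A ++ P k z) ++ shift (suc k) (shift z (P k z) ++ B)
    ≡⟨ cong ((shift (suc z) A ++ P k z) ++_) (trans (map-++ _ (shift z (P k z)) B)
         (cong (_++ shift (suc k) B) (trans (shift-shift (suc k) z (P k z))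
           (cong (λ a → shift (suc a) (P k z)) (ℕ.+-comm k z))))) ⟩
  (shift (suc z) A ++ P k z) ++ (shift (suc z + k) (P k z) ++ shift (suc k) B)
    ↭⟨ ++-interchange (shift (suc z) A) (P k z) (shift (suc z + k) (P k z)) (shift (suc k) B) ⟩
  (shift (suc z) A ++ shift (suc z + k) (P k z)) ++ (P k z ++ shift (suc k) B)
    ≡⟨ cong (_++ (P k z ++ shift (suc k) B)) (trans (map-++ _ A (shift k (P k z)))
         (cong (shift (suc z) A ++_) (shift-shift (suc z) k (P k z)))) ⟨
  shift (suc z) (A ++ shift k (P k z)) ++ (P k z ++ shift (suc k) B)
    ↭⟨ ++⁺ (↭-reflexive (cong (shift (suc z)) (sym (before-pascal₁ k z))))
         (↭-sym (after-pascal₁ k z)) ⟩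
  shift (suc z) (P k (suc z)) ++ P (suc k) z ∎
  where
  open PermutationReasoning
  A = before k z
  B = after k z

-- Guards a branch by the number of letters left; with none left, `pred` would stay at 0 and produce
-- a spurious branch.
when : {A : Set} → ℕ → List A → List A
when zero    xs = []
when (suc _) xs = xs

when-↭ : ∀ {A : Set} k {xs ys : List A} → (0 < k → xs ↭ ys) → when k xs ↭ when k ys
when-↭ zero    p = ↭-refl
when-↭ (suc k) p = p (s≤s z≤n)

map-when : ∀ {A B : Set} (f : A → B) k xs → map f (when k xs) ≡ when k (map f xs)
map-when f zero    xs = refl
map-when f (suc k) xs = refl

-- P k z enumerates words with k letters of one kind and z of another; they are split
-- by their first letter, u and w being the weights of the two possible first letters.
Pascal : (u w : ℕ → ℕ → ℕ) → Set
Pascal u w = ∀ k z → 0 < k + z →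
  P k z ↭ when k (shift (u k z) (P (pred k) z)) ⊕ when z (shift (w k z) (P k (pred z)))

-- For inv a lowered column counts the kept columns to its right, so a lowered first letter weighs
-- `z` and a kept one 0.
pascal-inv : Pascal (λ k z → z) (λ k z → 0)
pascal-inv (suc k) zero    _ = ↭-trans (P-k-0 (suc k)) (↭-trans (↭-sym (P-k-0 k))
  (↭-reflexive (sym (trans (++-identityʳ _) (shift-0 _)))))
pascal-inv zero    (suc z) _ = ↭-refl
pascal-inv (suc k) (suc z) _ = ↭-trans (pascal₂ k z)
  (++⁺ˡ (shift (suc z) (P k (suc z))) (↭-reflexive (sym (shift-0 _))))

-- For quinv it is the kept column that counts the lowered ones to its right.
pascal-quinv : Pascal (λ k z → 0) (λ k z → k)
pascal-quinv (suc k) zero    _ = ↭-trans (P-k-0 (suc k)) (↭-trans (↭-sym (P-k-0 k))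
  (↭-reflexive (sym (trans (++-identityʳ _) (shift-0 _)))))
pascal-quinv zero    (suc z) _ = ↭-refl
pascal-quinv (suc k) (suc z) _ = ↭-reflexive (trans (pascal₁ k z)
  (cong (_++ shift (suc k) (P (suc k) z)) (sym (shift-0 _))))

Π< : ℕ → (ℕ → Laurent) → Laurent
Π< zero    f = 𝟙
Π< (suc n) f = f 0 ⊗ Π< n (f ∘ suc)

Π-cong : ∀ n {f g} → (∀ i → i < n → f i ≡ g i) → Π< n f ≡ Π< n g
Π-cong zero    eq = refl
Π-cong (suc n) eq = cong₂ _⊗_ (eq 0 (s≤s z≤n)) (Π-cong n (λ i p → eq (suc i) (s≤s p)))

-- The factor becomes 1 instead of being removed, so the other factors keep their indices.
without : ℕ → (ℕ → Laurent) → ℕ → Laurent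
without a f i with a ≡ᵇ i
... | true  = 𝟙
... | false = f i

without-cong : ∀ a {f g} → (∀ i → i ≢ a → f i ≡ g i) → ∀ i → without a f i ≡ without a g i
without-cong a eq i with a ℕ.≟ i
... | yes refl rewrite ≡ᵇ-refl a = refl
... | no a≢i rewrite ≡ᵇ-false a≢i = eq i (a≢i ∘ sym)

Π-extract : ∀ n a f → a < n → Π< n f ↭ f a ⊗ Π< n (without a f)
Π-extract (suc n) zero    f _         =
  ⊗-congˡ (f 0) (↭-reflexive (sym (⊗-identityˡ _)))
Π-extract (suc n) (suc a) f (s≤s a<n) = ↭-trans
  (⊗-congˡ (f 0) (Π-extract n a (f ∘ suc) a<n))
  (↭-trans (⊗-swapˡ (f 0) (f (suc a)) _)
    (↭-reflexive (cong (λ g → f (suc a) ⊗ (f 0 ⊗ g)) (Π-cong n (λ i _ → shifted i)))))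
  where
  shifted : ∀ i → without a (f ∘ suc) i ≡ without (suc a) f (suc i)
  shifted i with a ≡ᵇ i
  ... | true  = refl
  ... | false = refl

Π-last : ∀ n f → Π< (suc n) f ↭ f n ⊗ Π< n f
Π-last zero    f = ↭-refl
Π-last (suc n) f = ↭-trans (⊗-congˡ (f 0) (Π-last n (f ∘ suc)))
  (⊗-swapˡ (f 0) (f (suc n)) (Π< n (f ∘ suc)))

-- Column heights on consecutive levels

-- h and h′ list the heights of the columns on consecutive levels; a column of
-- class i is one of height i on the upper level.
tally : (ℕ → ℕ → Bool) → ℕ → List ℕ → List ℕ → ℕ
tally σ i (a ∷ h) (b ∷ h′) = ⟦ i ≡ᵇ a ⟧ * ⟦ σ a b ⟧ + tally σ i h h′
tally σ i _       _        = 0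

lowered kept : ℕ → List ℕ → List ℕ → ℕ
lowered = tally (λ a b → b <ᵇ a)
kept    = tally (λ a b → a ≡ᵇ b)

Steps : List ℕ → List ℕ → Set
Steps = Pointwise Step

count : ℕ → List ℕ → ℕ
count i []      = 0
count i (a ∷ h) = ⟦ i ≡ᵇ a ⟧ + count i h

tally-cong : ∀ σ τ i {h h′} → (∀ b → Step i b → σ i b ≡ τ i b) → Steps h h′ →
  tally σ i h h′ ≡ tally τ i h h′
tally-cong σ τ i eq [] = refl
tally-cong σ τ i eq (_∷_ {x = a} {y = b} s ss) = cong₂ _+_ (head (i ℕ.≟ a)) (tally-cong σ τ i eq ss)
  where
  head : Dec (i ≡ a) → ⟦ i ≡ᵇ a ⟧ * ⟦ σ a b ⟧ ≡ ⟦ i ≡ᵇ a ⟧ * ⟦ τ a b ⟧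
  head (yes refl) = cong (λ t → ⟦ i ≡ᵇ i ⟧ * ⟦ t ⟧) (eq b s)
  head (no i≢a) rewrite ≡ᵇ-false i≢a = refl

tally-false : ∀ i h h′ → tally (λ _ _ → false) i h h′ ≡ 0
tally-false i []      h′       = refl
tally-false i (a ∷ h) []       = refl
tally-false i (a ∷ h) (b ∷ h′) = cong₂ _+_ (ℕ.*-zeroʳ ⟦ i ≡ᵇ a ⟧) (tally-false i h h′)

-- One level of the crossings over all pairs of columns: equal heights on the upper level, heights
-- related by `ρ` on the lower one.
pairStat : (ℕ → ℕ → Bool) → List ℕ → List ℕ → ℕ
pairStat ρ (a ∷ h) (b ∷ h′) = tally (λ _ y → ρ b y) a h h′ + pairStat ρ h h′
pairStat ρ _       _        = 0

-- u and w give the contribution of the leftmost column to pairStat ρ, in terms of the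
-- numbers of lowered and of kept columns of its class, itself included.
record Weights (ρ : ℕ → ℕ → Bool) (u w : ℕ → ℕ → ℕ) : Set where
  field
    pascal    : Pascal u w
    onLowered : ∀ b {h h′} → Steps h h′ → tally (λ _ y → ρ b y) (suc b) h h′
      ≡ u (suc (lowered (suc b) h h′)) (kept (suc b) h h′)
    onKept    : ∀ a {h h′} → Steps h h′ → tally (λ _ y → ρ a y) a h h′
      ≡ w (lowered a h h′) (suc (kept a h h′))

_>ᵇ_ : ℕ → ℕ → Bool
a >ᵇ b = b <ᵇ a

-- Inside a class the lower height has only two possible values, so comparing it with that of the
-- leftmost column either singles out the columns of the other kind or holds for none.
weights-inv : Weights _<ᵇ_ (λ k z → z) (λ k z → 0)
weights-inv = record
  { pascal    = pascal-inv
  ; onLowered = λ b ss → tally-cong _ _ (suc b) (low b) ss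
  ; onKept    = λ a {h} {h′} ss → trans (tally-cong _ _ a (keep a) ss) (tally-false a h h′)
  }
  where
  low : ∀ b y → Step (suc b) y → (b <ᵇ y) ≡ (suc b ≡ᵇ y)
  low b _ (inj₁ refl) = trans (<ᵇ-true (ℕ.n<1+n b)) (sym (≡ᵇ-refl b))
  low b _ (inj₂ refl) = trans (<ᵇ-false {b} ℕ.≤-refl) (sym (≡ᵇ-false (ℕ.1+n≢n {b})))
  keep : ∀ a y → Step a y → (a <ᵇ y) ≡ false
  keep a _ (inj₁ refl) = <ᵇ-false {a} ℕ.≤-refl
  keep _ y (inj₂ refl) = <ᵇ-false {suc y} (ℕ.n≤1+n y)

weights-quinv : Weights _>ᵇ_ (λ k z → 0) (λ k z → k)
weights-quinv = record
  { pascal    = pascal-quinv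
  ; onLowered = λ b {h} {h′} ss →
      trans (tally-cong _ _ (suc b) (low b) ss) (tally-false (suc b) h h′)
  ; onKept    = λ a ss → tally-cong _ _ a (λ _ _ → refl) ss
  }
  where
  low : ∀ b y → Step (suc b) y → (y <ᵇ b) ≡ false
  low b _ (inj₁ refl) = <ᵇ-false {suc b} (ℕ.n≤1+n b)
  low b _ (inj₂ refl) = <ᵇ-false {b} ℕ.≤-refl

dec : ℕ → (ℕ → ℕ) → ℕ → ℕ
dec a f i = f i ∸ ⟦ i ≡ᵇ a ⟧

dec-self : ∀ a f → dec a f a ≡ pred (f a)
dec-self a f rewrite ≡ᵇ-refl a = refl

dec-other : ∀ {a i} f → i ≢ a → dec a f i ≡ f i
dec-other f i≢a rewrite ≡ᵇ-false i≢a = refl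

dec-+ : ∀ a f → 0 < f a → ∀ i → ⟦ i ≡ᵇ a ⟧ + dec a f i ≡ f i
dec-+ a f 0<fa i with i ℕ.≟ a
... | yes refl rewrite ≡ᵇ-refl i = ℕ.m+[n∸m]≡n 0<fa
... | no i≢a rewrite ≡ᵇ-false i≢a = refl

dec-unique : ∀ a f i {x} → ⟦ i ≡ᵇ a ⟧ + x ≡ f i → x ≡ dec a f i
dec-unique a f i {x} eq = sym (trans (cong (_∸ ⟦ i ≡ᵇ a ⟧) (sym eq)) (ℕ.m+n∸m≡n ⟦ i ≡ᵇ a ⟧ x))

head-true : ∀ i a x {t} → t ≡ true → ⟦ i ≡ᵇ a ⟧ * ⟦ t ⟧ + x ≡ ⟦ i ≡ᵇ a ⟧ + x
head-true i a x refl = cong (_+ x) (ℕ.*-identityʳ ⟦ i ≡ᵇ a ⟧)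

head-false : ∀ i a x {t} → t ≡ false → ⟦ i ≡ᵇ a ⟧ * ⟦ t ⟧ + x ≡ x
head-false i a x refl = cong (_+ x) (ℕ.*-zeroʳ ⟦ i ≡ᵇ a ⟧)

module _ (i : ℕ) (h h′ : List ℕ) where

  lowered-lower : ∀ b → lowered i (suc b ∷ h) (b ∷ h′) ≡ ⟦ i ≡ᵇ suc b ⟧ + lowered i h h′
  lowered-lower b = head-true i (suc b) _ (<ᵇ-true (ℕ.n<1+n b))

  kept-lower : ∀ b → kept i (suc b ∷ h) (b ∷ h′) ≡ kept i h h′
  kept-lower b = head-false i (suc b) _ (≡ᵇ-false (ℕ.1+n≢n {b}))

  lowered-keep : ∀ a → lowered i (a ∷ h) (a ∷ h′) ≡ lowered i h h′
  lowered-keep a = head-false i a _ (<ᵇ-false {a} ℕ.≤-refl)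

  kept-keep : ∀ a → kept i (a ∷ h) (a ∷ h′) ≡ ⟦ i ≡ᵇ a ⟧ + kept i h h′
  kept-keep a = head-true i a _ (≡ᵇ-refl a)

-- Enumeration of the steps with prescribed numbers in each class

steps : List ℕ → (ℕ → ℕ) → (ℕ → ℕ) → List (List ℕ)
steps []      k z = [] ∷ []
steps (a ∷ h) k z = when (k a) (map (pred a ∷_) (steps h (dec a k) z))
  ++ when (z a) (map (a ∷_) (steps h k (dec a z)))

-- Every column is either lowered or kept. A column of height 0 cannot be lowered; as `pred 0` is 0,
-- lowering it would duplicate the step that keeps it.
record Balanced (h : List ℕ) (k z : ℕ → ℕ) : Set where
  field
    total : ∀ i → k i + z i ≡ count i h
    k0    : k 0 ≡ 0

open Balanced

balanced-lower : ∀ {a h k z} → Balanced (a ∷ h) k z → 0 < k a → Balanced h (dec a k) z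
balanced-lower {a} {h} {k} {z} B 0<k = record
  { total = λ i → ℕ.+-cancelˡ-≡ ⟦ i ≡ᵇ a ⟧ _ _ (trans (sym (ℕ.+-assoc ⟦ i ≡ᵇ a ⟧ _ _))
      (trans (cong (_+ z i) (dec-+ a k 0<k i)) (total B i)))
  ; k0    = trans (cong (_∸ ⟦ 0 ≡ᵇ a ⟧) (k0 B)) (ℕ.0∸n≡0 ⟦ 0 ≡ᵇ a ⟧)
  }

balanced-keep : ∀ {a h k z} → Balanced (a ∷ h) k z → 0 < z a → Balanced h k (dec a z)
balanced-keep {a} {h} {k} {z} B 0<z = record
  { total = λ i → ℕ.+-cancelˡ-≡ ⟦ i ≡ᵇ a ⟧ _ _
      (trans (lemma ⟦ i ≡ᵇ a ⟧ (k i) (dec a z i))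
      (trans (cong (k i +_) (dec-+ a z 0<z i)) (total B i)))
  ; k0    = k0 B
  }
  where
  lemma : ∀ x y z → x + (y + z) ≡ y + (x + z)
  lemma = solve-∀

record Reaches (h : List ℕ) (k z : ℕ → ℕ) (h′ : List ℕ) : Set where
  field
    stepwise : Steps h h′
    lowered≡ : ∀ i → lowered i h h′ ≡ k i
    kept≡    : ∀ i → kept i h h′ ≡ z i

open Reaches

∈-when⁻ : ∀ {A : Set} {x : A} k {xs} → x ∈ when k xs → 0 < k × x ∈ xs
∈-when⁻ (suc k) p = s≤s z≤n , p

∈-when⁺ : ∀ {A : Set} {x : A} {k xs} → 0 < k → x ∈ xs → x ∈ when k xs
∈-when⁺ {k = suc k} _ p = p

steps⇒reaches : ∀ h {k z h′} → Balanced h k z → h′ ∈ steps h k z → Reaches h k z h′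
steps⇒reaches [] {k} {z} B (here refl) = record
  { stepwise = []
  ; lowered≡ = λ i → sym (ℕ.m+n≡0⇒m≡0 (k i) (total B i))
  ; kept≡    = λ i → sym (ℕ.m+n≡0⇒n≡0 (k i) (total B i))
  }
steps⇒reaches (a ∷ h) {k} {z} B p with ∈-++⁻ (when (k a) _) p
steps⇒reaches (a ∷ h) {k} {z} B p | inj₁ q with ∈-when⁻ (k a) q
... | 0<k , q′ with ∈-map⁻ (pred a ∷_) q′
...   | h′ , h′∈ , refl with a
...     | zero  = ⊥-elim (ℕ.<-irrefl (sym (k0 B)) 0<k)
...     | suc b = record
  { stepwise = inj₂ refl ∷ stepwise R
  ; lowered≡ = λ i → trans (lowered-lower i h h′ b)
      (trans (cong (⟦ i ≡ᵇ suc b ⟧ +_) (lowered≡ R i)) (dec-+ (suc b) k 0<k i))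
  ; kept≡    = λ i → trans (kept-lower i h h′ b) (kept≡ R i)
  }
  where R = steps⇒reaches h (balanced-lower B 0<k) h′∈
steps⇒reaches (a ∷ h) {k} {z} B p | inj₂ q with ∈-when⁻ (z a) q
... | 0<z , q′ with ∈-map⁻ (a ∷_) q′
...   | h′ , h′∈ , refl = record
  { stepwise = inj₁ refl ∷ stepwise R
  ; lowered≡ = λ i → trans (lowered-keep i h h′ a) (lowered≡ R i)
  ; kept≡    = λ i → trans (kept-keep i h h′ a)
      (trans (cong (⟦ i ≡ᵇ a ⟧ +_) (kept≡ R i)) (dec-+ a z 0<z i))
  }
  where R = steps⇒reaches h (balanced-keep B 0<z) h′∈

dec-positive : ∀ a (f : ℕ → ℕ) {x} → ⟦ a ≡ᵇ a ⟧ + x ≡ f a → 0 < f a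
dec-positive a f eq rewrite ≡ᵇ-refl a = subst (0 <_) eq (s≤s z≤n)

reaches⇒steps : ∀ h {k z h′} → Reaches h k z h′ → h′ ∈ steps h k z
reaches⇒steps [] R with stepwise R
... | [] = here refl
reaches⇒steps (a ∷ h) {k} {z} R with stepwise R
... | _∷_ {ys = h′} (inj₁ refl) ss =
  ∈-++⁺ʳ (when (k a) _) (∈-when⁺ (dec-positive a z (self a)) (∈-map⁺ (a ∷_)
    (reaches⇒steps h (record
      { stepwise = ss
      ; lowered≡ = λ i → trans (sym (lowered-keep i h h′ a)) (lowered≡ R i)
      ; kept≡    = λ i → dec-unique a z i (self i)
      }))))
  where
  self : ∀ i → ⟦ i ≡ᵇ a ⟧ + kept i h h′ ≡ z i
  self i = trans (sym (kept-keep i h h′ a)) (kept≡ R i)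
... | _∷_ {y = b} {ys = h′} (inj₂ refl) ss =
  ∈-++⁺ˡ (∈-when⁺ (dec-positive a k (self a)) (∈-map⁺ (b ∷_)
    (reaches⇒steps h (record
      { stepwise = ss
      ; lowered≡ = λ i → dec-unique a k i (self i)
      ; kept≡    = λ i → trans (sym (kept-lower i h h′ b)) (kept≡ R i)
      }))))
  where
  self : ∀ i → ⟦ i ≡ᵇ a ⟧ + lowered i h h′ ≡ k i
  self i = trans (sym (lowered-lower i h h′ b)) (lowered≡ R i)

-- The two branches already differ in the first height, since `k 0 ≡ 0` makes `pred a` different
-- from `a` whenever lowering is allowed.
steps-unique : ∀ h {k z} → Balanced h k z → Unique (steps h k z)
steps-unique []      B = [] ∷ []
steps-unique (a ∷ h) {k} {z} B = Unique.++⁺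
  (when-unique (k a) (λ 0<k → Unique.map⁺ ∷-injectiveʳ (steps-unique h (balanced-lower B 0<k))))
  (when-unique (z a) (λ 0<z → Unique.map⁺ ∷-injectiveʳ (steps-unique h (balanced-keep B 0<z))))
  disjoint
  where
  when-unique : ∀ k {xs : List (List ℕ)} → (0 < k → Unique xs) → Unique (when k xs)
  when-unique zero    u = []
  when-unique (suc k) u = u (s≤s z≤n)

  pred≢ : ∀ a → 0 < k a → pred a ≢ a
  pred≢ zero    0<k _  = ℕ.<-irrefl (sym (k0 B)) 0<k
  pred≢ (suc a) _   eq = ℕ.1+n≢n (sym eq)

  disjoint : ∀ {xs ys x} →
    ¬ (x ∈ when (k a) (map (pred a ∷_) xs) × x ∈ when (z a) (map (a ∷_) ys))
  disjoint (p , q) with ∈-when⁻ (k a) p | ∈-when⁻ (z a) q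
  ... | 0<k , p′ | _ , q′ with ∈-map⁻ (pred a ∷_) p′ | ∈-map⁻ (a ∷_) q′
  ...   | _ , _ , refl | _ , _ , eq =
    pred≢ a 0<k (∷-injectiveˡ eq)

when-⊗ : ∀ k f g → when k f ⊗ g ≡ when k (f ⊗ g)
when-⊗ zero    f g = refl
when-⊗ (suc k) f g = refl

module _ {ρ u w} (W : Weights ρ u w) where

  open Weights W

  -- The first column affects only the factor of its own class `a`: this factor is extracted, split
  -- by its Pascal recursion and put back.
  pascalProduct : ∀ {N a} → a < N → ∀ k z → 0 < k a + z a →
    Π< N (λ i → P (k i) (z i))
      ↭ when (k a) (shift (u (k a) (z a)) (Π< N (λ i → P (dec a k i) (z i))))
      ⊕ when (z a) (shift (w (k a) (z a)) (Π< N (λ i → P (k i) (dec a z i))))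
  pascalProduct {N} {a} a<N k z 0<k+z = begin
    Π< N f
      ↭⟨ Π-extract N a f a<N ⟩
    f a ⊗ R
      ↭⟨ ⊗-congʳ R (pascal (k a) (z a) 0<k+z) ⟩
    (when (k a) (shift x (P (pred (k a)) (z a))) ⊕ when (z a) (shift y (P (k a) (pred (z a))))) ⊗ R
      ≡⟨ ⊗-distribʳ (when (k a) _) (when (z a) _) R ⟩
    when (k a) (shift x (P (pred (k a)) (z a))) ⊗ R
      ⊕ when (z a) (shift y (P (k a) (pred (z a)))) ⊗ R
      ≡⟨ cong₂ _⊕_
           (trans (when-⊗ (k a) _ R)
             (cong (when (k a)) (shift-⊗ (ℤ.+ x) (P (pred (k a)) (z a)) R)))
           (trans (when-⊗ (z a) _ R)
             (cong (when (z a)) (shift-⊗ (ℤ.+ y) (P (k a) (pred (z a))) R))) ⟩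
    when (k a) (shift x (P (pred (k a)) (z a) ⊗ R))
      ⊕ when (z a) (shift y (P (k a) (pred (z a)) ⊗ R))
      ↭⟨ ++⁺ (when-↭ (k a) (λ _ → map⁺ _ lower)) (when-↭ (z a) (λ _ → map⁺ _ keep)) ⟩
    when (k a) (shift x (Π< N (λ i → P (dec a k i) (z i))))
      ⊕ when (z a) (shift y (Π< N (λ i → P (k i) (dec a z i)))) ∎
    where
    open PermutationReasoning
    x = u (k a) (z a)
    y = w (k a) (z a)
    f : ℕ → Laurent
    f i = P (k i) (z i)
    R = Π< N (without a f)

    restore : ∀ g → (∀ i → i ≢ a → f i ≡ g i) → g a ⊗ R ↭ Π< N g
    restore g eq = ↭-trans (↭-reflexive (cong (g a ⊗_) (Π-cong N (λ i _ → without-cong a eq i))))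
      (↭-sym (Π-extract N a g a<N))

    lower : P (pred (k a)) (z a) ⊗ R ↭ Π< N (λ i → P (dec a k i) (z i))
    lower = ↭-trans (↭-reflexive (cong (λ l → P l (z a) ⊗ R) (sym (dec-self a k))))
      (restore _ (λ i i≢a → cong (λ l → P l (z i)) (sym (dec-other k i≢a))))

    keep : P (k a) (pred (z a)) ⊗ R ↭ Π< N (λ i → P (k i) (dec a z i))
    keep = ↭-trans (↭-reflexive (cong (λ l → P (k a) l ⊗ R) (sym (dec-self a z))))
      (restore _ (λ i i≢a → cong (P (k i)) (sym (dec-other z i≢a))))

  -- Induction on the columns. By `Weights` the leftmost column contributes an amount fixed by the
  -- class counts and by whether it is lowered, so each branch is a shifted copy of the sum for the
  -- remaining columns, as in `pascalProduct`.
  steps-generating : ∀ N h {k z} → All (_< N) h → Balanced h k z →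
    map (λ h′ → ℤ.+ pairStat ρ h h′) (steps h k z) ↭ Π< N (λ i → P (k i) (z i))
  steps-generating N [] {k} {z} _ B = ↭-sym (↭-reflexive (trans
    (Π-cong N (λ i _ → cong₂ P (ℕ.m+n≡0⇒m≡0 (k i) (total B i)) (ℕ.m+n≡0⇒n≡0 (k i) (total B i))))
    (units N)))
    where
    units : ∀ N → Π< N (λ _ → P 0 0) ≡ 𝟙
    units zero    = refl
    units (suc N) = trans (⊗-identityˡ _) (units N)
  steps-generating N (a ∷ h) {k} {z} (a<N ∷ h<N) B = begin
    map st (when (k a) (map (pred a ∷_) (steps h (dec a k) z))
      ++ when (z a) (map (a ∷_) (steps h k (dec a z))))
      ≡⟨ map-++ st (when (k a) _) (when (z a) _) ⟩
    map st (when (k a) (map (pred a ∷_) (steps h (dec a k) z)))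
      ++ map st (when (z a) (map (a ∷_) (steps h k (dec a z))))
      ≡⟨ cong₂ _++_ (trans (map-when st (k a) _) (cong (when (k a)) (sym (map-∘ _))))
                    (trans (map-when st (z a) _) (cong (when (z a)) (sym (map-∘ _)))) ⟩
    when (k a) (map (λ h′ → st (pred a ∷ h′)) (steps h (dec a k) z))
      ++ when (z a) (map (λ h′ → st (a ∷ h′)) (steps h k (dec a z)))
      ↭⟨ ++⁺ (when-↭ (k a) lower) (when-↭ (z a) keep) ⟩
    when (k a) (shift (u (k a) (z a)) (Π< N (λ i → P (dec a k i) (z i))))
      ++ when (z a) (shift (w (k a) (z a)) (Π< N (λ i → P (k i) (dec a z i))))
      -- The Pascal recursion fails for the empty word; class `a` is nonempty because it contains
      -- the leftmost column.
      ↭⟨ pascalProduct a<N k z (subst (0 <_) (sym (total B a)) present) ⟨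
    Π< N (λ i → P (k i) (z i)) ∎
    where
    open PermutationReasoning
    st : List ℕ → ℤ
    st h′ = ℤ.+ pairStat ρ (a ∷ h) h′

    present : 0 < count a (a ∷ h)
    present = subst (λ t → 0 < ⟦ t ⟧ + count a h) (sym (≡ᵇ-refl a)) (s≤s z≤n)

    branch : ∀ b c S → (∀ {h′} → h′ ∈ S → tally (λ _ y → ρ b y) a h h′ ≡ c) →
      map (λ h′ → st (b ∷ h′)) S ≡ shift c (map (λ h′ → ℤ.+ pairStat ρ h h′) S)
    branch b c S eq = trans
      (map-cong-local (All.tabulate (λ {h′} h′∈ → trans
        (cong (λ x → ℤ.+ (x + pairStat ρ h h′)) (eq h′∈)) (ℤ.pos-+ c _))))
      (map-∘ S)

    lower : 0 < k a → map (λ h′ → st (pred a ∷ h′)) (steps h (dec a k) z)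
      ↭ shift (u (k a) (z a)) (Π< N (λ i → P (dec a k i) (z i)))
    lower 0<k = ↭-trans (↭-reflexive (branch (pred a) (u (k a) (z a)) _ (weight a B 0<k)))
      (map⁺ _ (steps-generating N h h<N B′))
      where
      B′ = balanced-lower B 0<k
      weight : ∀ a → Balanced (a ∷ h) k z → 0 < k a → ∀ {h′} → h′ ∈ steps h (dec a k) z →
        tally (λ _ y → ρ (pred a) y) a h h′ ≡ u (k a) (z a)
      weight zero    B 0<k h′∈ = ⊥-elim (ℕ.<-irrefl (sym (k0 B)) 0<k)
      weight (suc b) B 0<k h′∈ = trans (onLowered b (stepwise R)) (cong₂ u
        (trans (cong suc (trans (lowered≡ R (suc b)) (dec-self (suc b) k)))
          (ℕ.suc-pred (k (suc b)) ⦃ ℕ.>-nonZero 0<k ⦄))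
        (kept≡ R (suc b)))
        where R = steps⇒reaches h (balanced-lower B 0<k) h′∈

    keep : 0 < z a → map (λ h′ → st (a ∷ h′)) (steps h k (dec a z))
      ↭ shift (w (k a) (z a)) (Π< N (λ i → P (k i) (dec a z i)))
    keep 0<z = ↭-trans (↭-reflexive (branch a (w (k a) (z a)) _ weight))
      (map⁺ _ (steps-generating N h h<N B′))
      where
      B′ = balanced-keep B 0<z
      weight : ∀ {h′} → h′ ∈ steps h k (dec a z) →
        tally (λ _ y → ρ a y) a h h′ ≡ w (k a) (z a)
      weight h′∈ = trans (onKept a (stepwise R)) (cong₂ w (lowered≡ R a)
        (trans (cong suc (trans (kept≡ R a) (dec-self a z)))
          (ℕ.suc-pred (z a) ⦃ ℕ.>-nonZero 0<z ⦄)))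
        where R = steps⇒reaches h B′ h′∈

-- A new leftmost column is paired with each column of its class of the other kind, by exactly one
-- of the two statistics. This is the increment of `lowered * kept` in its class.
pairStat-area : ∀ N {h h′} → All (_< N) h → Steps h h′ →
  pairStat _<ᵇ_ h h′ + pairStat _>ᵇ_ h h′ ≡ Σ< N (λ i → lowered i h h′ * kept i h h′)
pairStat-area N [] [] = sym (Σ-zero N (λ _ → refl))
pairStat-area N {a ∷ h} {_ ∷ h′} (a<N ∷ h<N) (inj₁ refl ∷ ss) = begin
  (tally (λ _ y → a <ᵇ y) a h h′ + x) + (tally (λ _ y → y <ᵇ a) a h h′ + y)
    ≡⟨ cong₂ (λ p q → (p + x) + (q + y))
         (Weights.onKept weights-inv a ss) (Weights.onKept weights-quinv a ss) ⟩
  x + (lowered a h h′ + y)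
    ≡⟨ trans (lemma x (lowered a h h′) y) (cong (lowered a h h′ +_) (pairStat-area N h<N ss)) ⟩
  lowered a h h′ + Σ< N (λ i → lowered i h h′ * kept i h h′)
    ≡⟨ cong (_+ Σ< N (λ i → lowered i h h′ * kept i h h′))
         (Σ-δ N a (λ i → lowered i h h′) (λ N≤a → ⊥-elim (ℕ.<⇒≱ a<N N≤a))) ⟨
  Σ< N (λ i → ⟦ i ≡ᵇ a ⟧ * lowered i h h′) + Σ< N (λ i → lowered i h h′ * kept i h h′)
    ≡⟨ Σ-+ N _ _ ⟨
  Σ< N (λ i → ⟦ i ≡ᵇ a ⟧ * lowered i h h′ + lowered i h h′ * kept i h h′)
    ≡⟨ Σ-cong′ N (λ i → trans (factor ⟦ i ≡ᵇ a ⟧ (lowered i h h′) (kept i h h′))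
         (sym (cong₂ _*_ (lowered-keep i h h′ a) (kept-keep i h h′ a)))) ⟩
  Σ< N (λ i → lowered i (a ∷ h) (a ∷ h′) * kept i (a ∷ h) (a ∷ h′)) ∎
  where
  open ≡-Reasoning
  x = pairStat _<ᵇ_ h h′
  y = pairStat _>ᵇ_ h h′
  lemma : ∀ x l y → x + (l + y) ≡ l + (x + y)
  lemma = solve-∀
  factor : ∀ d l k → d * l + l * k ≡ l * (d + k)
  factor = solve-∀
pairStat-area N {_ ∷ h} {b ∷ h′} (a<N ∷ h<N) (inj₂ refl ∷ ss) = begin
  (tally (λ _ y → b <ᵇ y) a h h′ + x) + (tally (λ _ y → y <ᵇ b) a h h′ + y)
    ≡⟨ cong₂ (λ p q → (p + x) + (q + y))
         (Weights.onLowered weights-inv b ss) (Weights.onLowered weights-quinv b ss) ⟩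
  (kept a h h′ + x) + y
    ≡⟨ trans (ℕ.+-assoc (kept a h h′) x y) (cong (kept a h h′ +_) (pairStat-area N h<N ss)) ⟩
  kept a h h′ + Σ< N (λ i → lowered i h h′ * kept i h h′)
    ≡⟨ cong (_+ Σ< N (λ i → lowered i h h′ * kept i h h′))
         (Σ-δ N a (λ i → kept i h h′) (λ N≤a → ⊥-elim (ℕ.<⇒≱ a<N N≤a))) ⟨
  Σ< N (λ i → ⟦ i ≡ᵇ a ⟧ * kept i h h′) + Σ< N (λ i → lowered i h h′ * kept i h h′)
    ≡⟨ Σ-+ N _ _ ⟨
  Σ< N (λ i → ⟦ i ≡ᵇ a ⟧ * kept i h h′ + lowered i h h′ * kept i h h′)
    ≡⟨ Σ-cong′ N (λ i → trans (sym (ℕ.*-distribʳ-+ (kept i h h′) ⟦ i ≡ᵇ a ⟧ (lowered i h h′)))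
         (sym (cong₂ _*_ (lowered-lower i h h′ b) (kept-lower i h h′ b)))) ⟩
  Σ< N (λ i → lowered i (a ∷ h) (b ∷ h′) * kept i (a ∷ h) (b ∷ h′)) ∎
  where
  open ≡-Reasoning
  a = suc b
  x = pairStat _<ᵇ_ h h′
  y = pairStat _>ᵇ_ h h′

-- Numbers of columns of height at least i

atLeast : ℕ → List ℕ → ℕ
atLeast i []      = 0
atLeast i (a ∷ h) = ⟦ i <ᵇ suc a ⟧ + atLeast i h

atLeast-count : ∀ i h → atLeast i h ≡ count i h + atLeast (suc i) h
atLeast-count i []      = refl
atLeast-count i (a ∷ h) = trans
  (cong₂ _+_ (trans (<ᵇ-suc i a) (cong (λ t → ⟦ t ⟧ + ⟦ i <ᵇ a ⟧) (≡ᵇ-sym a i)))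
    (atLeast-count i h))
  (lemma ⟦ i ≡ᵇ a ⟧ ⟦ i <ᵇ a ⟧ (count i h) (atLeast (suc i) h))
  where
  lemma : ∀ a b c d → (a + b) + (c + d) ≡ (a + c) + (b + d)
  lemma = solve-∀

-- Heights drop by at most one, so only the columns lowered from exactly `i` are lost.
atLeast-lowered : ∀ i {h h′} → Steps h h′ → atLeast i h ≡ lowered i h h′ + atLeast i h′
atLeast-lowered i [] = refl
atLeast-lowered i {a ∷ h} {_ ∷ h′} (inj₁ refl ∷ ss)
  rewrite lowered-keep i h h′ a | atLeast-lowered i ss =
  lemma ⟦ i <ᵇ suc a ⟧ (lowered i h h′) (atLeast i h′)
  where
  lemma : ∀ x l y → x + (l + y) ≡ l + (x + y)
  lemma = solve-∀
atLeast-lowered i {_ ∷ h} {b ∷ h′} (inj₂ refl ∷ ss)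
  rewrite lowered-lower i h h′ b | atLeast-lowered i ss | <ᵇ-suc i (suc b) | ≡ᵇ-sym i (suc b) =
  lemma ⟦ suc b ≡ᵇ i ⟧ ⟦ i <ᵇ suc b ⟧ (lowered i h h′) (atLeast i h′)
  where
  lemma : ∀ d x l y → (d + x) + (l + y) ≡ (d + l) + (x + y)
  lemma = solve-∀

-- A column higher than `i` on the upper level cannot fall below `i`; the others that reach `i` on
-- the lower level were kept there.
atLeast-kept : ∀ i {h h′} → Steps h h′ → atLeast i h′ ≡ kept i h h′ + atLeast (suc i) h
atLeast-kept i [] = refl
atLeast-kept i {a ∷ h} {_ ∷ h′} (inj₁ refl ∷ ss)
  rewrite kept-keep i h h′ a | atLeast-kept i ss | <ᵇ-suc i a | ≡ᵇ-sym i a =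
  lemma ⟦ a ≡ᵇ i ⟧ ⟦ i <ᵇ a ⟧ (kept i h h′) (atLeast (suc i) h)
  where
  lemma : ∀ d x l y → (d + x) + (l + y) ≡ (d + l) + (x + y)
  lemma = solve-∀
atLeast-kept i {_ ∷ h} {b ∷ h′} (inj₂ refl ∷ ss)
  rewrite kept-lower i h h′ b | atLeast-kept i ss =
  lemma ⟦ i <ᵇ suc b ⟧ (kept i h h′) (atLeast (suc i) h)
  where
  lemma : ∀ x l y → x + (l + y) ≡ l + (x + y)
  lemma = solve-∀

atLeast-0⇒bounded : ∀ N h → atLeast N h ≡ 0 → All (_< N) h
atLeast-0⇒bounded N []      eq = []
atLeast-0⇒bounded N (a ∷ h) eq =
  below (N ℕ.<? suc a) ∷ atLeast-0⇒bounded N h (ℕ.m+n≡0⇒n≡0 ⟦ N <ᵇ suc a ⟧ eq)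
  where
  below : Dec (N < suc a) → a < N
  below (no N≮) = ℕ.≮⇒≥ N≮
  below (yes N<) = ⊥-elim (ℕ.1+n≢0
    (trans (sym (cong ⟦_⟧ (<ᵇ-true N<))) (ℕ.m+n≡0⇒m≡0 ⟦ N <ᵇ suc a ⟧ eq)))

-- Chains of levels over an interlacing array

chainStat : (ℕ → ℕ → Bool) → List ℕ → List (List ℕ) → ℕ
chainStat ρ h []       = 0
chainStat ρ h (h′ ∷ C) = pairStat ρ h h′ + chainStat ρ h′ C

-- t j i is the number of columns with at least i entries among the j smallest values:
-- the Gelfand–Tsetlin entry T^j_i, extended by the number of columns for i = 0.
record Interlacing (n : ℕ) (t : ℕ → ℕ → ℕ) : Set where
  field
    columns    : ∀ j → j < n → t j 0 ≡ t (suc j) 0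
    lower      : ∀ j i → j < n → t j i ≤ t (suc j) i
    upper      : ∀ j i → j < n → t (suc j) (suc i) ≤ t j i
    triangular : ∀ j → j ≤ n → t j (suc j) ≡ 0

module Chains {n t} (I : Interlacing n t) where

  open Interlacing I

  -- NE and SE for the step from level `suc j` to level `j`; interlacing makes the truncated
  -- differences exact.
  ne se : ℕ → ℕ → ℕ
  ne j i = t (suc j) i ∸ t j i
  se j i = t j i ∸ t (suc j) (suc i)

  balanced : ∀ j {h} → j < n → (∀ i → atLeast i h ≡ t (suc j) i) → Balanced h (ne j) (se j)
  balanced j {h} j<n eq = record
    { total = λ i → ℕ.+-cancelʳ-≡ (t (suc j) (suc i)) _ _ (begin
        (ne j i + se j i) + t (suc j) (suc i)
          ≡⟨ ℕ.+-assoc (ne j i) _ _ ⟩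
        ne j i + (se j i + t (suc j) (suc i))
          ≡⟨ cong (ne j i +_) (ℕ.m∸n+n≡m (upper j i j<n)) ⟩
        ne j i + t j i
          ≡⟨ ℕ.m∸n+n≡m (lower j i j<n) ⟩
        t (suc j) i
          ≡⟨ trans (sym (eq i)) (atLeast-count i h) ⟩
        count i h + atLeast (suc i) h
          ≡⟨ cong (count i h +_) (eq (suc i)) ⟩
        count i h + t (suc j) (suc i) ∎)
    ; k0 = trans (cong (t (suc j) 0 ∸_) (columns j j<n)) (ℕ.n∸n≡0 (t (suc j) 0))
    }
    where open ≡-Reasoning

  reaches : ∀ j {h h′} → j < n → (∀ i → atLeast i h ≡ t (suc j) i) → Steps h h′ →
    (∀ i → atLeast i h′ ≡ t j i) → Reaches h (ne j) (se j) h′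
  reaches j {h} {h′} j<n eq ss eq′ = record
    { stepwise = ss
    ; lowered≡ = λ i → sym (trans
        (cong (_∸ t j i) (trans (sym (eq i))
          (trans (atLeast-lowered i ss) (cong (lowered i h h′ +_) (eq′ i)))))
        (ℕ.m+n∸n≡m (lowered i h h′) (t j i)))
    ; kept≡    = λ i → sym (trans
        (cong (_∸ t (suc j) (suc i)) (trans (sym (eq′ i))
          (trans (atLeast-kept i ss) (cong (kept i h h′ +_) (eq (suc i))))))
        (ℕ.m+n∸n≡m (kept i h h′) (t (suc j) (suc i))))
    }

  reached : ∀ j {h h′} → j < n → (∀ i → atLeast i h ≡ t (suc j) i) →
    Reaches h (ne j) (se j) h′ → ∀ i → atLeast i h′ ≡ t j i
  reached j {h} {h′} j<n eq R i = ℕ.+-cancelˡ-≡ (ne j i) _ _ (trans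
    (trans (cong (_+ atLeast i h′) (sym (lowered≡ R i)))
      (trans (sym (atLeast-lowered i (stepwise R))) (eq i)))
    (sym (ℕ.m∸n+n≡m (lower j i j<n))))

  -- The possible column heights on the levels j − 1, …, 0, given those on level j.
  chains : ℕ → List ℕ → List (List (List ℕ))
  chains zero    h = [] ∷ []
  chains (suc j) h = concatMap (λ h′ → map (h′ ∷_) (chains j h′)) (steps h (ne j) (se j))

  -- Membership in `chains` expressed through `t` alone, the form in which the heights of a filling
  -- are recognised.
  data Valid : ℕ → List ℕ → List (List ℕ) → Set where
    []  : ∀ {h} → Valid 0 h []
    _∷_ : ∀ {j h h′ C} → Steps h h′ × (∀ i → atLeast i h′ ≡ t j i) → Valid j h′ C →
      Valid (suc j) h (h′ ∷ C)

  valid⇒∈ : ∀ {j h C} → j ≤ n → (∀ i → atLeast i h ≡ t j i) → Valid j h C → C ∈ chains j h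
  valid⇒∈ j≤n eq [] = here refl
  valid⇒∈ {suc j} {h} j<n eq (_∷_ {h′ = h′} (ss , eq′) V) =
    ∈-concatMap⁺ (λ h′ → map (h′ ∷_) (chains j h′)) (lose
      (reaches⇒steps h (reaches j j<n eq ss eq′))
      (∈-map⁺ (h′ ∷_) (valid⇒∈ (ℕ.<⇒≤ j<n) eq′ V)))

  ∈⇒valid : ∀ j {h C} → j ≤ n → (∀ i → atLeast i h ≡ t j i) → C ∈ chains j h → Valid j h C
  ∈⇒valid zero    j≤n eq (here refl) = []
  ∈⇒valid (suc j) {h} j<n eq p
    with find (∈-concatMap⁻ (λ h′ → map (h′ ∷_) (chains j h′)) {xs = steps h (ne j) (se j)} p)
  ... | h′ , h′∈ , q with ∈-map⁻ (h′ ∷_) q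
  ...   | C , C∈ , refl = (stepwise R , eq′) ∷ ∈⇒valid j (ℕ.<⇒≤ j<n) eq′ C∈
    where
    R   = steps⇒reaches h (balanced j j<n eq) h′∈
    eq′ = reached j j<n eq R

  chains-unique : ∀ j h → j ≤ n → (∀ i → atLeast i h ≡ t j i) → Unique (chains j h)
  chains-unique zero    h j≤n eq = [] ∷ []
  chains-unique (suc j) h j<n eq = prefixes _ (steps-unique h (balanced j j<n eq))
    (λ h′∈ → chains-unique j _ (ℕ.<⇒≤ j<n)
      (reached j j<n eq (steps⇒reaches h (balanced j j<n eq) h′∈)))
    where
    headed : ∀ {x : List ℕ} {C} S → x ∷ C ∈ concatMap (λ h′ → map (h′ ∷_) (chains j h′)) S → x ∈ S
    headed S p with find (∈-concatMap⁻ (λ h′ → map (h′ ∷_) (chains j h′)) {xs = S} p)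
    ... | h′ , h′∈ , q with ∈-map⁻ (h′ ∷_) q
    ...   | _ , _ , refl = h′∈

    prefixes : ∀ S → Unique S → (∀ {h′} → h′ ∈ S → Unique (chains j h′)) →
      Unique (concatMap (λ h′ → map (h′ ∷_) (chains j h′)) S)
    prefixes []      u        v = []
    prefixes (x ∷ S) (x∉ ∷ u) v = Unique.++⁺ (Unique.map⁺ ∷-injectiveʳ (v (here refl)))
      (prefixes S u (v ∘ there)) λ { (p , q) → apart p q }
      where
      apart : ∀ {C} → C ∈ map (x ∷_) (chains j x) →
        ¬ (C ∈ concatMap (λ h′ → map (h′ ∷_) (chains j h′)) S)
      apart p q with ∈-map⁻ (x ∷_) p
      ... | _ , _ , refl = All.lookup x∉ (headed S q) refl

  -- Heights on level `suc j` are at most `suc j`, hence `suc (suc j)` classes.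
  chainWeight : ℕ → Laurent
  chainWeight zero    = 𝟙
  chainWeight (suc j) = Π< (suc (suc j)) (λ i → P (ne j i) (se j i)) ⊗ chainWeight j

  bounded : ∀ j {h} → j ≤ n → (∀ i → atLeast i h ≡ t j i) → All (_< suc j) h
  bounded j {h} j≤n eq = atLeast-0⇒bounded (suc j) h (trans (eq (suc j)) (triangular j j≤n))

  -- By induction all continuations of a step `h′` sum to `chainWeight j`, whichever `h′` was
  -- chosen, so this common factor can be taken out of the sum over the steps.
  chains-generating : ∀ {ρ u w} → Weights ρ u w → ∀ j h → j ≤ n → (∀ i → atLeast i h ≡ t j i) →
    map (λ C → ℤ.+ chainStat ρ h C) (chains j h) ↭ chainWeight j
  chains-generating W zero    h j≤n eq = ↭-refl
  chains-generating {ρ} W (suc j) h j<n eq = ↭-trans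
    (product (steps h (ne j) (se j)) (λ {h′} h′∈ → chains-generating W j h′ (ℕ.<⇒≤ j<n)
      (reached j j<n eq (steps⇒reaches h (balanced j j<n eq) h′∈))))
    (⊗-congʳ (chainWeight j)
      (steps-generating W (suc (suc j)) h (bounded (suc j) j<n eq) (balanced j j<n eq)))
    where
    product : ∀ S →
      (∀ {h′} → h′ ∈ S → map (λ C → ℤ.+ chainStat ρ h′ C) (chains j h′) ↭ chainWeight j) →
      map (λ C → ℤ.+ chainStat ρ h C) (concatMap (λ h′ → map (h′ ∷_) (chains j h′)) S)
        ↭ map (λ h′ → ℤ.+ pairStat ρ h h′) S ⊗ chainWeight j
    product []       ih = ↭-refl
    product (h′ ∷ S) ih = ↭-trans (↭-reflexive (map-++ _ (map (h′ ∷_) (chains j h′)) _))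
      (++⁺ (↭-trans (↭-reflexive (trans (sym (map-∘ (chains j h′)))
          (trans (map-cong (λ C → ℤ.pos-+ (pairStat ρ h h′) (chainStat ρ h′ C)) (chains j h′))
            (map-∘ (chains j h′)))))
        (map⁺ _ (ih (here refl)))) (product S (ih ∘ there)))

  chainArea : ∀ {j h C} → j ≤ n → (∀ i → atLeast i h ≡ t j i) → Valid j h C →
    chainStat _<ᵇ_ h C + chainStat _>ᵇ_ h C
      ≡ Σ< j (λ l → Σ< (suc (suc l)) (λ i → ne l i * se l i))
  chainArea j≤n eq [] = refl
  chainArea {suc j} {h} j<n eq (_∷_ {h′ = h′} {C} (ss , eq′) V) = trans
    (lemma (pairStat _<ᵇ_ h h′) (chainStat _<ᵇ_ h′ C) (pairStat _>ᵇ_ h h′) (chainStat _>ᵇ_ h′ C))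
    (trans (cong₂ _+_ level (chainArea (ℕ.<⇒≤ j<n) eq′ V)) (sym (Σ-last j _)))
    where
    lemma : ∀ a b c d → (a + b) + (c + d) ≡ (a + c) + (b + d)
    lemma = solve-∀
    R = reaches j j<n eq ss eq′
    level : pairStat _<ᵇ_ h h′ + pairStat _>ᵇ_ h h′ ≡ Σ< (suc (suc j)) (λ i → ne j i * se j i)
    level = trans (pairStat-area (suc (suc j)) (bounded (suc j) j<n eq) ss)
      (Σ-cong′ (suc (suc j)) (λ i → cong₂ _*_ (lowered≡ R i) (kept≡ R i)))

-- From Gelfand–Tsetlin patterns to chains of levels

module Pattern {n L} {lam : Vec ℕ n} (widths : ∀ r → lookup lam r ≤ L) (T : GT lam) where

  open GT T using (top; NE-≥0; SE-≥0)

  private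
    T′ : ℕ → ℕ → ℤ
    T′ j i = entry T j (suc i)

  -- Only row `n` is nonnegative by definition. The SE inequalities bound an entry from below along
  -- a diagonal ending there, and `d` is the distance.
  T-nonneg : ∀ d j i → j + d ≡ n → i < j → 0ℤ ℤ.≤ T′ j i
  T-nonneg zero j i eq i<j with trans (sym (ℕ.+-identityʳ j)) eq
  ... | refl = subst (λ l → 0ℤ ℤ.≤ T′ n l) (Fin.toℕ-fromℕ< i<j)
    (subst (0ℤ ℤ.≤_) (sym (top (fromℕ< i<j))) (ℤ.+≤+ z≤n))
  T-nonneg (suc d) j i eq i<j = ℤ.≤-trans
    (T-nonneg d (suc j) (suc i) (trans (sym (ℕ.+-suc j d)) eq) (s≤s i<j))
    (ℤ.0≤i-j⇒j≤i (SE-≥0 (suc i) j (s≤s z≤n) i<j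
      (subst (j <_) eq (ℕ.m<m+n j (s≤s z≤n)))))

  τ : ℕ → ℕ → ℕ
  τ j i = ∣ T′ j i ∣

  τ-T : ∀ j i → i < j → j ≤ n → ℤ.+ τ j i ≡ T′ j i
  τ-T j i i<j j≤n = ℤ.0≤i⇒+∣i∣≡i (T-nonneg (n ∸ j) j i (ℕ.m+[n∸m]≡n j≤n) i<j)

  τ-lower : ∀ j i → i < j → j < n → τ j i ≤ τ (suc j) i
  τ-lower j i i<j j<n = ℤ.drop‿+≤+ (subst₂ ℤ._≤_
    (sym (τ-T j i i<j (ℕ.<⇒≤ j<n))) (sym (τ-T (suc j) i (ℕ.m<n⇒m<1+n i<j) j<n))
    (ℤ.0≤i-j⇒j≤i (NE-≥0 (suc i) j (s≤s z≤n) i<j j<n)))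

  τ-upper : ∀ j i → i < j → j < n → τ (suc j) (suc i) ≤ τ j i
  τ-upper j i i<j j<n = ℤ.drop‿+≤+ (subst₂ ℤ._≤_
    (sym (τ-T (suc j) (suc i) (s≤s i<j) j<n)) (sym (τ-T j i i<j (ℕ.<⇒≤ j<n)))
    (ℤ.0≤i-j⇒j≤i (SE-≥0 (suc i) j (s≤s z≤n) i<j j<n)))

  τ-top : ∀ r → τ n (toℕ r) ≡ lookup lam r
  τ-top r = cong ∣_∣ (top r)

  τ≤L : ∀ d j i → j + d ≡ n → i < j → τ j i ≤ L
  τ≤L zero j i eq i<j with trans (sym (ℕ.+-identityʳ j)) eq
  ... | refl = subst (λ l → τ n l ≤ L) (Fin.toℕ-fromℕ< i<j)
    (subst (_≤ L) (sym (τ-top (fromℕ< i<j))) (widths (fromℕ< i<j)))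
  τ≤L (suc d) j i eq i<j = ℕ.≤-trans
    (τ-lower j i i<j (subst (j <_) eq (ℕ.m<m+n j (s≤s z≤n))))
    (τ≤L d (suc j) i (trans (sym (ℕ.+-suc j d)) eq) (ℕ.m<n⇒m<1+n i<j))

  -- All `L` columns have height at least 0. Outside the triangle the array `entry T` is arbitrary,
  -- so its values are cut off to 0.
  t : ℕ → ℕ → ℕ
  t j zero    = L
  t j (suc i) = ⟦ i <ᵇ j ⟧ * τ j i

  t-inside : ∀ {j i} → i < j → t j (suc i) ≡ τ j i
  t-inside {j} {i} i<j = trans (cong (λ b → ⟦ b ⟧ * τ j i) (<ᵇ-true i<j)) (ℕ.*-identityˡ _)

  t-outside : ∀ {j i} → j ≤ i → t j (suc i) ≡ 0
  t-outside {j} {i} j≤i = cong (λ b → ⟦ b ⟧ * τ j i) (<ᵇ-false j≤i)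

  interlacing : Interlacing n t
  interlacing = record
    { columns    = λ _ _ → refl
    ; lower      = lower
    ; upper      = upper
    ; triangular = λ j _ → t-outside {j} ℕ.≤-refl
    }
    where
    lower : ∀ j i → j < n → t j i ≤ t (suc j) i
    lower j zero    j<n = ℕ.≤-refl
    lower j (suc i) j<n with i ℕ.<? j
    ... | yes i<j = subst₂ _≤_ (sym (t-inside i<j)) (sym (t-inside (ℕ.m<n⇒m<1+n i<j)))
                      (τ-lower j i i<j j<n)
    ... | no i≮j  = subst (_≤ t (suc j) (suc i)) (sym (t-outside (ℕ.≮⇒≥ i≮j))) z≤n

    upper : ∀ j i → j < n → t (suc j) (suc i) ≤ t j i
    upper j zero    j<n = subst (_≤ L) (sym (t-inside (s≤s z≤n)))
      (τ≤L (n ∸ suc j) (suc j) 0 (ℕ.m+[n∸m]≡n j<n) (s≤s z≤n))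
    upper j (suc i) j<n with i ℕ.<? j
    ... | yes i<j = subst₂ _≤_ (sym (t-inside (s≤s i<j))) (sym (t-inside i<j))
                      (τ-upper j i i<j j<n)
    ... | no i≮j  = subst (_≤ t j (suc i)) (sym (t-outside (s≤s (ℕ.≮⇒≥ i≮j)))) z≤n

  open Chains interlacing

  -- With `se-last` this disposes of the boundary classes: no column of height 0 is lowered, and one
  -- of height `suc j` on level `suc j` contains every value so far and must be lowered.
  ne-0 : ∀ j → ne j 0 ≡ 0
  ne-0 j = ℕ.n∸n≡0 L

  se-last : ∀ j → se j (suc j) ≡ 0
  se-last j = trans (cong (_∸ t (suc j) (suc (suc j))) (t-outside {j} ℕ.≤-refl))
    (ℕ.0∸n≡0 (t (suc j) (suc (suc j))))

  private
    difference : ∀ {a b} → b ≤ a → ℤ.+ a ℤ.- ℤ.+ b ≡ ℤ.+ (a ∸ b)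
    difference {a} {b} b≤a = trans (ℤ.m-n≡m⊖n a b) (ℤ.⊖-≥ b≤a)

  NE-ne : ∀ j i → i < j → j < n → NE (entry T) (suc i) j ≡ ℤ.+ ne j (suc i)
  NE-ne j i i<j j<n = trans
    (cong₂ ℤ._-_ (sym (τ-T (suc j) i (ℕ.m<n⇒m<1+n i<j) j<n)) (sym (τ-T j i i<j (ℕ.<⇒≤ j<n))))
    (trans (difference (τ-lower j i i<j j<n))
      (cong ℤ.+_ (sym (cong₂ _∸_ (t-inside (ℕ.m<n⇒m<1+n i<j)) (t-inside i<j)))))

  SE-se : ∀ j i → i < j → j < n → SE (entry T) (suc i) j ≡ ℤ.+ se j (suc i)
  SE-se j i i<j j<n = trans
    (cong₂ ℤ._-_ (sym (τ-T j i i<j (ℕ.<⇒≤ j<n))) (sym (τ-T (suc j) (suc i) (s≤s i<j) j<n)))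
    (trans (difference (τ-upper j i i<j j<n))
      (cong ℤ.+_ (sym (cong₂ _∸_ (t-inside i<j) (t-inside (s≤s i<j))))))

  wtFactor-P : ∀ j i → i < j → j < n →
    wtFactor (entry T) (suc i , j) ≡ P (ne j (suc i)) (se j (suc i))
  wtFactor-P j i i<j j<n rewrite NE-ne j i i<j j<n | SE-se j i i<j j<n = refl

  triangle-suc : ∀ j → triangle (suc j) ≡ triangle j ++ map (_, j) (1… j)
  triangle-suc zero    = refl
  triangle-suc (suc j) = trans
    (cong (concatMap (λ j → map (_, j) (1… j)))
      (trans (cong (map suc) (sym (upTo-∷ʳ j))) (map-++ suc (upTo j) (j ∷ []))))
    (trans (concatMap-++ (λ j → map (_, j) (1… j)) (1… j) (suc j ∷ []))
      (cong (triangle (suc j) ++_) (++-identityʳ _)))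

  private
    wt : List (ℕ × ℕ) → Laurent
    wt xs = ∏[ ij ∈ xs ] wtFactor (entry T) ij

  ∏-++ : ∀ {A : Set} (f : A → Laurent) xs ys →
    (∏[ x ∈ xs ++ ys ] f x) ≡ (∏[ x ∈ xs ] f x) ⊗ (∏[ x ∈ ys ] f x)
  ∏-++ f []       ys = sym (⊗-identityˡ _)
  ∏-++ f (x ∷ xs) ys = trans (cong (f x ⊗_) (∏-++ f xs ys)) (sym (⊗-assoc (f x) _ _))

  ∏-applyUpTo : ∀ {A : Set} (f : A → Laurent) (g : ℕ → A) m →
    (∏[ x ∈ applyUpTo g m ] f x) ≡ Π< m (f ∘ g)
  ∏-applyUpTo f g zero    = refl
  ∏-applyUpTo f g (suc m) = cong (f (g 0) ⊗_) (∏-applyUpTo f (g ∘ suc) m)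

  row-cells : ∀ j → map (_, j) (1… j) ≡ applyUpTo (λ i → (suc i , j)) j
  row-cells j = trans (cong (map (_, j)) (map-applyUpTo id suc j)) (map-applyUpTo suc (_, j) j)

  levelWeight : ∀ j → j < n →
    Π< (suc (suc j)) (λ i → P (ne j i) (se j i)) ↭ wt (map (_, j) (1… j))
  levelWeight j j<n = begin
    f 0 ⊗ Π< (suc j) (f ∘ suc)
      ≡⟨ trans (cong (λ k → P k (se j 0) ⊗ Π< (suc j) (f ∘ suc)) (ne-0 j)) (⊗-identityˡ _) ⟩
    Π< (suc j) (f ∘ suc)
      ↭⟨ Π-last j (f ∘ suc) ⟩
    f (suc j) ⊗ Π< j (f ∘ suc)
      ↭⟨ ⊗-congʳ _ (↭-trans (↭-reflexive (cong (P (ne j (suc j))) (se-last j)))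
           (P-k-0 (ne j (suc j)))) ⟩
    𝟙 ⊗ Π< j (f ∘ suc)
      ≡⟨ ⊗-identityˡ _ ⟩
    Π< j (f ∘ suc)
      ≡⟨ Π-cong j (λ i i<j → wtFactor-P j i i<j j<n) ⟨
    Π< j (λ i → wtFactor (entry T) (suc i , j))
      ≡⟨ ∏-applyUpTo (wtFactor (entry T)) (λ i → (suc i , j)) j ⟨
    wt (applyUpTo (λ i → (suc i , j)) j)
      ≡⟨ cong wt (row-cells j) ⟨
    wt (map (_, j) (1… j)) ∎
    where
    open PermutationReasoning
    f : ℕ → Laurent
    f i = P (ne j i) (se j i)

  chainWeight-wt : ∀ j → j ≤ n → chainWeight j ↭ wt (triangle j)
  chainWeight-wt zero    j≤n = ↭-refl
  chainWeight-wt (suc j) j<n = begin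
    Π< (suc (suc j)) (λ i → P (ne j i) (se j i)) ⊗ chainWeight j
      ↭⟨ ⊗-congʳ (chainWeight j) (levelWeight j j<n) ⟩
    wt (map (_, j) (1… j)) ⊗ chainWeight j
      ↭⟨ ⊗-congˡ (wt (map (_, j) (1… j))) (chainWeight-wt j (ℕ.<⇒≤ j<n)) ⟩
    wt (map (_, j) (1… j)) ⊗ wt (triangle j)
      ↭⟨ ⊗-comm (wt (map (_, j) (1… j))) (wt (triangle j)) ⟩
    wt (triangle j) ⊗ wt (map (_, j) (1… j))
      ≡⟨ ∏-++ (wtFactor (entry T)) (triangle j) _ ⟨
    wt (triangle j ++ map (_, j) (1… j))
      ≡⟨ cong wt (triangle-suc j) ⟨
    wt (triangle (suc j)) ∎
    where open PermutationReasoning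

  private
    product : ℕ × ℕ → ℤ
    product (i , j) = NE (entry T) i j ℤ.* SE (entry T) i j

    areaSum : List (ℕ × ℕ) → ℤ
    areaSum xs = foldr ℤ._+_ 0ℤ (map product xs)

  areaSum-++ : ∀ xs ys → areaSum (xs ++ ys) ≡ areaSum xs ℤ.+ areaSum ys
  areaSum-++ []       ys = sym (ℤ.+-identityˡ _)
  areaSum-++ (x ∷ xs) ys = trans (cong (ℤ._+_ (product x)) (areaSum-++ xs ys))
    (sym (ℤ.+-assoc (product x) (areaSum xs) (areaSum ys)))

  areaSum-applyUpTo : ∀ (g : ℕ → ℕ × ℕ) f m → (∀ i → i < m → product (g i) ≡ ℤ.+ f i) →
    areaSum (applyUpTo g m) ≡ ℤ.+ Σ< m f
  areaSum-applyUpTo g f zero    eq = refl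
  areaSum-applyUpTo g f (suc m) eq = trans
    (cong₂ ℤ._+_ (eq 0 (s≤s z≤n))
      (areaSum-applyUpTo (g ∘ suc) (f ∘ suc) m (λ i p → eq (suc i) (s≤s p))))
    (sym (ℤ.pos-+ (f 0) _))

  levelArea : ∀ j → j < n →
    areaSum (map (_, j) (1… j)) ≡ ℤ.+ Σ< (suc (suc j)) (λ i → ne j i * se j i)
  levelArea j j<n = trans (cong areaSum (row-cells j)) (trans
    (areaSum-applyUpTo (λ i → (suc i , j)) (f ∘ suc) j (λ i i<j → trans
      (cong₂ ℤ._*_ (NE-ne j i i<j j<n) (SE-se j i i<j j<n)) (sym (ℤ.pos-* (ne j (suc i)) _))))
    (cong ℤ.+_ (sym (trans
      (cong (_+ Σ< (suc j) (f ∘ suc)) (cong (_* se j 0) (ne-0 j)))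
      (trans (Σ-last j (f ∘ suc)) (cong (_+ Σ< j (f ∘ suc))
        (trans (cong (ne j (suc j) *_) (se-last j)) (ℕ.*-zeroʳ (ne j (suc j))))))))))
    where
    f : ℕ → ℕ
    f i = ne j i * se j i

  areaSum-triangle : ∀ j → j ≤ n →
    areaSum (triangle j) ≡ ℤ.+ Σ< j (λ l → Σ< (suc (suc l)) (λ i → ne l i * se l i))
  areaSum-triangle zero    j≤n = refl
  areaSum-triangle (suc j) j<n = begin
    areaSum (triangle (suc j))
      ≡⟨ trans (cong areaSum (triangle-suc j)) (areaSum-++ (triangle j) _) ⟩
    areaSum (triangle j) ℤ.+ areaSum (map (_, j) (1… j))
      ≡⟨ cong₂ ℤ._+_ (areaSum-triangle j (ℕ.<⇒≤ j<n)) (levelArea j j<n) ⟩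
    ℤ.+ Σ< j f ℤ.+ ℤ.+ f j
      ≡⟨ trans (sym (ℤ.pos-+ (Σ< j f) (f j))) (cong ℤ.+_ (ℕ.+-comm (Σ< j f) (f j))) ⟩
    ℤ.+ (f j + Σ< j f)
      ≡⟨ cong ℤ.+_ (Σ-last j f) ⟨
    ℤ.+ Σ< (suc j) f ∎
    where
    open ≡-Reasoning
    f : ℕ → ℕ
    f l = Σ< (suc (suc l)) (λ i → ne l i * se l i)

-- Levels of a table of heights

level : ℕ → (ℕ → ℕ → ℕ) → ℕ → List ℕ
level L η v = applyUpTo (λ c → η c v) L

profile : ℕ → (ℕ → ℕ → ℕ) → ℕ → List (List ℕ)
profile L η zero    = []
profile L η (suc j) = level L η j ∷ profile L η j

tally-applyUpTo : ∀ σ i L f g → tally σ i (applyUpTo f L) (applyUpTo g L)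
  ≡ Σ< L (λ d → ⟦ i ≡ᵇ f d ⟧ * ⟦ σ (f d) (g d) ⟧)
tally-applyUpTo σ i zero    f g = refl
tally-applyUpTo σ i (suc L) f g =
  cong (⟦ i ≡ᵇ f 0 ⟧ * ⟦ σ (f 0) (g 0) ⟧ +_) (tally-applyUpTo σ i L (f ∘ suc) (g ∘ suc))

-- Column 0 splits off from `pairs` by computation: `_<ᵇ_` reduces to false whenever the right
-- column is column 0.
pairStat-applyUpTo : ∀ ρ L f g → pairStat ρ (applyUpTo f L) (applyUpTo g L)
  ≡ pairs L _<ᵇ_ (λ c d → ⟦ f c ≡ᵇ f d ⟧ * ⟦ ρ (g c) (g d) ⟧)
pairStat-applyUpTo ρ zero    f g = refl
pairStat-applyUpTo ρ (suc L) f g = cong₂ _+_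
  (trans (tally-applyUpTo (λ _ → ρ (g 0)) (f 0) L (f ∘ suc) (g ∘ suc))
    (Σ-cong′ L (λ d → sym (ℕ.*-identityˡ _))))
  (pairStat-applyUpTo ρ L (f ∘ suc) (g ∘ suc))

chainStat-profile : ∀ ρ L η j → chainStat ρ (level L η j) (profile L η j)
  ≡ pairs L _<ᵇ_ (λ c d → Σ< j (λ v → ⟦ η c (suc v) ≡ᵇ η d (suc v) ⟧ * ⟦ ρ (η c v) (η d v) ⟧))
chainStat-profile ρ L η j = trans (levels j) (Σ-pairs j L _<ᵇ_ _)
  where
  levels : ∀ j → chainStat ρ (level L η j) (profile L η j) ≡ Σ< j (λ v →
    pairs L _<ᵇ_ (λ c d → ⟦ η c (suc v) ≡ᵇ η d (suc v) ⟧ * ⟦ ρ (η c v) (η d v) ⟧))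
  levels zero    = refl
  levels (suc j) = trans (cong₂ _+_ (pairStat-applyUpTo ρ L _ _) (levels j)) (sym (Σ-last j _))

chainStat-crossings : ∀ L η n → chainStat _<ᵇ_ (level L η n) (profile L η n)
  ≡ pairs L _<ᵇ_ (λ c d → crossings n (η c) (η d))
chainStat-crossings L η n = chainStat-profile _<ᵇ_ L η n

chainStat-crossings′ : ∀ L η n → chainStat _>ᵇ_ (level L η n) (profile L η n)
  ≡ pairs L _<ᵇ_ (λ c d → crossings n (η d) (η c))
chainStat-crossings′ L η n = trans (chainStat-profile _>ᵇ_ L η n)
  (pairs-cong L _<ᵇ_ (λ c d → Σ-cong′ n (λ v →
    cong (λ b → ⟦ b ⟧ * ⟦ η d v <ᵇ η c v ⟧) (≡ᵇ-sym (η c (suc v)) (η d (suc v))))))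

atLeast-applyUpTo : ∀ i f L → atLeast i (applyUpTo f L) ≡ Σ< L (λ c → ⟦ i <ᵇ suc (f c) ⟧)
atLeast-applyUpTo i f zero    = refl
atLeast-applyUpTo i f (suc L) = cong (⟦ i <ᵇ suc (f 0) ⟧ +_) (atLeast-applyUpTo i (f ∘ suc) L)

Σ-one : ∀ n → Σ< n (λ _ → 1) ≡ n
Σ-one zero    = refl
Σ-one (suc n) = cong suc (Σ-one n)

Σ-below : ∀ L {a} → a ≤ L → Σ< L (λ c → ⟦ c <ᵇ a ⟧) ≡ a
Σ-below L       {zero}  _         = Σ-zero L (λ _ → refl)
Σ-below (suc L) {suc a} (s≤s a≤L) = cong suc (Σ-below L a≤L)

applyUpTo-cong : ∀ L {f g : ℕ → ℕ} → (∀ c → c < L → f c ≡ g c) → applyUpTo f L ≡ applyUpTo g L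
applyUpTo-cong zero    eq = refl
applyUpTo-cong (suc L) eq =
  cong₂ _∷_ (eq 0 (s≤s z≤n)) (applyUpTo-cong L (λ c p → eq (suc c) (s≤s p)))

applyUpTo-injective : ∀ L {f g : ℕ → ℕ} → applyUpTo f L ≡ applyUpTo g L →
  ∀ c → c < L → f c ≡ g c
applyUpTo-injective (suc L) eq zero    _         = ∷-injectiveˡ eq
applyUpTo-injective (suc L) eq (suc c) (s≤s c<L) = applyUpTo-injective L (∷-injectiveʳ eq) c c<L

profile-cong : ∀ L {η θ} j → (∀ v → v < j → ∀ c → c < L → η c v ≡ θ c v) →
  profile L η j ≡ profile L θ j
profile-cong L zero    eq = refl
profile-cong L (suc j) eq = cong₂ _∷_ (applyUpTo-cong L (eq j ℕ.≤-refl))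
  (profile-cong L j (λ v v<j → eq v (ℕ.m<n⇒m<1+n v<j)))

profile-injective : ∀ L {η θ} j → profile L η j ≡ profile L θ j →
  ∀ v → v < j → ∀ c → c < L → η c v ≡ θ c v
profile-injective L {η} {θ} (suc j) eq v v<1+j with ℕ.m≤n⇒m<n∨m≡n (ℕ.≤-pred v<1+j)
... | inj₁ v<j  = profile-injective L {η} {θ} j (∷-injectiveʳ eq) v v<j
... | inj₂ refl = applyUpTo-injective L (∷-injectiveˡ eq)

steps-applyUpTo⁺ : ∀ L {f g} → (∀ c → c < L → Step (f c) (g c)) →
  Steps (applyUpTo f L) (applyUpTo g L)
steps-applyUpTo⁺ zero    s = []
steps-applyUpTo⁺ (suc L) s = s 0 (s≤s z≤n) ∷ steps-applyUpTo⁺ L (λ c p → s (suc c) (s≤s p))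

steps-applyUpTo⁻ : ∀ L f {h′} → Steps (applyUpTo f L) h′ →
  ∃ λ g → h′ ≡ applyUpTo g L × (∀ c → c < L → Step (f c) (g c))
steps-applyUpTo⁻ zero    f [] = f , refl , λ _ ()
steps-applyUpTo⁻ (suc L) f (_∷_ {y = b} s ss) with steps-applyUpTo⁻ L (f ∘ suc) ss
... | g , refl , s′ = g′ , refl , step
  where
  g′ : ℕ → ℕ
  g′ zero    = b
  g′ (suc c) = g c
  step : ∀ c → c < suc L → Step (f c) (g′ c)
  step zero    _         = s
  step (suc c) (s≤s c<L) = s′ c c<L

-- Row counts and row sorting

entries≤-val : ∀ {n m L} {lam : Vec ℕ m} → (∀ r → lookup lam r ≤ L) → (F : Filling n lam) →
  ∀ j i → entries≤ F j i ≡ Σ< L (λ c → ⟦ val F (toℕ i) c <ᵇ suc (toℕ j) ⟧)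
entries≤-val {L = L} {lam} widths F j i = trans (length-filter _ (allFin (lookup lam i)))
  (sum-allFin L _ _ (widths i)
    (λ c → cong ⟦_⟧ (trans (≤ᵇ-<ᵇ (toℕ (F ⟨ cell i c ⟩)) (toℕ j))
      (cong (_<ᵇ suc (toℕ j)) (sym (val-cell F i c)))))
    (λ c λ≤c → cong ⟦_⟧ (<ᵇ-false
      (subst (suc (toℕ j) ≤_) (sym (val-right F i c λ≤c)) (Fin.toℕ<n j)))))
  where
  ≤ᵇ-<ᵇ : ∀ a b → (a ℕ.≤ᵇ b) ≡ (a <ᵇ suc b)
  ≤ᵇ-<ᵇ zero    b = refl
  ≤ᵇ-<ᵇ (suc a) b = refl

entriesBelow : ∀ {n k} (j : Fin n) (xs : Vec (Fin n) k) →
  length (filter (λ c → lookup xs c Fin.≤? j) (allFin k)) ≡ length (filter (Fin._≤? j) (toList xs))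
entriesBelow {k = k} j xs = trans (length-filter _ (allFin k))
  (trans (cong sum (map-tabulate id (λ c → ⟦ does (lookup xs c Fin.≤? j) ⟧)))
    (trans (along xs) (sym (length-filter (Fin._≤? j) (toList xs)))))
  where
  along : ∀ {k} (xs : Vec (Fin _) k) → sum (tabulate (λ c → ⟦ does (lookup xs c Fin.≤? j) ⟧))
    ≡ sum (map (λ x → ⟦ does (x Fin.≤? j) ⟧) (toList xs))
  along []       = refl
  along (x ∷ xs) = cong (⟦ does (x Fin.≤? j) ⟧ +_) (along xs)

toList-sortRow : ∀ {n k} (xs : Vec (Fin n) k) → toList (sortRow xs) ↭ toList xs
toList-sortRow {n} xs = ↭-trans
  (↭-reflexive (trans (Vec.toList-cast _ _) (Vec.toList∘fromList _)))
  (sort-↭ (Fin.≤-decTotalOrder n) (toList xs))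

lookup⁺-map : ∀ {n m} {lam : Vec ℕ m} (F : Filling n lam) i →
  lookup⁺ (rsort F) i ≡ sortRow (lookup⁺ F i)
lookup⁺-map (xs ∷ F) Fin.zero    = refl
lookup⁺-map (xs ∷ F) (Fin.suc i) = lookup⁺-map F i

-- A row count sees only the multiset of the row, so the condition on the sorted tableau becomes one
-- on the filling itself.
entries≤-rsort : ∀ {n m} {lam : Vec ℕ m} (F : Filling n lam) j i →
  entries≤ (rsort F) j i ≡ entries≤ F j i
entries≤-rsort {lam = lam} F j i = trans
  (cong (λ xs → length (filter (λ c → lookup xs c Fin.≤? j) (allFin (lookup lam i))))
    (lookup⁺-map F i))
  (trans (entriesBelow j (sortRow (lookup⁺ F i)))
    (trans (↭-length (filter-↭ (Fin._≤? j) (toList-sortRow (lookup⁺ F i))))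
      (sym (entriesBelow j (lookup⁺ F i)))))

-- Fillings and their chains of column heights

lamAt : ∀ {m} → Vec ℕ m → ℕ → ℕ
lamAt []        r       = 0
lamAt (l ∷ lam) zero    = l
lamAt (l ∷ lam) (suc r) = lamAt lam r

lamAt-lookup : ∀ {m} (lam : Vec ℕ m) r → lamAt lam (toℕ r) ≡ lookup lam r
lamAt-lookup (l ∷ lam) Fin.zero    = refl
lamAt-lookup (l ∷ lam) (Fin.suc r) = lamAt-lookup lam r

lamAt-fromℕ< : ∀ {m} (lam : Vec ℕ m) {r} (r<m : r < m) → lamAt lam r ≡ lookup lam (fromℕ< r<m)
lamAt-fromℕ< lam r<m =
  trans (cong (lamAt lam) (sym (Fin.toℕ-fromℕ< r<m))) (lamAt-lookup lam (fromℕ< r<m))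

lamAt-below : ∀ {m} (lam : Vec ℕ m) r → m ≤ r → lamAt lam r ≡ 0
lamAt-below []        r       _         = refl
lamAt-below (l ∷ lam) (suc r) (s≤s m≤r) = lamAt-below lam r m≤r

lamAt-decreasing : ∀ {m} {lam : Vec ℕ m} → IsPartition lam → ∀ r → lamAt lam (suc r) ≤ lamAt lam r
lamAt-decreasing {m} {lam} part r with suc r ℕ.<? m
... | no ≮m  = subst (_≤ lamAt lam r) (sym (lamAt-below lam (suc r) (ℕ.≮⇒≥ ≮m))) z≤n
... | yes <m = subst₂ _≤_ (sym (lamAt-fromℕ< lam <m)) (sym (lamAt-fromℕ< lam r<m))
  (part (fromℕ< r<m) (fromℕ< <m)
    (subst₂ _≤_ (sym (Fin.toℕ-fromℕ< r<m)) (sym (Fin.toℕ-fromℕ< <m)) (ℕ.n≤1+n r)))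
  where r<m = ℕ.<-trans (ℕ.n<1+n r) <m

lamAt-bounded : ∀ {m L} (lam : Vec ℕ m) → (∀ r → lookup lam r ≤ L) → ∀ r → lamAt lam r ≤ L
lamAt-bounded []        widths r       = z≤n
lamAt-bounded (l ∷ lam) widths zero    = widths Fin.zero
lamAt-bounded (l ∷ lam) widths (suc r) = lamAt-bounded lam (widths ∘ Fin.suc) r

rowVal-inside : ∀ {n k} (xs : Vec (Fin n) k) c → (rowVal xs c <ᵇ n) ≡ (c <ᵇ k)
rowVal-inside {n} []       c       = <ᵇ-false {n} ℕ.≤-refl
rowVal-inside     (x ∷ xs) zero    = <ᵇ-true (Fin.toℕ<n x)
rowVal-inside     (x ∷ xs) (suc c) = rowVal-inside xs c

val-inside : ∀ {n m} {lam : Vec ℕ m} (F : Filling n lam) r c →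
  (val F r c <ᵇ n) ≡ (c <ᵇ lamAt lam r)
val-inside {n} []       r       c = <ᵇ-false {n} ℕ.≤-refl
val-inside     (xs ∷ F) zero    c = rowVal-inside xs c
val-inside     (xs ∷ F) (suc r) c = val-inside F r c

row-ext : ∀ {A : Set} {k} (xs ys : Vec A k) → (∀ c → lookup xs c ≡ lookup ys c) → xs ≡ ys
row-ext []       []       eq = refl
row-ext (x ∷ xs) (y ∷ ys) eq = cong₂ _∷_ (eq Fin.zero) (row-ext xs ys (eq ∘ Fin.suc))

filling-ext : ∀ {n m} {lam : Vec ℕ m} (F G : Filling n lam) →
  (∀ r c → F ⟨ cell r c ⟩ ≡ G ⟨ cell r c ⟩) → F ≡ G
filling-ext []       []       eq = refl
filling-ext (xs ∷ F) (ys ∷ G) eq =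
  cong₂ _∷_ (row-ext xs ys (eq Fin.zero)) (filling-ext F G (eq ∘ Fin.suc))

lookup⁺∘lookup⁻ : ∀ {A : Set} {Q : A → Set} {m} (xs : Vec A m) (f : ∀ i → Q (lookup xs i)) i →
  lookup⁺ {P = Q} (lookup⁻ {xs = xs} f) i ≡ f i
lookup⁺∘lookup⁻ (_ ∷ _)          f Fin.zero    = refl
lookup⁺∘lookup⁻ {Q = Q} (_ ∷ xs) f (Fin.suc i) = lookup⁺∘lookup⁻ {Q = Q} xs (f ∘ Fin.suc) i

build : ∀ {n m} {lam : Vec ℕ m} (e : ℕ → ℕ → ℕ) →
  (∀ r (c : Fin (lookup lam r)) → e (toℕ r) (toℕ c) < n) → Filling n lam
build e e<n = lookup⁻ (λ r → Vec.tabulate (λ c → fromℕ< (e<n r c)))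

build-cell : ∀ {n m} {lam : Vec ℕ m} e
  (e<n : ∀ r (c : Fin (lookup lam r)) → e (toℕ r) (toℕ c) < n) r c →
  toℕ (build {lam = lam} e e<n ⟨ cell r c ⟩) ≡ e (toℕ r) (toℕ c)
build-cell {n} {lam = lam} e e<n r c = trans
  (cong (λ xs → toℕ (lookup xs c))
    (lookup⁺∘lookup⁻ {Q = Vec (Fin n)} lam (λ r → Vec.tabulate (λ c → fromℕ< (e<n r c))) r))
  (trans (cong toℕ (Vec.lookup∘tabulate (λ c → fromℕ< (e<n r c)) c)) (Fin.toℕ-fromℕ< (e<n r c)))

module Fibre {n L} {lam : Vec ℕ n} (part : IsPartition lam)
  (widths : ∀ r → lookup lam r ≤ L) (T : GT lam) where

  open Pattern widths T
  open Chains interlacing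

  -- The conjugate partition: the heights forced on level `n`, where every entry is counted.
  columnLength : ℕ → ℕ
  columnLength c = Σ< n (λ r → ⟦ c <ᵇ lamAt lam r ⟧)

  topLevel : List ℕ
  topLevel = applyUpTo columnLength L

  columnLength-galois : ∀ c r → (c <ᵇ lamAt lam r) ≡ (r <ᵇ columnLength c)
  columnLength-galois c = initialSegment n (λ r → c <ᵇ lamAt lam r)
    (λ r p → ℕ.<⇒<ᵇ (ℕ.<-≤-trans (ℕ.<ᵇ⇒< c (lamAt lam (suc r)) p)
      (lamAt-decreasing {lam = lam} part r)))
    (λ r n≤r → trans (cong (c <ᵇ_) (lamAt-below lam r n≤r)) (<ᵇ-false {c} z≤n))

  columnLength≤n : ∀ c → columnLength c ≤ n
  columnLength≤n c = ℕ.≮⇒≥ λ n<l → ℕ.<⇒≱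
    (<ᵇ-transport (sym (columnLength-galois c n)) n<l)
    (subst (_≤ c) (sym (lamAt-below lam n ℕ.≤-refl)) z≤n)

  -- Conjugating twice: column `c` is longer than `r` exactly when `c` is less than the length of
  -- row `r`, so counting such columns returns that length.
  topLevel-pattern : ∀ i → atLeast i topLevel ≡ t n i
  topLevel-pattern zero    = trans (atLeast-applyUpTo 0 columnLength L) (Σ-one L)
  topLevel-pattern (suc r) = trans (atLeast-applyUpTo (suc r) columnLength L)
    (trans (Σ-cong′ L (λ c → cong ⟦_⟧ (sym (columnLength-galois c r))))
      (trans (Σ-below L (lamAt-bounded lam widths r)) row-length))
    where
    row-length : lamAt lam r ≡ t n (suc r)
    row-length with r ℕ.<? n
    ... | yes r<n = trans (lamAt-fromℕ< lam r<n) (trans (sym (τ-top (fromℕ< r<n)))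
      (trans (cong (τ n) (Fin.toℕ-fromℕ< r<n)) (sym (t-inside r<n))))
    ... | no r≮n = trans (lamAt-below lam r (ℕ.≮⇒≥ r≮n)) (sym (t-outside (ℕ.≮⇒≥ r≮n)))

  height-top : ∀ (F : Filling n lam) c → height F c n ≡ columnLength c
  height-top F c = Σ-cong′ n (λ r → cong ⟦_⟧ (val-inside F r c))

  level-top : ∀ (F : Filling n lam) → level L (height F) n ≡ topLevel
  level-top F = applyUpTo-cong L (λ c _ → height-top F c)

  OnPattern : Filling n lam → Set
  OnPattern F = ∀ v → v ≤ n → ∀ i → atLeast i (level L (height F) v) ≡ t v i

  module _ (F : Filling n lam) (cs : ColumnStrict F) where

    private
      module E = Entries {n} {n} {L} (val F) (val-below F) (val-strict part F cs) (val-rows F)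

    height-galois : ∀ c r v → v ≤ n → (val F r c <ᵇ v) ≡ (r <ᵇ height F c v)
    height-galois = E.galois

    height-step : ∀ c v → v < n → Step (height F c (suc v)) (height F c v)
    height-step c = Column.step (E.column c)

    height≤ : ∀ c v → v ≤ n → height F c v ≤ v
    height≤ c zero    v≤n = ℕ.≤-reflexive (Σ-zero n (λ r → cong ⟦_⟧ (<ᵇ-false {val F r c} z≤n)))
    height≤ c (suc v) v<n = ℕ.≤-trans (E.η-suc c v<n) (s≤s (height≤ c v (ℕ.<⇒≤ v<n)))

    atLeast-height : ∀ r v → v ≤ n →
      atLeast (suc r) (level L (height F) v) ≡ Σ< L (λ c → ⟦ val F r c <ᵇ v ⟧)
    atLeast-height r v v≤n = trans (atLeast-applyUpTo (suc r) (λ c → height F c v) L)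
      (Σ-cong′ L (λ c → cong ⟦_⟧ (sym (height-galois c r v v≤n))))

    entries-pattern : ∀ i j →
      entries≤ (rsort F) j i ≡ atLeast (suc (toℕ i)) (level L (height F) (suc (toℕ j)))
    entries-pattern i j = trans (entries≤-rsort F j i) (trans (entries≤-val widths F j i)
      (sym (atLeast-height (toℕ i) (suc (toℕ j)) (Fin.toℕ<n j))))

    onPattern⇒represents : OnPattern F → Represents (rsort F) T
    onPattern⇒represents on i j i≤j = trans
      (sym (τ-T (suc (toℕ j)) (toℕ i) (s≤s i≤j) (Fin.toℕ<n j)))
      (cong ℤ.+_ (trans (sym (t-inside (s≤s i≤j)))
        (trans (sym (on (suc (toℕ j)) (Fin.toℕ<n j) (suc (toℕ i)))) (sym (entries-pattern i j)))))

    -- `Represents` speaks only of the triangle. Index 0 counts all columns, and beyond the triangle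
    -- both sides vanish because a strict column has at most `v` entries below `v`.
    represents⇒onPattern : Represents (rsort F) T → OnPattern F
    represents⇒onPattern rep v v≤n zero =
      trans (atLeast-applyUpTo 0 (λ c → height F c v) L) (Σ-one L)
    represents⇒onPattern rep v v≤n (suc r) with r ℕ.<? v
    ... | no r≮v = trans (atLeast-applyUpTo (suc r) (λ c → height F c v) L)
      (trans (Σ-zero L (λ c → cong ⟦_⟧
        (<ᵇ-false {r} (ℕ.≤-trans (height≤ c v v≤n) (ℕ.≮⇒≥ r≮v))))) (sym (t-outside (ℕ.≮⇒≥ r≮v))))
    represents⇒onPattern rep (suc w) w<n (suc r) | yes r<v = trans
      (subst₂ (λ r w → atLeast (suc r) (level L (height F) (suc w)) ≡ τ (suc w) r)
        (Fin.toℕ-fromℕ< r<n) (Fin.toℕ-fromℕ< w<n)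
        (trans (sym (entries-pattern i j)) (sym (cong ∣_∣ (rep i j i≤j)))))
      (sym (t-inside r<v))
      where
      r<n = ℕ.<-≤-trans r<v w<n
      i = fromℕ< r<n
      j = fromℕ< w<n
      i≤j = subst₂ _≤_ (sym (Fin.toℕ-fromℕ< r<n)) (sym (Fin.toℕ-fromℕ< w<n)) (ℕ.≤-pred r<v)

    profile-valid : OnPattern F → Valid n topLevel (profile L (height F) n)
    profile-valid on = subst (λ h → Valid n h (profile L (height F) n)) (level-top F)
      (levels n ℕ.≤-refl)
      where
      levels : ∀ j → j ≤ n → Valid j (level L (height F) j) (profile L (height F) j)
      levels zero    j≤n = []
      levels (suc j) j<n = (steps-applyUpTo⁺ L (λ c _ → height-step c j j<n) , on j (ℕ.<⇒≤ j<n))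
        ∷ levels j (ℕ.<⇒≤ j<n)

  -- The profile gives the heights on the levels below `n`, and the shape gives those on level `n`.
  -- By the equivalence `height-galois` they decide whether each entry is below `v` for every
  -- `v ≤ n`.
  profile-determines : ∀ F G → ColumnStrict F → ColumnStrict G →
    profile L (height F) n ≡ profile L (height G) n → F ≡ G
  profile-determines F G csF csG eq = filling-ext F G λ r c → Fin.toℕ-injective
    (thresholds (Fin.toℕ<n (F ⟨ cell r c ⟩)) (Fin.toℕ<n (G ⟨ cell r c ⟩)) λ v v≤n → begin
      (toℕ (F ⟨ cell r c ⟩) <ᵇ v)
        ≡⟨ cong (_<ᵇ v) (val-cell F r c) ⟨
      (val F (toℕ r) (toℕ c) <ᵇ v)
        ≡⟨ height-galois F csF (toℕ c) (toℕ r) v v≤n ⟩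
      (toℕ r <ᵇ height F (toℕ c) v)
        ≡⟨ cong (toℕ r <ᵇ_) (heights v v≤n (toℕ c) (ℕ.<-≤-trans (Fin.toℕ<n c) (widths r))) ⟩
      (toℕ r <ᵇ height G (toℕ c) v)
        ≡⟨ height-galois G csG (toℕ c) (toℕ r) v v≤n ⟨
      (val G (toℕ r) (toℕ c) <ᵇ v)
        ≡⟨ cong (_<ᵇ v) (val-cell G r c) ⟩
      (toℕ (G ⟨ cell r c ⟩) <ᵇ v) ∎)
    where
    open ≡-Reasoning
    heights : ∀ v → v ≤ n → ∀ c → c < L → height F c v ≡ height G c v
    heights v v≤n c c<L with ℕ.m≤n⇒m<n∨m≡n v≤n
    ... | inj₁ v<n  = profile-injective L {height F} {height G} n eq v v<n c c<L
    ... | inj₂ refl = trans (height-top F c) (sym (height-top G c))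

    thresholds : ∀ {a b} → a < n → b < n → (∀ v → v ≤ n → (a <ᵇ v) ≡ (b <ᵇ v)) → a ≡ b
    thresholds {a} {b} a<n b<n same = ℕ.≤-antisym
      (ℕ.≤-pred (<ᵇ-transport (sym (same (suc b) b<n)) (ℕ.n<1+n b)))
      (ℕ.≤-pred (<ᵇ-transport (same (suc a) a<n) (ℕ.n<1+n a)))

step-mono : ∀ {a b} → Step a b → b ≤ a
step-mono (inj₁ refl) = ℕ.≤-refl
step-mono (inj₂ refl) = ℕ.n≤1+n _

step-suc : ∀ {a b} → Step a b → a ≤ suc b
step-suc (inj₁ refl) = ℕ.n≤1+n _
step-suc (inj₂ refl) = ℕ.≤-refl

extend : ℕ → (ℕ → ℕ → ℕ) → (ℕ → ℕ) → ℕ → ℕ → ℕ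
extend j η f c v with v <ᵇ suc j
... | true  = η c v
... | false = f c

extend-below : ∀ j η f c {v} → v ≤ j → extend j η f c v ≡ η c v
extend-below j η f c v≤j rewrite <ᵇ-true (s≤s v≤j) = refl

extend-at : ∀ j η f c → extend j η f c (suc j) ≡ f c
extend-at j η f c rewrite <ᵇ-false {suc j} {suc j} ℕ.≤-refl = refl

-- The lists of fillings

allRows-complete : ∀ {n k} (xs : Vec (Fin n) k) → xs ∈ allRows n k
allRows-complete []       = here refl
allRows-complete (x ∷ xs) = ∈-cartesianProductWith⁺ _∷_ (∈-allFin x) (allRows-complete xs)

allFillings-complete : ∀ {n m} {lam : Vec ℕ m} (F : Filling n lam) → F ∈ allFillings n lam
allFillings-complete []       = here refl
allFillings-complete (xs ∷ F) =
  ∈-cartesianProductWith⁺ _∷_ (allRows-complete xs) (allFillings-complete F)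

allRows-unique : ∀ n k → Unique (allRows n k)
allRows-unique n zero    = [] ∷ []
allRows-unique n (suc k) =
  Unique.cartesianProductWith⁺ _∷_ Vec.∷-injective (Unique.allFin⁺ n) (allRows-unique n k)

allFillings-unique : ∀ n {m} (lam : Vec ℕ m) → Unique (allFillings n lam)
allFillings-unique n []        = [] ∷ []
allFillings-unique n (l ∷ lam) = Unique.cartesianProductWith⁺ _∷_ (λ { refl → refl , refl })
  (allRows-unique n l) (allFillings-unique n lam)

∈-rsort⁻¹⁺ : ∀ {n} {lam : Vec ℕ n} (T : GT lam) F → InFibre T F → F ∈ rsort⁻¹ T
∈-rsort⁻¹⁺ T F = ∈-filter⁺ (λ F → columnStrict? F ×-dec represents? (rsort F) T)
  (allFillings-complete F)

∈-rsort⁻¹⁻ : ∀ {n} {lam : Vec ℕ n} (T : GT lam) F → F ∈ rsort⁻¹ T → InFibre T F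
∈-rsort⁻¹⁻ {n} {lam} T F F∈ = proj₂ (∈-filter⁻ (λ F → columnStrict? F ×-dec represents? (rsort F) T)
  {xs = allFillings n lam} F∈)

map-unique : ∀ {A B : Set} {f : A → B} {xs} →
  (∀ {x y} → x ∈ xs → y ∈ xs → f x ≡ f y → x ≡ y) → Unique xs → Unique (map f xs)
map-unique {xs = []}     inj []       = []
map-unique {f = f} {x ∷ xs} inj (x∉ ∷ u) =
  All.tabulate (λ p eq → apart (∈-map⁻ f p) eq) ∷ map-unique (λ p q → inj (there p) (there q)) u
  where
  apart : ∀ {y} → ∃ (λ x′ → x′ ∈ xs × y ≡ f x′) → f x ≢ y
  apart (x′ , x′∈ , refl) eq = All.lookup x∉ x′∈ (inj (here refl) (there x′∈) eq)

∑-monomials : ∀ {A : Set} (f : A → ℤ) xs → (∑[ x ∈ xs ] (q^ f x)) ≡ map f xs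
∑-monomials f []       = refl
∑-monomials f (x ∷ xs) = cong (f x ∷_) (∑-monomials f xs)

-- The bijection between a fibre and its chains

module Enumeration {n L} {lam : Vec ℕ n} (part : IsPartition lam)
  (widths : ∀ r → lookup lam r ≤ L) (T : GT lam) where

  open Pattern widths T
  open Chains interlacing
  open Fibre part widths T

  -- A chain is a list of levels; rebuilding entries needs the height of one column as a function of
  -- the level.
  record Realisation (j : ℕ) (f : ℕ → ℕ) (C : List (List ℕ)) : Set where
    field
      η       : ℕ → ℕ → ℕ
      start   : ∀ c → η c j ≡ f c
      chain   : C ≡ profile L η j
      descend : ∀ v → v < j → ∀ c → c < L → Step (η c (suc v)) (η c v)
      counts  : ∀ v → v ≤ j → ∀ i → atLeast i (level L η v) ≡ t v i

  realise : ∀ j f {C} → (∀ i → atLeast i (applyUpTo f L) ≡ t j i) →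
    Valid j (applyUpTo f L) C → Realisation j f C
  realise zero f eq [] = record
    { η       = λ c _ → f c
    ; start   = λ c → refl
    ; chain   = refl
    ; descend = λ _ ()
    ; counts = λ { zero _ → eq }
    }
  realise (suc j) f eq ((ss , eq′) ∷ V) with steps-applyUpTo⁻ L f ss
  ... | g , refl , s = record
    { η       = η′
    ; start   = extend-at j η f
    ; chain   = cong₂ _∷_
        (applyUpTo-cong L (λ c _ → sym (trans (extend-below j η f c ℕ.≤-refl) (start c))))
        (trans chain (profile-cong L j (λ v v<j c _ → sym (extend-below j η f c (ℕ.<⇒≤ v<j)))))
    ; descend = descend′
    ; counts = counts′
    }
    where
    open Realisation (realise j g eq′ V)
    η′ = extend j η f

    descend′ : ∀ v → v < suc j → ∀ c → c < L → Step (η′ c (suc v)) (η′ c v)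
    descend′ v v<1+j c c<L with ℕ.m≤n⇒m<n∨m≡n (ℕ.≤-pred v<1+j)
    ... | inj₁ v<j  = subst₂ Step (sym (extend-below j η f c v<j))
      (sym (extend-below j η f c (ℕ.<⇒≤ v<j))) (descend v v<j c c<L)
    ... | inj₂ refl = subst₂ Step (sym (extend-at j η f c))
      (sym (trans (extend-below j η f c ℕ.≤-refl) (start c))) (s c c<L)

    counts′ : ∀ v → v ≤ suc j → ∀ i → atLeast i (level L η′ v) ≡ t v i
    counts′ v v≤1+j i with ℕ.m≤n⇒m<n∨m≡n v≤1+j
    ... | inj₁ v<1+j = trans (cong (atLeast i)
      (applyUpTo-cong L (λ c _ → extend-below j η f c (ℕ.≤-pred v<1+j))))
      (counts v (ℕ.≤-pred v<1+j) i)
    ... | inj₂ refl  = trans (cong (atLeast i)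
      (applyUpTo-cong L (λ c _ → extend-at j η f c))) (eq i)

  module _ {C} (R : Realisation n columnLength C) where

    open Realisation R

    η-zero : ∀ {c} → c < L → η c 0 ≡ 0
    η-zero c<L = ℕ.n<1⇒n≡0 (applyUpTo⁻ (λ c → η c 0) L
      (atLeast-0⇒bounded 1 (level L η 0) (trans (counts 0 z≤n 1) (t-outside {0} {0} z≤n))) c<L)

    η-mono : ∀ {c} → c < L → ∀ {v} w → v ≤ w → w ≤ n → η c v ≤ η c w
    η-mono c<L zero    z≤n   w≤n = ℕ.≤-refl
    η-mono c<L (suc w) v≤1+w w<n with ℕ.m≤n⇒m<n∨m≡n v≤1+w
    ... | inj₁ v<1+w = ℕ.≤-trans (η-mono c<L w (ℕ.≤-pred v<1+w) (ℕ.<⇒≤ w<n))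
                         (step-mono (descend w w<n _ c<L))
    ... | inj₂ refl  = ℕ.≤-refl

    η≤columnLength : ∀ {c v} → c < L → v ≤ n → η c v ≤ columnLength c
    η≤columnLength {c} {v} c<L v≤n = subst (η c v ≤_) (start c) (η-mono c<L n v≤n ℕ.≤-refl)

    private
      absent : ℕ → ℕ → ℕ → Bool
      absent r c v = (v <ᵇ n) ∧ (η c (suc v) <ᵇ suc r)

    -- The entry in row r of column c is the number of values v for which the column
    -- has at most r entries that are at most v.
    e : ℕ → ℕ → ℕ
    e r c = Σ< n (λ v → ⟦ absent r c v ⟧)

    absent-segment : ∀ r {c} → c < L → ∀ v → absent r c v ≡ (v <ᵇ e r c)
    absent-segment r {c} c<L = initialSegment n (absent r c) down
      (λ v n≤v → cong (_∧ (η c (suc v) <ᵇ suc r)) (<ᵇ-false n≤v))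
      where
      down : ∀ v → Bool.T (absent r c (suc v)) → Bool.T (absent r c v)
      down v a with Equivalence.to T-∧ a
      ... | p , q = Equivalence.from T-∧ (ℕ.<⇒<ᵇ (ℕ.<-trans (ℕ.n<1+n v) v<n) ,
        ℕ.<⇒<ᵇ (ℕ.≤-<-trans (step-mono (descend (suc v) v<n c c<L)) (ℕ.<ᵇ⇒< _ (suc r) q)))
        where v<n = ℕ.<ᵇ⇒< (suc v) n p

    e-large : ∀ {r c v} → c < L → v < n → η c (suc v) ≤ r → v < e r c
    e-large {r} {c} {v} c<L v<n η≤r = ℕ.<ᵇ⇒< v (e r c) (subst Bool.T (absent-segment r c<L v)
      (Equivalence.from T-∧ (ℕ.<⇒<ᵇ v<n , ℕ.<⇒<ᵇ (s≤s η≤r))))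

    e-small : ∀ {r c v} → c < L → v < e r c → η c (suc v) ≤ r
    e-small {r} {c} {v} c<L v<e = ℕ.≤-pred (ℕ.<ᵇ⇒< (η c (suc v)) (suc r)
      (proj₂ (Equivalence.to T-∧ (subst Bool.T (sym (absent-segment r c<L v)) (ℕ.<⇒<ᵇ v<e)))))

    e⇒η : ∀ {r c v} → c < L → v ≤ n → e r c < v → r < η c v
    e⇒η {v = suc v} c<L v<n e<1+v = ℕ.≰⇒> λ η≤r → ℕ.<⇒≱ (e-large c<L v<n η≤r) (ℕ.≤-pred e<1+v)

    η⇒e : ∀ {r c v} → c < L → v ≤ n → r < η c v → e r c < v
    -- The definition of `e` uses only the heights at successors, so level 0 is settled by `η-zero`.
    η⇒e {v = zero}  c<L v≤n r<η = ⊥-elim (ℕ.n≮0 (subst (_ <_) (η-zero c<L) r<η))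
    η⇒e {v = suc v} c<L v<n r<η = s≤s (ℕ.≮⇒≥ λ v<e → ℕ.<⇒≱ r<η (e-small c<L v<e))

    -- At the level `e r′ c` the height is about to exceed `r′`. It grows by at most one, so there
    -- it is already at least `r′` and hence above `r`.
    e-strict : ∀ {r r′ c} → c < L → r < r′ → e r′ c < n → e r c < e r′ c
    e-strict {r} {r′} {c} c<L r<r′ e<n = η⇒e c<L (ℕ.<⇒≤ e<n) (ℕ.<-≤-trans r<r′
      (ℕ.≤-pred (ℕ.≤-trans (e⇒η c<L e<n (ℕ.n<1+n (e r′ c)))
        (step-suc (descend (e r′ c) e<n c c<L)))))

    e-inside : ∀ {r c} → c < L → c < lamAt lam r → e r c < n
    e-inside {r} {c} c<L c<λ = η⇒e c<L ℕ.≤-refl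
      (subst (r <_) (sym (start c)) (<ᵇ-transport (columnLength-galois c r) c<λ))

    private
      e-cell : ∀ r (c : Fin (lookup lam r)) → e (toℕ r) (toℕ c) < n
      e-cell r c = e-inside (ℕ.<-≤-trans (Fin.toℕ<n c) (widths r))
        (subst (toℕ c <_) (sym (lamAt-lookup lam r)) (Fin.toℕ<n c))

    filling : Filling n lam
    filling = build e e-cell

    filling-strict : ColumnStrict filling
    filling-strict r c r′ c′ c≡c′ r<r′ = subst₂ _<_
      (sym (trans (build-cell {lam = lam} e e-cell r c) (cong (e (toℕ r)) c≡c′)))
      (sym (build-cell {lam = lam} e e-cell r′ c′))
      (e-strict (ℕ.<-≤-trans (Fin.toℕ<n c′) (widths r′)) r<r′ (e-cell r′ c′))

    filling-val : ∀ r c → c < lamAt lam r → val filling r c ≡ e r c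
    filling-val r c c<λ = trans (val-at filling r<n c<λ′)
      (trans (build-cell {lam = lam} e e-cell (fromℕ< r<n) (fromℕ< c<λ′))
        (cong₂ e (Fin.toℕ-fromℕ< r<n) (Fin.toℕ-fromℕ< c<λ′)))
      where
      r<n = ℕ.≰⇒> λ n≤r → ℕ.n≮0 (subst (c <_) (lamAt-below lam r n≤r) c<λ)
      c<λ′ = subst (c <_) (lamAt-fromℕ< lam r<n) c<λ

    filling-galois : ∀ r {c v} → c < L → v ≤ n → (val filling r c <ᵇ v) ≡ (r <ᵇ η c v)
    filling-galois r {c} {v} c<L v≤n with c ℕ.<? lamAt lam r
    ... | yes c<λ = trans (cong (_<ᵇ v) (filling-val r c c<λ)) (<ᵇ-cong (e⇒η c<L v≤n) (η⇒e c<L v≤n))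
    -- Off the diagram the entry is `n`, and `r` is at least the column length, which bounds every
    -- height.
    ... | no c≮λ  = trans
      (<ᵇ-false (ℕ.≤-trans v≤n (ℕ.≮⇒≥ λ val<n → c≮λ (<ᵇ-transport (val-inside filling r c) val<n))))
      (sym (<ᵇ-false (ℕ.≮⇒≥ λ r<η → c≮λ (<ᵇ-transport (sym (columnLength-galois c r))
        (ℕ.<-≤-trans r<η (η≤columnLength c<L v≤n))))))

    filling-height : ∀ {c v} → c < L → v ≤ n → height filling c v ≡ η c v
    filling-height {c} {v} c<L v≤n = trans
      (Σ-cong′ n (λ r → cong ⟦_⟧ (filling-galois r c<L v≤n)))
      (Σ-below n (ℕ.≤-trans (η≤columnLength c<L v≤n) (columnLength≤n c)))

    filling-onPattern : OnPattern filling
    filling-onPattern v v≤n i = trans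
      (cong (atLeast i) (applyUpTo-cong L (λ c c<L → filling-height c<L v≤n))) (counts v v≤n i)

    filling-inFibre : InFibre T filling
    filling-inFibre = filling-strict , onPattern⇒represents filling filling-strict filling-onPattern

    filling-profile : profile L (height filling) n ≡ C
    filling-profile = trans
      (profile-cong L n (λ v v<n c c<L → filling-height c<L (ℕ.<⇒≤ v<n))) (sym chain)

  heightChain : Filling n lam → List (List ℕ)
  heightChain F = profile L (height F) n

  heightChain-valid : ∀ F → InFibre T F → Valid n topLevel (heightChain F)
  heightChain-valid F (cs , rep) = profile-valid F cs (represents⇒onPattern F cs rep)

  -- Two duplicate-free lists with the same members are permutations of each other.
  -- `profile-determines` gives injectivity on the fibre, and `filling` a preimage of every chain.
  fibre-chains : map heightChain (rsort⁻¹ T) ↭ chains n topLevel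
  fibre-chains = ∼bag⇒↭ (unique∧set⇒bag
    (map-unique (λ {F} {G} F∈ G∈ →
        profile-determines F G (proj₁ (∈-rsort⁻¹⁻ T F F∈)) (proj₁ (∈-rsort⁻¹⁻ T G G∈)))
      (Unique.filter⁺ (λ F → columnStrict? F ×-dec represents? (rsort F) T)
        (allFillings-unique n lam)))
    (chains-unique n topLevel ℕ.≤-refl topLevel-pattern)
    (mk⇔ to from))
    where
    to : ∀ {C} → C ∈ map heightChain (rsort⁻¹ T) → C ∈ chains n topLevel
    to p with ∈-map⁻ heightChain p
    ... | F , F∈ , refl =
      valid⇒∈ ℕ.≤-refl topLevel-pattern (heightChain-valid F (∈-rsort⁻¹⁻ T F F∈))

    from : ∀ {C} → C ∈ chains n topLevel → C ∈ map heightChain (rsort⁻¹ T)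
    from C∈ = subst (_∈ map heightChain (rsort⁻¹ T)) (filling-profile R)
      (∈-map⁺ heightChain (∈-rsort⁻¹⁺ T (filling R) (filling-inFibre R)))
      where R = realise n columnLength topLevel-pattern (∈⇒valid n ℕ.≤-refl topLevel-pattern C∈)

  inv-chain : ∀ F → ColumnStrict F → inv F ≡ ℤ.+ chainStat _<ᵇ_ topLevel (heightChain F)
  inv-chain F cs = trans (inv-crossings part widths F cs) (cong ℤ.+_ (trans
    (sym (chainStat-crossings L (height F) n))
    (cong (λ h → chainStat _<ᵇ_ h (heightChain F)) (level-top F))))

  quinv-chain : ∀ F → ColumnStrict F → quinv F ≡ ℤ.+ chainStat _>ᵇ_ topLevel (heightChain F)
  quinv-chain F cs = trans (quinv-crossings part widths F cs) (cong ℤ.+_ (trans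
    (sym (chainStat-crossings′ L (height F) n))
    (cong (λ h → chainStat _>ᵇ_ h (heightChain F)) (level-top F))))

  generating : ∀ {ρ u w} → Weights ρ u w → (stat : Filling n lam → ℤ) →
    (∀ F → ColumnStrict F → stat F ≡ ℤ.+ chainStat ρ topLevel (heightChain F)) →
    (∑[ F ∈ rsort⁻¹ T ] (q^ stat F)) ↭ wt-q T
  generating {ρ} W stat eq = begin
    (∑[ F ∈ rsort⁻¹ T ] (q^ stat F))
      ≡⟨ ∑-monomials stat (rsort⁻¹ T) ⟩
    map stat (rsort⁻¹ T)
      ≡⟨ map-cong-local (All.tabulate (λ {F} F∈ → eq F (proj₁ (∈-rsort⁻¹⁻ T F F∈)))) ⟩
    map (λ F → ℤ.+ chainStat ρ topLevel (heightChain F)) (rsort⁻¹ T)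
      ≡⟨ map-∘ (rsort⁻¹ T) ⟩
    map (λ C → ℤ.+ chainStat ρ topLevel C) (map heightChain (rsort⁻¹ T))
      ↭⟨ map⁺ _ fibre-chains ⟩
    map (λ C → ℤ.+ chainStat ρ topLevel C) (chains n topLevel)
      ↭⟨ chains-generating W n topLevel ℕ.≤-refl topLevel-pattern ⟩
    chainWeight n
      ↭⟨ chainWeight-wt n ℕ.≤-refl ⟩
    wt-q T ∎
    where open PermutationReasoning

  inv+quinv≡area : ∀ F → InFibre T F → inv F ℤ.+ quinv F ≡ area T
  inv+quinv≡area F fib@(cs , _) = begin
    inv F ℤ.+ quinv F
      ≡⟨ cong₂ ℤ._+_ (inv-chain F cs) (quinv-chain F cs) ⟩
    ℤ.+ chainStat _<ᵇ_ topLevel (heightChain F) ℤ.+ ℤ.+ chainStat _>ᵇ_ topLevel (heightChain F)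
      ≡⟨ ℤ.pos-+ (chainStat _<ᵇ_ topLevel (heightChain F)) _ ⟨
    ℤ.+ (chainStat _<ᵇ_ topLevel (heightChain F) + chainStat _>ᵇ_ topLevel (heightChain F))
      ≡⟨ cong ℤ.+_ (chainArea ℕ.≤-refl topLevel-pattern (heightChain-valid F fib)) ⟩
    ℤ.+ Σ< n (λ l → Σ< (suc (suc l)) (λ i → ne l i * se l i))
      ≡⟨ areaSum-triangle n ℕ.≤-refl ⟨
    area T ∎
    where open ≡-Reasoning

corollary4 : (n : ℕ) → n ≥ 1 → (lam : Vec ℕ n) → IsPartition lam → (T : GT lam) →
    (((∑[ F ∈ rsort⁻¹ T ] (q^ inv F)) ≈ (∑[ F ∈ rsort⁻¹ T ] (q^ quinv F)))
    × ((∑[ F ∈ rsort⁻¹ T ] (q^ quinv F)) ≈ wt-q T))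
    × ((∀ (F : Filling n lam) → InFibre T F → inv F ℤ.+ quinv F ≡ area T)
    × (∀ (F G : Filling n lam) → InFibre T F → InFibre T G →
    inv F ℤ.+ quinv F ≡ inv G ℤ.+ quinv G))
corollary4 (suc n) _ lam part T =
  (↭⇒≈ (↭-trans inv-gf (↭-sym quinv-gf)) , ↭⇒≈ quinv-gf) ,
  inv+quinv≡area ,
  λ F G fF fG → trans (inv+quinv≡area F fF) (sym (inv+quinv≡area G fG))
  where
  -- The first row exists because `n` is positive; its length serves as `L`.
  open Enumeration part (λ r → part Fin.zero r z≤n) T
  inv-gf   = generating weights-inv inv inv-chain
  quinv-gf = generating weights-quinv quinv quinv-chain
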